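{- Let $M$ be a saturated model of a complete theory $T$. Then $T$ is NIP if and only if for every automorphism $\sigma\in\mathrm{Aut}(M)$ and every $\sigma$-invariant measure $\mu$ on $\langle \mathrm{Def}(M)\rangle$, the measure-theoretic entropy $h_\mu(\sigma)$ equals $0$.
   Context: $\mathrm{Def}(M)$ is the Boolean algebra of subsets of $M$ (in a fixed sort/tuple of variables) definable with parameters from $M$, and $\langle\mathrm{Def}(M)\rangle$ is the $\sigma$-algebra it generates. A measure on $\langle\mathrm{Def}(M)\rangle$ here means the unique countably additive extension of a Keisler measure (finitely additive probability measure) on $\mathrm{Def}(M)$; $\sigma$-invariant means $\mu(\sigma(D))=\mu(D)$. For a finite measurable partition $P$, $H(P)=-\sum_{C\in P}\mu(C)\log\mu(C)$, $h_\mu(\sigma,P)=\lim_{n\to\infty}\frac1n H\big(\bigvee_{i=0}^{n-1}\sigma^{ -i}(P)\big)$, and $h_\mu(\sigma)=\sup_P h_\mu(\sigma,P)$ over finite measurable partitions $P$.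
   Formalization: M is assumed not countably infinite: there Keisler measures need not extend to ⟨Def(M)⟩ and all measures are atomic, so the claim fails (countable random graph). The variable tuple is nonempty. -}

module Defs where

open import Level using (Level; 0ℓ; _⊔_) renaming (suc to lsuc)
open import Algebra.Structures using (IsCommutativeRing)
open import Data.Empty.Polymorphic using (⊥)
open import Data.Fin.Base using (Fin; remQuot)
import Data.Fin.Subset as FinSubset
open import Data.List.Base using (List)
open import Data.List.Relation.Unary.All using () renaming (All to ListAll)
open import Data.Nat.Base as ℕ using (ℕ; zero; suc)
open import Data.Nat.GeneralisedArithmetic using (fold)
open import Data.Product.Base using (Σ-syntax; ∃; ∃-syntax; _×_; proj₁; proj₂)
open import Data.Sum.Base using (_⊎_)
open import Data.Vec.Base as Vec using (Vec; []; _∷_; _++_; lookup)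
open import Data.Vec.Relation.Unary.All using () renaming (All to VecAll)
open import Function.Bundles using (_⇔_; _↔_; Inverse)
open import Function.Definitions using (Injective)
open import Relation.Binary.PropositionalEquality.Core using (_≡_; _≢_)
open import Relation.Binary.Structures using (IsTotalOrder)
open import Relation.Nullary.Negation.Core using (¬_)
open import Relation.Unary using (Pred; _∈_; _≐_; _∪_; _∩_; ∁; ⋃; _⊥′_)
open import Relation.Unary.Polymorphic using (U)

private
  variable
    a ℓ : Level

------------------------------------------------------------------------
-- Real numbers

-- A Dedekind-complete ordered field; it is unique up to isomorphism.
-- The value of 0# ⁻¹ is unspecified.
record RealNumbers : Set₁ where
  infix  4 _≤_ _<_
  infixl 6 _+_ _-_
  infixl 7 _*_
  infix  8 -_
  infix  9 _⁻¹
  field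
    ℝ                   : Set
    _+_ _*_             : ℝ → ℝ → ℝ
    -_ _⁻¹              : ℝ → ℝ
    0# 1#               : ℝ
    _≤_                 : ℝ → ℝ → Set
    isCommutativeRing   : IsCommutativeRing _≡_ _+_ _*_ -_ 0# 1#
    1≢0                 : 1# ≢ 0#
    *-inverseʳ          : ∀ x → x ≢ 0# → x * (x ⁻¹) ≡ 1#
    isTotalOrder        : IsTotalOrder _≡_ _≤_
    +-monoˡ-≤           : ∀ z {x y} → x ≤ y → x + z ≤ y + z
    *-nonNeg            : ∀ {x y} → 0# ≤ x → 0# ≤ y → 0# ≤ x * y

  IsUpperBound : Pred ℝ a → ℝ → Set a
  IsUpperBound S b = ∀ x → x ∈ S → x ≤ b

  IsSupremum : Pred ℝ a → ℝ → Set a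
  IsSupremum S s = IsUpperBound S s × (∀ b → IsUpperBound S b → s ≤ b)

  field
    complete : (S : Pred ℝ 0ℓ) → ∃ S → ∃ (IsUpperBound S) → ∃ (IsSupremum S)

  _<_ : ℝ → ℝ → Set
  x < y = x ≤ y × x ≢ y

  _-_ : ℝ → ℝ → ℝ
  x - y = x + (- y)

  fromℕ : ℕ → ℝ
  fromℕ zero    = 0#
  fromℕ (suc n) = 1# + fromℕ n

  ∑< : ℕ → (ℕ → ℝ) → ℝ
  ∑< zero    f = 0#
  ∑< (suc n) f = ∑< n f + f n

  ∑Fin : ∀ {n} → (Fin n → ℝ) → ℝ
  ∑Fin f = Vec.foldr _ _+_ 0# (Vec.tabulate f)

  ConvergesTo : (ℕ → ℝ) → ℝ → Set
  ConvergesTo s l =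
    ∀ ε → 0# < ε → ∃[ N ] (∀ n → N ℕ.≤ n → l - ε < s n × s n < l + ε)

  -- The strictly increasing homomorphisms from the positive reals under
  -- multiplication to the reals under addition are exactly the logarithms to
  -- a base greater than 1.  Values outside the positive reals are unspecified.
  record IsLogarithm (log : ℝ → ℝ) : Set where
    field
      log-*    : ∀ x y → 0# < x → 0# < y → log (x * y) ≡ log x + log y
      log-mono : ∀ x y → 0# < x → x < y → log x < log y

------------------------------------------------------------------------
-- First-order logic

record Language (ℓ : Level) : Set (lsuc ℓ) where
  field
    Fun : ℕ → Set ℓ
    Rel : ℕ → Set ℓ

module _ (L : Language ℓ) where
  open Language L

  data Term (n : ℕ) : Set ℓ where
    var : Fin n → Term n
    fun : ∀ {k} → Fun k → Vec (Term n) k → Term n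

  infixr 5 _⟹_

  -- Variables are de Bruijn indices: ∀′ binds index zero.
  data Formula (n : ℕ) : Set ℓ where
    _≈′_  : Term n → Term n → Formula n
    rel   : ∀ {k} → Rel k → Vec (Term n) k → Formula n
    false : Formula n
    _⟹_   : Formula n → Formula n → Formula n
    ∀′    : Formula (suc n) → Formula n

  Sentence : Set ℓ
  Sentence = Formula 0

  Theory : Set (lsuc ℓ)
  Theory = Pred Sentence ℓ

  record Structure : Set (lsuc ℓ) where
    field
      Domain   : Set ℓ
      nonempty : Domain
      ⟦fun⟧    : ∀ {k} → Fun k → Vec Domain k → Domain
      ⟦rel⟧    : ∀ {k} → Rel k → Vec Domain k → Set ℓ

module _ {L : Language ℓ} where

  ¬′_ : ∀ {n} → Formula L n → Formula L n
  ¬′ φ = φ ⟹ false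

  module _ (M : Structure L) where
    open Structure M

    mutual
      eval : ∀ {n} → Vec Domain n → Term L n → Domain
      eval v (var i)    = lookup v i
      eval v (fun f ts) = ⟦fun⟧ f (evals v ts)

      evals : ∀ {n k} → Vec Domain n → Vec (Term L n) k → Vec Domain k
      evals v []       = []
      evals v (t ∷ ts) = eval v t ∷ evals v ts

    Sat : ∀ {n} → Formula L n → Vec Domain n → Set ℓ
    Sat (s ≈′ t)   v = eval v s ≡ eval v t
    Sat (rel R ts) v = ⟦rel⟧ R (evals v ts)
    Sat false      v = ⊥
    Sat (φ ⟹ ψ)    v = Sat φ v → Sat ψ v
    Sat (∀′ φ)     v = ∀ x → Sat φ (x ∷ v)

    IsModelOf : Theory L → Set ℓ
    IsModelOf T = ∀ φ → φ ∈ T → Sat φ []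

  _⊨_ : Theory L → Sentence L → Set (lsuc ℓ)
  T ⊨ φ = (N : Structure L) → IsModelOf N T → Sat N φ []

  IsComplete : Theory L → Set (lsuc ℓ)
  IsComplete T =
    (Σ[ N ∈ Structure L ] IsModelOf N T) × (∀ φ → (T ⊨ φ) ⊎ (T ⊨ (¬′ φ)))

  -- φ(x;y) with x of length m and y of length n: in every model of T, for
  -- every p, some b₀,…,b_{p-1} are shattered by φ.
  HasIP : Theory L → ∀ m n → Formula L (m ℕ.+ n) → Set (lsuc ℓ)
  HasIP T m n φ =
    (N : Structure L) → IsModelOf N T → let open Structure N in
    ∀ p → Σ[ b ∈ (Fin p → Vec Domain n) ]
      ((S : FinSubset.Subset p) →
        Σ[ a ∈ Vec Domain m ]
          (∀ i → Sat N φ (a ++ b i) ⇔ i FinSubset.∈ S))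

  NIP : Theory L → Set (lsuc ℓ)
  NIP T = ∀ m n (φ : Formula L (m ℕ.+ n)) → ¬ HasIP T m n φ

  module _ (M : Structure L) where
    open Structure M

    -- A formula in k free variables with parameters from M.
    record FormulaWithParams (k : ℕ) : Set ℓ where
      field
        {arity} : ℕ
        formula : Formula L (k ℕ.+ arity)
        params  : Vec Domain arity

    _satisfies_ : ∀ {k} → Vec Domain k → FormulaWithParams k → Set ℓ
    x satisfies ψ = Sat M formula (x ++ params)
      where open FormulaWithParams ψ

    IsOver : ∀ {k} → Pred Domain ℓ → FormulaWithParams k → Set ℓ
    IsOver A ψ = VecAll A (FormulaWithParams.params ψ)

    -- |A| < |M|, stated as |M| ≰ |A|.  The injection is into Domain with
    -- image in A, since Σ Domain A may contain an element of A repeatedly.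
    IsSmall : Pred Domain ℓ → Set ℓ
    IsSmall A =
      ¬ (Σ[ f ∈ (Domain → Domain) ] Injective _≡_ _≡_ f × (∀ x → f x ∈ A))

    FinitelySatisfiable : ∀ {k} → Pred (FormulaWithParams k) ℓ → Set ℓ
    FinitelySatisfiable {k} p =
      (ψs : List (FormulaWithParams k)) → ListAll p ψs →
      ∃[ x ] ListAll (x satisfies_) ψs

    Realised : ∀ {k} → Pred (FormulaWithParams k) ℓ → Set ℓ
    Realised p = ∃[ x ] (∀ ψ → ψ ∈ p → x satisfies ψ)

    IsSaturated : Set (lsuc ℓ)
    IsSaturated =
      (A : Pred Domain ℓ) → IsSmall A →
      (p : Pred (FormulaWithParams 1) ℓ) → (∀ ψ → ψ ∈ p → IsOver A ψ) →
      FinitelySatisfiable p → Realised p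

    -- On subsets of a countably infinite saturated M, a non-realised type is a
    -- Keisler measure with no countably additive extension to ⟨ Def M k ⟩, and
    -- every countably additive measure is a sum of point masses, hence has zero
    -- entropy even when the theory has IP (e.g. the countable random graph).
    -- Every other saturated M is finite or ℵ₁-saturated, and every Keisler
    -- measure on it extends uniquely.
    IsCountablyInfinite : Set ℓ
    IsCountablyInfinite = ℕ ↔ Domain

    record Automorphism : Set ℓ where
      field
        bijection : Domain ↔ Domain
      open Inverse bijection public using (to; from)
      field
        preserves-fun : ∀ {k} (f : Language.Fun L k) xs →
                        to (⟦fun⟧ f xs) ≡ ⟦fun⟧ f (Vec.map to xs)
        preserves-rel : ∀ {k} (R : Language.Rel L k) xs →
                        ⟦rel⟧ R xs ⇔ ⟦rel⟧ R (Vec.map to xs)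

------------------------------------------------------------------------
-- Definable sets and the σ-algebra they generate

-- Proof irrelevance is not assumed, so sets are identified up to _≐_.
data ⟨_⟩ {X : Set ℓ} (𝒜 : Pred (Pred X ℓ) a) : Pred (Pred X ℓ) (a ⊔ lsuc ℓ) where
  generator  : ∀ {D} → D ∈ 𝒜 → D ∈ ⟨ 𝒜 ⟩
  complement : ∀ {D} → D ∈ ⟨ 𝒜 ⟩ → ∁ D ∈ ⟨ 𝒜 ⟩
  union      : ∀ {D : ℕ → Pred X ℓ} → (∀ i → D i ∈ ⟨ 𝒜 ⟩) → ⋃ ℕ D ∈ ⟨ 𝒜 ⟩
  resp-≐     : ∀ {D E} → D ≐ E → D ∈ ⟨ 𝒜 ⟩ → E ∈ ⟨ 𝒜 ⟩

module _ {L : Language ℓ} (M : Structure L) (k : ℕ) where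
  open Structure M

  Subset : Set (lsuc ℓ)
  Subset = Pred (Vec Domain k) ℓ

  Def : Pred Subset ℓ
  Def D = ∃[ ψ ] D ≐ (λ x → _satisfies_ M x ψ)

module _ {L : Language ℓ} {M : Structure L} {k : ℕ} where
  open Structure M

  image : Automorphism M → Subset M k → Subset M k
  image σ D y = ∃[ x ] x ∈ D × Vec.map (Automorphism.to σ) x ≡ y

  preimage^ : Automorphism M → ℕ → Subset M k → Subset M k
  preimage^ σ i D x = fold x (Vec.map (Automorphism.to σ)) i ∈ D

  -- Cells of a partition are listed by Fin m and may be empty; an empty cell
  -- contributes 0 · log 0 = 0 to the entropy.
  record IsMeasurablePartition {m} (P : Fin m → Subset M k) : Set (lsuc ℓ) where
    field
      measurable : ∀ c → P c ∈ ⟨ Def M k ⟩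
      disjoint   : ∀ c d → c ≢ d → P c ⊥′ P d
      covers     : ∀ x → ∃[ c ] x ∈ P c

  infixr 6 _∨_
  _∨_ : ∀ {m n} → (Fin m → Subset M k) → (Fin n → Subset M k) →
        Fin (m ℕ.* n) → Subset M k
  _∨_ {m} {n} P Q c = P (proj₁ (remQuot {m} n c)) ∩ Q (proj₂ (remQuot {m} n c))

  -- The join of σ⁻ⁱ(P) over 0 ≤ i < n.
  iteratedJoin : ∀ {m} → Automorphism M → (Fin m → Subset M k) →
                 ∀ n → Fin (m ℕ.^ n) → Subset M k
  iteratedJoin σ P zero    = λ _ → U
  iteratedJoin σ P (suc n) = (λ c → preimage^ σ n (P c)) ∨ iteratedJoin σ P n

FinitePartition : {L : Language ℓ} (M : Structure L) (k : ℕ) → Set (lsuc ℓ)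
FinitePartition M k =
  ∃[ n ] Σ[ P ∈ (Fin n → Subset M k) ] IsMeasurablePartition {M = M} P

------------------------------------------------------------------------
-- Measures and entropy

module _ (𝓡 : RealNumbers) {L : Language ℓ} (M : Structure L) (k : ℕ) where
  open RealNumbers 𝓡

  -- Set functions are total; only their values on Def (for Keisler measures)
  -- or on ⟨ Def ⟩ (for measures) are constrained and used.
  record IsKeislerMeasure (μ : Subset M k → ℝ) : Set (lsuc ℓ) where
    field
      cong     : ∀ {D E} → D ∈ Def M k → E ∈ Def M k → D ≐ E → μ D ≡ μ E
      nonNeg   : ∀ {D} → D ∈ Def M k → 0# ≤ μ D
      total    : μ U ≡ 1#
      additive : ∀ {D E} → D ∈ Def M k → E ∈ Def M k → D ⊥′ E →
                 μ (D ∪ E) ≡ μ D + μ E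

  -- A countably additive μ on ⟨ Def ⟩ extending the Keisler measure μ ↾ Def.
  record Measure : Set (lsuc ℓ) where
    field
      μ          : Subset M k → ℝ
      isKeisler  : IsKeislerMeasure μ
      cong       : ∀ {D E} → D ∈ ⟨ Def M k ⟩ → E ∈ ⟨ Def M k ⟩ → D ≐ E → μ D ≡ μ E
      nonNeg     : ∀ {D} → D ∈ ⟨ Def M k ⟩ → 0# ≤ μ D
      σ-additive : (D : ℕ → Subset M k) → (∀ i → D i ∈ ⟨ Def M k ⟩) →
                   (∀ i j → i ≢ j → D i ⊥′ D j) →
                   ConvergesTo (λ n → ∑< n (λ i → μ (D i))) (μ (⋃ ℕ D))

module _ (𝓡 : RealNumbers) {L : Language ℓ} {M : Structure L} {k : ℕ} where
  open RealNumbers 𝓡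

  IsInvariant : Automorphism M → Measure 𝓡 M k → Set (lsuc ℓ)
  IsInvariant σ m = ∀ D → D ∈ ⟨ Def M k ⟩ → μ (image σ D) ≡ μ D
    where open Measure m

  module _ (log : ℝ → ℝ) (m : Measure 𝓡 M k) where
    open Measure m

    H : ∀ {n} → (Fin n → Subset M k) → ℝ
    H P = - ∑Fin (λ c → μ (P c) * log (μ (P c)))

    -- h = h_μ(σ,P); the term at n = 0 plays no role.
    IsEntropyOfPartition : Automorphism M → ∀ {n} → (Fin n → Subset M k) → ℝ → Set
    IsEntropyOfPartition σ P h =
      ConvergesTo (λ n → fromℕ n ⁻¹ * H (iteratedJoin σ P n)) h

    -- h = h_μ(σ): all the limits h_μ(σ,P) exist and h is their supremum.
    IsEntropy : Automorphism M → ℝ → Set (lsuc ℓ)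
    IsEntropy σ h =
      Σ[ hP ∈ (FinitePartition M k → ℝ) ]
        (∀ P → IsEntropyOfPartition σ (proj₁ (proj₂ P)) (hP P)) ×
        IsSupremum (λ r → ∃[ P ] r ≡ hP P) h

{-# OPTIONS --safe #-}
module Submission where

-- NIP ⇒ zero entropy.  A measurable partition P agrees, off a set E of small measure, with one given
-- by definable sets D_c.  By NIP and Sauer–Shelah only polynomially many D-names of length n occur,
-- so every P-name of length n is one of polynomially many centres changed at the visits to E.
-- Mixing, over the centres, product measures concentrated near them gives a probability vector q on
-- names, and H ≤ O(1) − Σ μ(w) log q(w) (by log t ≤ t log 2) is at most o(n) + n·(small).
--
-- Zero entropy ⇒ NIP.  If T has IP, M is uncountable, hence ℵ₁-saturated.  A Morley sequence (cᵢ) of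
-- a coheir is an indiscernible sequence all of whose patterns are realised; it first serves to
-- reduce to a formula φ(x;y) in one variable x, and then c_{i+1} ↦ cᵢ extends to an automorphism σ
-- by homogeneity.  Choosing the pattern of x over (cᵢ) by fair coin tosses and averaging along σ,
-- an ultralimit is a σ-invariant Keisler measure making the sets φ(x;cᵢ) independent of measure 1/2;
-- by ℵ₁-saturation it extends to a countably additive measure, and its entropy is at least log 2.

open import Defs
open import Axiom.ExcludedMiddle using (ExcludedMiddle)
open import Axiom.Extensionality.Propositional using (Extensionality)
open import Level using (0ℓ; Lift; lift; lower; _⊔_) renaming (suc to lsuc)
open import Data.Bool.Base using (Bool; true; false; not; if_then_else_) renaming (_∨_ to _or_)
open import Data.Empty using (⊥; ⊥-elim)
open import Data.Unit.Base using (⊤)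
open import Data.Fin.Base as Fin using (Fin; zero; suc; toℕ; fromℕ<; combine; remQuot)
import Data.Fin.Properties as Fin
open import Data.Nat.Base as ℕ using (ℕ; zero; suc; NonZero; z≤n; s≤s)
import Data.Nat.Properties as ℕ
open import Data.Nat.GeneralisedArithmetic using (fold)
open import Data.Product.Base using (Σ-syntax; ∃; ∃-syntax; _×_; _,_; proj₁; proj₂; map₂)
open import Data.Sum.Base using (_⊎_; inj₁; inj₂; [_,_]′)
open import Data.Maybe.Base using (Maybe; just; nothing)
open import Data.Maybe.Properties using (just-injective)
open import Data.List.Base as List using (List; []; _∷_)
open import Data.List.Relation.Unary.All as ListAll using ([]; _∷_) renaming (All to ListAll)
import Data.List.Relation.Unary.All.Properties as ListAll
open import Data.Vec.Base as Vec using (Vec; []; _∷_; _++_; lookup)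
import Data.Vec.Properties as Vec
open import Data.Vec.Relation.Unary.All as VecAll using ([]; _∷_) renaming (All to VecAll)
import Data.Vec.Relation.Unary.All.Properties as VecAll
open import Function.Base using (_∘_; id; case_of_; flip)
open import Function.Bundles using (_⇔_; _↔_; Equivalence; mk⇔; mk↔ₛ′; Inverse)
open import Function.Definitions using (Injective)
open import Induction.WellFounded using (WellFounded; Acc; acc)
open import Relation.Binary.PropositionalEquality using (_≡_; _≢_; refl; sym; trans; cong; cong₂; subst; subst₂)
open import Relation.Nullary using (¬_; yes; no; does)
open import Relation.Binary.Definitions using (tri<; tri≈; tri>)
import Relation.Binary.Construct.On as On
open import Data.Nat.Induction using (<-wellFounded)
open import Relation.Unary using (Pred; _∈_; _≐_; _∪_; _∩_; ∁; ⋃; _⊥′_)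
open import Relation.Unary.Polymorphic using (U)
open import Algebra.Bundles using (CommutativeRing)
import Algebra.Properties.Ring
import Algebra.Properties.AbelianGroup
import Algebra.Solver.Ring
open import Algebra.Solver.Ring.AlmostCommutativeRing using (AlmostCommutativeRing; fromCommutativeRing; _-Raw-AlmostCommutative⟶_)
open import Data.Integer.Base as ℤ using (ℤ)
import Data.Integer.Properties as ℤ
import Data.Sign.Base as Sign
open import Relation.Binary.Structures using (IsTotalOrder)
open import Data.List.Relation.Unary.Any as ListAny using (here) renaming (Any to ListAny)
import Data.List.Relation.Unary.Any.Properties as ListAny
import Data.List.Properties as List

-- Three obstacles shape the converse. The number of variables of the measure is fixed, while a
-- formula with IP may have more object variables; hence the passage to one variable, padded
-- afterwards to any positive number. Smallness of `A` means that the whole domain does not inject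
-- into `A`, so extending a countable elementary map takes a back-and-forth along an initial
-- well-order of the domain, and the relation built up to any stage must be shown small: this is
-- what the order-theoretic part is for. Finally, the points chosen for the coin-toss patterns need
-- not be permuted by σ, so the coin-toss charge has σ-independent values only on the sets built
-- from the φ(x;cᵢ); averaging makes it invariant everywhere and keeps those values. In the other
-- direction names are priced rather than counted: the number of visits to E varies from point to
-- point, and only its mean n·μ(E) is controlled. The bound on -log q is linear in that number, so
-- the mean is enough. Entropies are also nonnegative, so the limits exist by squeezing. Excluded
-- middle applied to an existential type returns a witness; this is the source of all choices.

module Classical (em : ∀ {a} → ExcludedMiddle a) where

  -- Truth values as booleans: this makes subsets of X : Set a elements of Set a.
  ⌊_⌋ : ∀ {a} → Set a → Bool
  ⌊ P ⌋ = does (em {P = P})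

  truth : ∀ {a} {P : Set a} → ⌊ P ⌋ ≡ true → P
  truth {P = P} eq with em {P = P}
  ... | yes p = p

  holds : ∀ {a} {P : Set a} → P → ⌊ P ⌋ ≡ true
  holds {P = P} p with em {P = P}
  ... | yes _ = refl
  ... | no ¬p = ⊥-elim (¬p p)

  fails : ∀ {a} {P : Set a} → ¬ P → ⌊ P ⌋ ≡ false
  fails {P = P} ¬p with em {P = P}
  ... | yes p = ⊥-elim (¬p p)
  ... | no _  = refl

  ⌊⌋-cong : ∀ {a b} {P : Set a} {Q : Set b} → (P → Q) → (Q → P) → ⌊ P ⌋ ≡ ⌊ Q ⌋
  ⌊⌋-cong {P = P} f g with em {P = P}
  ... | yes p = sym (holds (f p))
  ... | no ¬p = sym (fails (¬p ∘ g))

  dne : ∀ {a} {P : Set a} → ¬ ¬ P → P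
  dne {P = P} ¬¬p with em {P = P}
  ... | yes p = p
  ... | no ¬p = ⊥-elim (¬¬p ¬p)

  ¬∀⇒∃¬ : ∀ {a b} {A : Set a} {P : A → Set b} → ¬ (∀ x → P x) → ∃[ x ] ¬ P x
  ¬∀⇒∃¬ ¬all = dne λ ¬ex → ¬all λ x → dne λ ¬px → ¬ex (x , ¬px)

  ≡-bool : ∀ {a b : Bool} → (a ≡ true → b ≡ true) → (b ≡ true → a ≡ true) → a ≡ b
  ≡-bool {true}  {b}     f g = sym (f refl)
  ≡-bool {false} {true}  f g = g refl
  ≡-bool {false} {false} f g = refl

  true≢false : ∀ {b : Bool} → b ≡ true → b ≡ false → ⊥
  true≢false refl ()

  or-true : ∀ {x y : Bool} → x or y ≡ true → x ≡ true ⊎ y ≡ true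
  or-true {true}  _ = inj₁ refl
  or-true {false} p = inj₂ p

  or-trueˡ : ∀ {x y : Bool} → x ≡ true → x or y ≡ true
  or-trueˡ refl = refl

  or-trueʳ : ∀ {x y : Bool} → y ≡ true → x or y ≡ true
  or-trueʳ {true}  _ = refl
  or-trueʳ {false} p = p

  not-true : ∀ {x : Bool} → ¬ (x ≡ true) → x ≡ false
  not-true {true}  p = ⊥-elim (p refl)
  not-true {false} p = refl

  record WellOrder {a} (X : Set a) : Set (lsuc a) where
    infix 4 _≺_
    field
      _≺_     : X → X → Set
      ≺-trans : ∀ {x y z} → x ≺ y → y ≺ z → x ≺ z
      ≺-cmp   : ∀ x y → x ≺ y ⊎ x ≡ y ⊎ y ≺ x
      ≺-wf    : WellFounded _≺_

    ≺-irrefl : ∀ {x} → ¬ (x ≺ x)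
    ≺-irrefl {x} = go (≺-wf x)
      where
      go : ∀ {x} → Acc _≺_ x → ¬ (x ≺ x)
      go (acc rs) x≺x = go (rs x≺x) x≺x

    ≺-asym : ∀ {x y} → x ≺ y → ¬ (y ≺ x)
    ≺-asym p q = ≺-irrefl (≺-trans p q)

    least : ∀ {b} (P : X → Set b) → ∃ P → ∃[ x ] P x × (∀ y → y ≺ x → ¬ P y)
    least P (x₀ , px₀) = go x₀ (≺-wf x₀) px₀
      where
      go : ∀ x → Acc _≺_ x → P x → ∃[ x ] P x × (∀ y → y ≺ x → ¬ P y)
      go x (acc rs) px with em {P = ∃[ y ] y ≺ x × P y}
      ... | yes (y , y≺x , py) = go y (rs y≺x) py
      ... | no none            = x , px , λ y y≺x py → none (y , y≺x , py)

  <-wellOrder : WellOrder ℕ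
  <-wellOrder = record
    { _≺_     = ℕ._<_
    ; ≺-trans = ℕ.<-trans
    ; ≺-cmp   = cmp
    ; ≺-wf    = <-wellFounded
    }
    where
    cmp : ∀ x y → x ℕ.< y ⊎ x ≡ y ⊎ y ℕ.< x
    cmp x y with ℕ.<-cmp x y
    ... | tri< p _ _ = inj₁ p
    ... | tri≈ _ p _ = inj₂ (inj₁ p)
    ... | tri> _ _ p = inj₂ (inj₂ p)

-- The well-ordering theorem

module Zermelo (em : ∀ {a} → ExcludedMiddle a) (ext : ∀ {a b} → Extensionality a b) where
  open Classical em

  module Tower {a} (X : Set a) where
    Sub : Set a
    Sub = X → Bool

    infix 4 _⊆_
    _⊆_ : Sub → Sub → Set a
    A ⊆ B = ∀ x → A x ≡ true → B x ≡ true

    antisym : ∀ {A B} → A ⊆ B → B ⊆ A → A ≡ B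
    antisym f g = ext λ x → ≡-bool (f x) (g x)

    -- A choice function on proper subsets: a positive answer of excluded middle carries the point
    -- outside `A`.
    pick : Sub → Maybe X
    pick A with em {P = ∃[ x ] A x ≡ false}
    ... | yes (x , _) = just x
    ... | no _        = nothing

    pick-fresh : ∀ A {x} → pick A ≡ just x → A x ≡ false
    pick-fresh A eq with em {P = ∃[ x ] A x ≡ false}
    pick-fresh A refl | yes (x , p) = p

    pick-just : ∀ A {x} → A x ≡ false → ∃[ z ] pick A ≡ just z
    pick-just A {x} p with em {P = ∃[ x ] A x ≡ false}
    ... | yes (z , _) = z , refl
    ... | no none     = ⊥-elim (none (x , p))

    next : Sub → Sub
    next A x = A x or ⌊ pick A ≡ just x ⌋

    ⊆next : ∀ {A} → A ⊆ next A
    ⊆next x p = or-trueˡ p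

    ⋃ᵇ : (Sub → Bool) → Sub
    ⋃ᵇ F x = ⌊ (∃[ A ] F A ≡ true × A x ≡ true) ⌋

    -- Zermelo's tower; its members will be the initial segments of the order. Families are
    -- boolean-valued so that `T` stays in the universe of `X`.
    data T : Sub → Set a where
      step : ∀ {A} → T A → T (next A)
      sup  : (F : Sub → Bool) → (∀ A → F A ≡ true → T A) → T (⋃ᵇ F)

    ⊆⋃ : ∀ {F A} → F A ≡ true → A ⊆ ⋃ᵇ F
    ⊆⋃ {A = A} fa x p = holds (A , fa , p)

    ⋃⊆ : ∀ {F B} → (∀ A → F A ≡ true → A ⊆ B) → ⋃ᵇ F ⊆ B
    ⋃⊆ h x p = let (A , fa , q) = truth p in h A fa x q

    -- No tower set fits strictly between a proper tower subset `C` of `B` and `next C` sticking out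
    -- of `B`. `compare` shows that such a `B` is comparable with the whole tower, and `gap` that
    -- every tower set is of this kind; together they give linearity.
    Gap : Sub → Set a
    Gap B = ∀ C → T C → C ⊆ B → B ⊆ C ⊎ next C ⊆ B

    compare : ∀ {B} → Gap B → ∀ {A} → T A → A ⊆ B ⊎ next B ⊆ A
    compare gap (step {A} tA) with compare gap tA
    ... | inj₂ B′⊆A = inj₂ λ x p → ⊆next x (B′⊆A x p)
    ... | inj₁ A⊆B with gap A tA A⊆B
    ...   | inj₁ B⊆A  = inj₂ λ x p → subst (λ C → next C x ≡ true) (antisym B⊆A A⊆B) p
    ...   | inj₂ A′⊆B = inj₁ A′⊆B
    compare {B} gap (sup F t) with em {P = ∃[ A ] F A ≡ true × next B ⊆ A}
    ... | yes (A , fa , B′⊆A) = inj₂ λ x p → ⊆⋃ fa x (B′⊆A x p)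
    ... | no none = inj₁ (⋃⊆ λ A fa → [ id , (λ q → ⊥-elim (none (A , fa , q))) ]′ (compare gap (t A fa)))

    gap : ∀ {B} → T B → Gap B
    gap (step {B} tB) C tC C⊆B′ with compare (gap tB) tC
    ... | inj₂ B′⊆C = inj₁ B′⊆C
    ... | inj₁ C⊆B with gap tB C tC C⊆B
    ...   | inj₁ B⊆C  = inj₂ λ x p → subst (λ D → next D x ≡ true) (antisym C⊆B B⊆C) p
    ...   | inj₂ C′⊆B = inj₂ λ x p → ⊆next x (C′⊆B x p)
    gap (sup F t) C tC C⊆ with em {P = ∃[ A ] F A ≡ true × ¬ (A ⊆ C)}
    ... | no none = inj₁ (⋃⊆ λ A fa → dne λ A⊈C → none (A , fa , A⊈C))
    ... | yes (A , fa , A⊈C) with compare (gap (t A fa)) tC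
    ...   | inj₂ A′⊆C = ⊥-elim (A⊈C λ x p → A′⊆C x (⊆next x p))
    ...   | inj₁ C⊆A with gap (t A fa) C tC C⊆A
    ...     | inj₁ A⊆C  = ⊥-elim (A⊈C A⊆C)
    ...     | inj₂ C′⊆A = inj₂ λ x p → ⊆⋃ fa x (C′⊆A x p)

    linear : ∀ {A B} → T A → T B → A ⊆ B ⊎ B ⊆ A
    linear tA tB with compare (gap tB) tA
    ... | inj₁ A⊆B  = inj₁ A⊆B
    ... | inj₂ B′⊆A = inj₂ λ x p → B′⊆A x (⊆next x p)

    avoiding : X → Sub → Bool
    avoiding x A = ⌊ T A × A x ≡ false ⌋

    -- The largest tower set avoiding `x`. If its next pick were not `x`, the following tower set
    -- would avoid `x` too; so `x` comes right after it and it consists of the predecessors of `x`.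
    below : X → Sub
    below x = ⋃ᵇ (avoiding x)

    T-below : ∀ x → T (below x)
    T-below x = sup _ λ A p → proj₁ (truth p)

    x∉below : ∀ x → below x x ≡ false
    x∉below x = fails λ (A , fa , ax) → true≢false ax (proj₂ (truth fa))

    pick-below : ∀ x → pick (below x) ≡ just x
    pick-below x with em {P = pick (below x) ≡ just x}
    ... | yes p = p
    ... | no ¬p =
      let (z , eq) = pick-just (below x) (x∉below x)
          avoid : next (below x) x ≡ false
          avoid = not-true λ q → [ (λ r → true≢false r (x∉below x)) , ¬p ∘ truth ]′ (or-true q)
      in ⊥-elim (true≢false (⊆⋃ (holds (step (T-below x) , avoid)) z (or-trueʳ (holds eq)))
                            (pick-fresh (below x) eq))

    x∈next-below : ∀ x → next (below x) x ≡ true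
    x∈next-below x = or-trueʳ (holds (pick-below x))

    -- Induction over the tower: by linearity, everything below the point added to `A` already lies
    -- in `A`.
    below-acc : ∀ {A} → T A → ∀ x → A x ≡ true → Acc (λ x y → below y x ≡ true) x
    below-acc (sup F t) x p = let (A , fa , q) = truth p in below-acc (t A fa) x q
    below-acc (step {A} tA) x p with or-true p
    ... | inj₁ q = below-acc tA x q
    ... | inj₂ q = acc λ {y} r → below-acc tA y (inside y r)
      where
      inside : below x ⊆ A
      inside y r with linear (step tA) (T-below x)
      ... | inj₁ A′⊆ = ⊥-elim (true≢false (A′⊆ x p) (x∉below x))
      ... | inj₂ ⊆A′ with or-true (⊆A′ y r)
      ...   | inj₁ s = s
      ...   | inj₂ s with trans (sym (truth q)) (truth s)
      ...     | refl = ⊥-elim (true≢false r (x∉below x))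

    wellOrder : WellOrder X
    wellOrder = record
      { _≺_     = λ x y → below y x ≡ true
      ; ≺-trans = λ {x} {y} {z} x≺y y≺z →
          [ (λ ⊆ → ⊆ x x≺y) , (λ ⊇ → ⊥-elim (true≢false (⊇ y y≺z) (x∉below y))) ]′
            (linear (T-below y) (T-below z))
      ; ≺-cmp   = cmp
      ; ≺-wf    = λ x → below-acc (step (T-below x)) x (x∈next-below x)
      }
      where
      cmp′ : ∀ x y → below x ⊆ below y → below y x ≡ true ⊎ x ≡ y
      cmp′ x y x⊆y with gap (T-below y) _ (T-below x) x⊆y
      ... | inj₂ x′⊆y = inj₁ (x′⊆y x (x∈next-below x))
      ... | inj₁ y⊆x = inj₂ (just-injective
        (trans (sym (pick-below x)) (trans (cong pick (antisym x⊆y y⊆x)) (pick-below y))))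
      cmp : ∀ x y → below y x ≡ true ⊎ x ≡ y ⊎ below x y ≡ true
      cmp x y with linear (T-below x) (T-below y)
      ... | inj₁ x⊆y = [ inj₁ , inj₂ ∘ inj₁ ]′ (cmp′ x y x⊆y)
      ... | inj₂ y⊆x = [ inj₂ ∘ inj₂ , inj₂ ∘ inj₁ ∘ sym ]′ (cmp′ y x y⊆x)

  open Tower public using (wellOrder)

-- Initial well-orders and the size of their segments

module Cardinal (em : ∀ {a} → ExcludedMiddle a) (ext : ∀ {a b} → Extensionality a b) where
  open Classical em
  open Zermelo em ext

  Into : ∀ {a b p} (X : Set a) {Y : Set b} → (Y → Set p) → Set (a ⊔ b ⊔ p)
  Into X {Y} P = Σ[ f ∈ (X → Y) ] Injective _≡_ _≡_ f × (∀ x → P (f x))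

  -- If `X` embeds in some proper segment, take the least `x` for which it does and pull the order
  -- back along the embedding. A further embedding of `X` below `a` would give one below `f a`,
  -- which precedes `x`.
  initialWellOrder : ∀ {a} (X : Set a) →
    Σ[ W ∈ WellOrder X ] (∀ x → ¬ Into X (λ y → WellOrder._≺_ W y x))
  initialWellOrder X with em {P = ∃[ x ] Into X (λ y → WellOrder._≺_ (wellOrder X) y x)}
  ... | no none  = wellOrder X , λ x i → none (x , i)
  ... | yes some with WellOrder.least (wellOrder X) (λ x → Into X (λ y → WellOrder._≺_ (wellOrder X) y x)) some
  ...   | x , (f , f-inj , f≺x) , minimal =
      record
        { _≺_     = λ a b → f a ≺ f b
        ; ≺-trans = ≺-trans
        ; ≺-cmp   = λ a b → [ inj₁ , [ inj₂ ∘ inj₁ ∘ f-inj , inj₂ ∘ inj₂ ]′ ]′ (≺-cmp (f a) (f b))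
        ; ≺-wf    = On.wellFounded f ≺-wf
        }
    , λ a (g , g-inj , g≺a) → minimal (f a) (f≺x a) (f ∘ g , g-inj ∘ f-inj , g≺a)
    where open WellOrder (wellOrder X)

  abstract
    code : ℕ → ℕ → ℕ
    code m j = (m ℕ.+ j) ℕ.* (m ℕ.+ j) ℕ.+ m

    -- With s = m + j, the value s² + m lies in the interval [s², (s+1)²), which determines s.
    code-< : ∀ m j m′ j′ → m ℕ.+ j ℕ.< m′ ℕ.+ j′ → code m j ℕ.< code m′ j′
    code-< m j m′ j′ lt = ℕ.<-≤-trans (ℕ.≤-<-trans (ℕ.+-monoʳ-≤ (s ℕ.* s) (ℕ.m≤m+n m j)) square)
      (ℕ.≤-trans (ℕ.*-mono-≤ lt lt) (ℕ.m≤m+n _ m′))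
      where
      s : ℕ
      s = m ℕ.+ j
      square : s ℕ.* s ℕ.+ s ℕ.< suc s ℕ.* suc s
      square = subst (ℕ._< suc s ℕ.* suc s) (ℕ.+-comm s (s ℕ.* s)) (ℕ.*-monoʳ-< (suc s) ℕ.≤-refl)

    code-sum : ∀ {m j m′ j′} → code m j ≡ code m′ j′ → m ℕ.+ j ≡ m′ ℕ.+ j′
    code-sum {m} {j} {m′} {j′} eq with ℕ.<-cmp (m ℕ.+ j) (m′ ℕ.+ j′)
    ... | tri< p _ _ = ⊥-elim (ℕ.<⇒≢ (code-< m j m′ j′ p) eq)
    ... | tri≈ _ p _ = p
    ... | tri> _ _ p = ⊥-elim (ℕ.<⇒≢ (code-< m′ j′ m j p) (sym eq))

    code-injective : ∀ {m j m′ j′} → code m j ≡ code m′ j′ → m ≡ m′ × j ≡ j′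
    code-injective {m} {j} {m′} {j′} eq = m≡ , ℕ.+-cancelˡ-≡ m j j′ (trans s≡ (cong (ℕ._+ j′) (sym m≡)))
      where
      s≡ : m ℕ.+ j ≡ m′ ℕ.+ j′
      s≡ = code-sum {m} {j} {m′} {j′} eq
      m≡ : m ≡ m′
      m≡ = ℕ.+-cancelˡ-≡ ((m ℕ.+ j) ℕ.* (m ℕ.+ j)) m m′ (trans eq (cong (λ s → s ℕ.* s ℕ.+ m′) (sym s≡)))

  module Segments {a} {X : Set a} (W : WellOrder X)
    (initial : ∀ x → ¬ Into X (λ y → WellOrder._≺_ W y x))
    (uncountable : ¬ (Σ[ f ∈ (X → ℕ) ] Injective _≡_ _≡_ f)) where
    open WellOrder W

    _⋖_ : X → X → Set a
    y ⋖ x = y ≺ x × (∀ z → y ≺ z → ¬ (z ≺ x))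

    ⋖-unique : ∀ {x y y′} → y ⋖ x → y′ ⋖ x → y ≡ y′
    ⋖-unique {x} {y} {y′} (p , g) (q , h) with ≺-cmp y y′
    ... | inj₁ r        = ⊥-elim (g y′ r q)
    ... | inj₂ (inj₁ r) = r
    ... | inj₂ (inj₂ r) = ⊥-elim (h y r p)

    ⋖-functional : ∀ {x x′ y} → y ⋖ x → y ⋖ x′ → x ≡ x′
    ⋖-functional {x} {x′} (p , g) (q , h) with ≺-cmp x x′
    ... | inj₁ r        = ⊥-elim (h x p r)
    ... | inj₂ (inj₁ r) = r
    ... | inj₂ (inj₂ r) = ⊥-elim (g x′ q r)

    -- The least element counts as a limit, so that every point is in exactly one way a limit
    -- followed by finitely many successors.
    Limit : X → Set a
    Limit μ = ∀ y → ¬ (y ⋖ μ)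

    data Iter (μ : X) : ℕ → X → Set a where
      here : Iter μ 0 μ
      succ : ∀ {m y x} → Iter μ m y → y ⋖ x → Iter μ (suc m) x

    iter-functional : ∀ {μ m x x′} → Iter μ m x → Iter μ m x′ → x ≡ x′
    iter-functional here       here       = refl
    iter-functional (succ i p) (succ j q) with iter-functional i j
    ... | refl = ⋖-functional p q

    iter-unique : ∀ {μ μ′ m m′ x} → Limit μ → Limit μ′ → Iter μ m x → Iter μ′ m′ x → μ ≡ μ′ × m ≡ m′
    iter-unique l l′ here       here       = refl , refl
    iter-unique l l′ here       (succ j q) = ⊥-elim (l _ q)
    iter-unique l l′ (succ i p) here       = ⊥-elim (l′ _ p)
    iter-unique l l′ (succ i p) (succ j q) with ⋖-unique p q
    ... | refl = map₂ (cong suc) (iter-unique l l′ i j)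

    iter-≽ : ∀ {μ m x} → Iter μ m x → ¬ (x ≺ μ)
    iter-≽ here                 = ≺-irrefl
    iter-≽ (succ i (y≺x , _)) p = iter-≽ i (≺-trans y≺x p)

    decompose : ∀ x → ∃[ μ ] ∃[ m ] Limit μ × Iter μ m x
    decompose x = go x (≺-wf x)
      where
      go : ∀ x → Acc _≺_ x → ∃[ μ ] ∃[ m ] Limit μ × Iter μ m x
      go x (acc rs) with em {P = ∃[ y ] y ⋖ x}
      ... | no none     = x , 0 , (λ y p → none (y , p)) , here
      ... | yes (y , p) = let (μ , m , l , i) = go y (rs (proj₁ p)) in μ , suc m , l , succ i p

    iterate : ∀ {ν μ} → Limit ν → μ ≺ ν → ∀ m → ∃[ x ] Iter μ m x × x ≺ ν
    iterate l μ≺ν zero    = _ , here , μ≺ν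
    iterate {ν} l μ≺ν (suc m) with iterate l μ≺ν m
    ... | y , i , y≺ν with least (y ≺_) (ν , y≺ν)
    ...   | z , y≺z , min with ≺-cmp z ν
    ...     | inj₁ z≺ν        = z , succ i (y≺z , λ w p q → min w q p) , z≺ν
    ...     | inj₂ (inj₁ refl) = ⊥-elim (l y (y≺z , λ w p q → min w q p))
    ...     | inj₂ (inj₂ ν≺z) = ⊥-elim (min ν ν≺z y≺ν)

    -- Writing α = ν + n with ν a limit, {x ≼ α} × ℕ is countable when ν = 0,
    -- and otherwise embeds in {x ≺ ν} by (μ + m , j) ↦ μ + code m j, where for μ = ν a smaller limit replaces μ.
    closedSegment-small : ∀ α → ¬ Into X (λ (p : X × ℕ) → ¬ (α ≺ proj₁ p))
    closedSegment-small α (f , f-inj , f≼α) = caseν (decompose α)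
      where
      limitOf : X → X
      limitOf y = proj₁ (decompose (proj₁ (f y)))
      height : X → ℕ
      height y = proj₁ (proj₂ (decompose (proj₁ (f y))))
      limit : ∀ y → Limit (limitOf y)
      limit y = proj₁ (proj₂ (proj₂ (decompose (proj₁ (f y)))))
      iter : ∀ y → Iter (limitOf y) (height y) (proj₁ (f y))
      iter y = proj₂ (proj₂ (proj₂ (decompose (proj₁ (f y)))))
      key : X → ℕ
      key y = code (height y) (proj₂ (f y))
      same : ∀ {y y′} → limitOf y ≡ limitOf y′ → key y ≡ key y′ → y ≡ y′
      same {y} {y′} l≡ k≡ =
        let (h≡ , j≡) = code-injective k≡
        in f-inj (cong₂ _,_ (iter-functional (iter y) (subst₂ (λ l h → Iter l h _) (sym l≡) (sym h≡) (iter y′))) j≡)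
      side : ∀ {ν n} → Iter ν n α → ∀ y → limitOf y ≺ ν ⊎ limitOf y ≡ ν
      side {ν} {n} ν-iter y with ≺-cmp (limitOf y) ν
      ... | inj₁ p        = inj₁ p
      ... | inj₂ (inj₁ p) = inj₂ p
      -- A limit above `ν` exceeds every finite successor of `ν`, hence `α`; then so does
      -- `proj₁ (f y)`, which is at least that limit.
      ... | inj₂ (inj₂ p) with iterate (limit y) p n
      ...   | x , i , x≺ with iter-functional i ν-iter
      ...     | refl with ≺-cmp (proj₁ (f y)) (limitOf y)
      ...       | inj₁ q        = ⊥-elim (iter-≽ (iter y) q)
      ...       | inj₂ (inj₁ q) = ⊥-elim (f≼α y (subst (α ≺_) (sym q) x≺))
      ...       | inj₂ (inj₂ q) = ⊥-elim (f≼α y (≺-trans x≺ q))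
      caseν : (∃[ ν ] ∃[ n ] Limit ν × Iter ν n α) → ⊥
      caseν (ν , n , ν-lim , ν-iter) with em {P = ∃[ o ] o ≺ ν}
      ... | no least-ν = uncountable (key , λ {y} {y′} → same (trans (at-ν y) (sym (at-ν y′))))
        where
        at-ν : ∀ y → limitOf y ≡ ν
        at-ν y = [ (λ p → ⊥-elim (least-ν (_ , p))) , id ]′ (side ν-iter y)
      ... | yes (o , o≺ν) =
        initial ν ((λ y → proj₁ (hit y)) , (λ {y} {y′} eq → hit-inj {y} {y′} (proj₁ (proj₂ (hit y)))
          (subst (Hit y′) (sym eq) (proj₁ (proj₂ (hit y′))))) , λ y → proj₂ (proj₂ (hit y)))
        where
        below-ν : ∃[ z ] Limit z × z ≺ ν
        below-ν with decompose o
        ... | z , m , z-lim , i with ≺-cmp z o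
        ...   | inj₁ p           = z , z-lim , ≺-trans p o≺ν
        ...   | inj₂ (inj₁ refl) = z , z-lim , o≺ν
        ...   | inj₂ (inj₂ p)    = ⊥-elim (iter-≽ i p)
        z : X
        z = proj₁ below-ν
        -- The tags 0 and 1 separate the points that keep their limit from those moved from `ν` to
        -- `z`.
        Hit : X → X → Set a
        Hit y x = Iter (limitOf y) (code (key y) 0) x ⊎ limitOf y ≡ ν × Iter z (code (key y) 1) x
        hit : ∀ y → ∃[ x ] Hit y x × x ≺ ν
        hit y with side ν-iter y
        ... | inj₁ p = let (x , i , x≺ν) = iterate ν-lim p (code (key y) 0) in x , inj₁ i , x≺ν
        ... | inj₂ p = let (x , i , x≺ν) = iterate ν-lim (proj₂ (proj₂ below-ν)) (code (key y) 1)
                       in x , inj₂ (p , i) , x≺ν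
        hit-inj : ∀ {y y′ x} → Hit y x → Hit y′ x → y ≡ y′
        hit-inj {y} {y′} (inj₁ i) (inj₁ j) with iter-unique (limit y) (limit y′) i j
        ... | l≡ , k≡ = same l≡ (proj₁ (code-injective k≡))
        hit-inj {y} {y′} (inj₂ (p , i)) (inj₂ (q , j)) with iter-unique (proj₁ (proj₂ below-ν)) (proj₁ (proj₂ below-ν)) i j
        ... | _ , k≡ = same (trans p (sym q)) (proj₁ (code-injective k≡))
        hit-inj {y} {y′} (inj₁ i) (inj₂ (_ , j)) with iter-unique (limit y) (proj₁ (proj₂ below-ν)) i j
        ... | _ , k≡ with proj₂ (code-injective {key y} k≡)
        ...   | ()
        hit-inj {y} {y′} (inj₂ (_ , i)) (inj₁ j) with iter-unique (proj₁ (proj₂ below-ν)) (limit y′) i j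
        ... | _ , k≡ with proj₂ (code-injective {key y} k≡)
        ...   | ()

  unboundedCountable : ∀ {a} {X : Set a} (f : X → ℕ) → Injective _≡_ _≡_ f →
    (∀ N → ∃[ x ] N ℕ.≤ f x) → ℕ ↔ X
  unboundedCountable {X = X} f f-inj unbounded =
    mk↔ₛ′ g (proj₁ ∘ onto) (proj₂ ∘ onto) λ n → g-inj (proj₂ (onto (g n)))
    where
    open WellOrder <-wellOrder using (least)
    above : ∀ N → ∃[ x ] N ℕ.≤ f x × (∀ y → N ℕ.≤ f y → f x ℕ.≤ f y)
    above N with least (λ v → ∃[ x ] f x ≡ v × N ℕ.≤ v) (let (x , p) = unbounded N in f x , x , refl , p)
    ... | _ , (x , refl , p) , min = x , p , λ y q → ℕ.≮⇒≥ λ lt → min (f y) lt (y , refl , q)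
    g : ℕ → X
    g zero    = proj₁ (above 0)
    g (suc n) = proj₁ (above (suc (f (g n))))
    g-step : ∀ n → f (g n) ℕ.< f (g (suc n))
    g-step n = proj₁ (proj₂ (above (suc (f (g n)))))
    g-mono : ∀ {m n} → m ℕ.< n → f (g m) ℕ.< f (g n)
    g-mono {m} {suc n} (s≤s m≤n) with ℕ.m≤n⇒m<n∨m≡n m≤n
    ... | inj₁ m<n  = ℕ.<-trans (g-mono m<n) (g-step n)
    ... | inj₂ refl = g-step n
    g-inj : ∀ {m n} → g m ≡ g n → m ≡ n
    g-inj {m} {n} eq with ℕ.<-cmp m n
    ... | tri< p _ _ = ⊥-elim (ℕ.<⇒≢ (g-mono p) (cong f eq))
    ... | tri≈ _ p _ = p
    ... | tri> _ _ p = ⊥-elim (ℕ.<⇒≢ (g-mono p) (cong f (sym eq)))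
    n≤fg : ∀ n → n ℕ.≤ f (g n)
    n≤fg zero    = z≤n
    n≤fg (suc n) = ℕ.≤-<-trans (n≤fg n) (g-step n)
    upto : ∀ n x → f x ℕ.≤ f (g n) → ∃[ m ] g m ≡ x
    upto zero    x p = zero , f-inj (ℕ.≤-antisym (proj₂ (proj₂ (above 0)) x z≤n) p)
    upto (suc n) x p with f x ℕ.≤? f (g n)
    ... | yes q = upto n x q
    ... | no ¬q = suc n , f-inj (ℕ.≤-antisym (proj₂ (proj₂ (above _)) x (ℕ.≰⇒> ¬q)) p)
    onto : ∀ x → ∃[ m ] g m ≡ x
    onto x = upto (f x) x (n≤fg (f x))

-- A nonprincipal ultrafilter on the natural numbers

module Ultrafilter (em : ∀ {a} → ExcludedMiddle a) (ext : ∀ {a b} → Extensionality a b) where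
  open Classical em
  open Zermelo em ext
  open WellOrder (wellOrder (ℕ → Bool))

  private
    Cofinally : ∀ {a} → (ℕ → Set a) → Set a
    Cofinally P = ∀ N → ∃[ n ] N ℕ.≤ n × P n

    -- Sets of naturals are examined along a well-order; one is accepted when it meets every finite
    -- intersection of previously accepted sets in an infinite set.
    accepted : ∀ A → Acc _≺_ A → Set
    accepted A (acc rs) = (Bs : List (∃ (_≺ A))) → ListAll (λ (B , B≺A) → accepted B (rs B≺A)) Bs →
      Cofinally λ n → A n ≡ true × ListAll (λ (B , _) → B n ≡ true) Bs

    irrelevant : ∀ A (p q : Acc _≺_ A) → accepted A p → accepted A q
    irrelevant A (acc rs) (acc rs′) h Bs all =
      h Bs (ListAll.map (λ {(B , B≺A)} → irrelevant B (rs′ B≺A) (rs B≺A)) all)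

  record 𝒰 (A : ℕ → Bool) : Set where
    constructor mk𝒰
    field
      isAccepted : accepted A (≺-wf A)

  private
    accept : ∀ {A} → ((Bs : List (∃ (_≺ A))) → ListAll (λ (B , _) → 𝒰 B) Bs →
      Cofinally λ n → A n ≡ true × ListAll (λ (B , _) → B n ≡ true) Bs) → 𝒰 A
    accept {A} h = mk𝒰 (go (≺-wf A))
      where
      go : ∀ p → accepted A p
      go (acc rs) Bs all = h Bs (ListAll.map (λ {(B , B≺A)} u → mk𝒰 (irrelevant B (rs B≺A) (≺-wf B) u)) all)

    accepts : ∀ {A} → 𝒰 A → (Bs : List (∃ (_≺ A))) → ListAll (λ (B , _) → 𝒰 B) Bs →
      Cofinally λ n → A n ≡ true × ListAll (λ (B , _) → B n ≡ true) Bs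
    accepts {A} (mk𝒰 u) Bs all = go (≺-wf A) u
      where
      go : ∀ p → accepted A p → Cofinally λ n → A n ≡ true × ListAll (λ (B , _) → B n ≡ true) Bs
      go (acc rs) u = u Bs (ListAll.map (λ {(B , B≺A)} (mk𝒰 v) → irrelevant B (≺-wf B) (rs B≺A) v) all)

    maximum : ∀ A As → ListAll 𝒰 (A ∷ As) → ∃[ C ] 𝒰 C × ListAll (λ B → B ≡ C ⊎ B ≺ C × 𝒰 B) (A ∷ As)
    maximum A [] (u ∷ []) = A , u , inj₁ refl ∷ []
    maximum A (A′ ∷ As) (u ∷ us) with maximum A′ As us
    ... | C , uC , all with ≺-cmp A C
    ...   | inj₁ A≺C        = C , uC , inj₂ (A≺C , u) ∷ all
    ...   | inj₂ (inj₁ A≡C) = C , uC , inj₁ A≡C ∷ all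
    ...   | inj₂ (inj₂ C≺A) = A , u , inj₁ refl ∷ ListAll.map
            (λ { (inj₁ refl) → inj₂ (C≺A , uC) ; (inj₂ (p , uB)) → inj₂ (≺-trans p C≺A , uB) }) all

    remove : ∀ {C} As → ListAll (λ B → B ≡ C ⊎ B ≺ C × 𝒰 B) As → Σ[ Bs ∈ List (∃ (_≺ C)) ]
      ListAll (λ (B , _) → 𝒰 B) Bs ×
      (∀ n → C n ≡ true → ListAll (λ (B , _) → B n ≡ true) Bs → ListAll (λ B → B n ≡ true) As)
    remove [] [] = [] , [] , λ _ _ _ → []
    remove (A ∷ As) (h ∷ hs) with h | remove As hs
    ... | inj₁ refl    | Bs , us , k = Bs , us , λ n c b → c ∷ k n c b
    ... | inj₂ (p , u) | Bs , us , k = (A , p) ∷ Bs , u ∷ us , λ { n c (a ∷ b) → a ∷ k n c b }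

    -- The latest of finitely many accepted sets was accepted against all the others, so their
    -- intersection is infinite.
    intersect : ∀ As → ListAll 𝒰 As → Cofinally λ n → ListAll (λ B → B n ≡ true) As
    intersect [] [] N = N , ℕ.≤-refl , []
    intersect (A ∷ As) us N with maximum A As us
    ... | C , uC , all with remove (A ∷ As) all
    ...   | Bs , uBs , k with accepts uC Bs uBs N
    ...     | n , N≤n , c , b = n , N≤n , k n c b

    rejection : ∀ A → ¬ 𝒰 A → ∃[ Bs ] ListAll 𝒰 Bs × ∃[ N ] (∀ n → N ℕ.≤ n → A n ≡ true → ListAll (λ B → B n ≡ true) Bs → ⊥)
    rejection A ¬u with em {P = ∃[ Bs ] ListAll 𝒰 Bs × ∃[ N ] (∀ n → N ℕ.≤ n → A n ≡ true → ListAll (λ B → B n ≡ true) Bs → ⊥)}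
    ... | yes p = p
    ... | no none = ⊥-elim (¬u (accept λ Bs us N → dne λ h → none (List.map proj₁ Bs , ListAll.map⁺ us , N ,
      λ n N≤n a b → h (n , N≤n , a , ListAll.map⁻ b))))

    -- Were both rejected, each would eventually be disjoint from a finite intersection of accepted
    -- sets. The joint intersection is infinite by `intersect`, yet `A` and `B` cover it eventually.
    -- With `B` the complement this is the ultrafilter property; with `B` empty, cofinite sets are
    -- accepted.
    maximal : ∀ A B → (∃[ N ] ∀ n → N ℕ.≤ n → A n ≡ true ⊎ B n ≡ true) → ¬ 𝒰 A → 𝒰 B
    maximal A B (N , cover) ¬A = dne λ ¬B →
      let (As , uA , M , hA) = rejection A ¬A
          (Bs , uB , K , hB) = rejection B ¬B
          (n , le , all) = intersect (As List.++ Bs) (ListAll.++⁺ uA uB) (N ℕ.+ (M ℕ.+ K))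
          M+K≤n = ℕ.≤-trans (ℕ.m≤n+m (M ℕ.+ K) N) le
      in [ (λ a → hA n (ℕ.≤-trans (ℕ.m≤m+n M K) M+K≤n) a (ListAll.++⁻ˡ As all))
         , (λ b → hB n (ℕ.≤-trans (ℕ.m≤n+m K M) M+K≤n) b (ListAll.++⁻ʳ As all)) ]′
         (cover n (ℕ.≤-trans (ℕ.m≤m+n N (M ℕ.+ K)) le))

  ∀ᵁ : ∀ {a} → (ℕ → Set a) → Set
  ∀ᵁ P = 𝒰 (λ n → ⌊ P n ⌋)

  ∀ᵁ-exists : ∀ {a} {P : ℕ → Set a} → ∀ᵁ P → ∀ N → ∃[ n ] N ℕ.≤ n × P n
  ∀ᵁ-exists {P = P} u N with intersect ((λ n → ⌊ P n ⌋) ∷ []) (u ∷ []) N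
  ... | n , le , p ∷ [] = n , le , truth p

  ∀ᵁ-zip : ∀ {a b c} {P : ℕ → Set a} {Q : ℕ → Set b} {R : ℕ → Set c} →
    (∀ n → P n → Q n → R n) → ∀ᵁ P → ∀ᵁ Q → ∀ᵁ R
  ∀ᵁ-zip {P = P} {Q} {R} h u v = dne λ ¬w →
    clash (intersect (A ∷ B ∷ C ∷ []) (u ∷ v ∷ maximal (λ n → ⌊ R n ⌋) C (0 , λ n _ → split n) ¬w ∷ []) 0)
    where
    A B C : ℕ → Bool
    A n = ⌊ P n ⌋
    B n = ⌊ Q n ⌋
    C n = ⌊ ¬ R n ⌋
    split : ∀ n → ⌊ R n ⌋ ≡ true ⊎ ⌊ ¬ R n ⌋ ≡ true
    split n with em {P = R n}
    ... | yes r = inj₁ refl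
    ... | no ¬r = inj₂ (holds ¬r)
    clash : ¬ (∃[ n ] 0 ℕ.≤ n × ListAll (λ D → D n ≡ true) (A ∷ B ∷ C ∷ []))
    clash (n , _ , p ∷ q ∷ r ∷ []) = truth r (h n (truth p) (truth q))

  ∀ᵁ-map : ∀ {a b} {P : ℕ → Set a} {Q : ℕ → Set b} → (∀ n → P n → Q n) → ∀ᵁ P → ∀ᵁ Q
  ∀ᵁ-map h u = ∀ᵁ-zip (λ n p _ → h n p) u u

  ∀ᵁ-eventually : ∀ {a} {P : ℕ → Set a} N → (∀ n → N ℕ.≤ n → P n) → ∀ᵁ P
  ∀ᵁ-eventually {P = P} N h = dne λ ¬u → proj₂ (proj₂ (∀ᵁ-exists {P = λ _ → ⊥}
    (maximal (λ n → ⌊ P n ⌋) (λ n → ⌊ ⊥ ⌋) (N , λ n le → inj₁ (holds (h n le))) ¬u) 0))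

  ∀ᵁ-¬ : ∀ {a} {P : ℕ → Set a} → ¬ ∀ᵁ P → ∀ᵁ (¬_ ∘ P)
  ∀ᵁ-¬ {P = P} = maximal (λ n → ⌊ P n ⌋) (λ n → ⌊ ¬ P n ⌋) (0 , λ n _ → split n)
    where
    split : ∀ n → ⌊ P n ⌋ ≡ true ⊎ ⌊ ¬ P n ⌋ ≡ true
    split n with em {P = P n}
    ... | yes p = inj₁ refl
    ... | no ¬p = inj₂ (holds ¬p)

-- Selecting and regrouping coordinates of tuples

module Selection where

  sel : ∀ {a} {A : Set a} {m n} → Vec (Fin m) n → Vec A m → Vec A n
  sel ρ v = Vec.map (lookup v) ρ

  sel-tabulate : ∀ {a} {A : Set a} {m n} (f : Fin n → Fin m) (v : Vec A m) (w : Vec A n) →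
    (∀ i → lookup v (f i) ≡ lookup w i) → sel (Vec.tabulate f) v ≡ w
  sel-tabulate f v w h = trans (sym (Vec.tabulate-∘ (lookup v) f)) (trans (Vec.tabulate-cong h) (Vec.tabulate∘lookup w))

  left : ∀ m n → Vec (Fin (m ℕ.+ n)) m
  left m n = Vec.tabulate (Fin._↑ˡ n)

  right : ∀ m n → Vec (Fin (m ℕ.+ n)) n
  right m n = Vec.tabulate (m Fin.↑ʳ_)

  sel-left : ∀ {a} {A : Set a} {m n} (v : Vec A m) (w : Vec A n) → sel (left m n) (v ++ w) ≡ v
  sel-left v w = sel-tabulate _ (v ++ w) v (Vec.lookup-++ˡ v w)

  sel-right : ∀ {a} {A : Set a} {m n} (v : Vec A m) (w : Vec A n) → sel (right m n) (v ++ w) ≡ w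
  sel-right v w = sel-tabulate _ (v ++ w) w (Vec.lookup-++ʳ v w)

  under : ∀ k {m n} → Vec (Fin m) n → Vec (Fin (k ℕ.+ m)) (k ℕ.+ n)
  under k {m} τ = left k m ++ Vec.map (k Fin.↑ʳ_) τ

  sel-↑ʳ : ∀ {a} {A : Set a} {k m n} (x : Vec A k) (q : Vec A m) (τ : Vec (Fin m) n) →
    sel (Vec.map (k Fin.↑ʳ_) τ) (x ++ q) ≡ sel τ q
  sel-↑ʳ {k = k} x q τ =
    trans (sym (Vec.map-∘ (lookup (x ++ q)) (k Fin.↑ʳ_) τ)) (Vec.map-cong (Vec.lookup-++ʳ x q) τ)

  sel-++ : ∀ {a} {A : Set a} {m n n′} (ρ : Vec (Fin m) n) (τ : Vec (Fin m) n′) (v : Vec A m) →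
    sel (ρ ++ τ) v ≡ sel ρ v ++ sel τ v
  sel-++ ρ τ v = Vec.map-++ (lookup v) ρ τ

  sel-under : ∀ {a} {A : Set a} {k m n} (x : Vec A k) (q : Vec A m) (τ : Vec (Fin m) n) →
    sel (under k τ) (x ++ q) ≡ x ++ sel τ q
  sel-under {k = k} x q τ = trans (sel-++ (left k _) _ (x ++ q)) (cong₂ _++_ (sel-left x q) (sel-↑ʳ x q τ))

  block : ∀ {n r} → Fin r → Vec (Fin (r ℕ.* n)) n
  block i = Vec.tabulate (combine i)

  sel-block : ∀ {a} {A : Set a} {n r} (Y : Vec (Vec A n) r) i → sel (block i) (Vec.concat Y) ≡ lookup Y i
  sel-block Y i = sel-tabulate _ (Vec.concat Y) (lookup Y i) (Vec.lookup-concat Y i)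

  blocks : ∀ {n N p} → Fin p → Vec (Fin ((p ℕ.* N) ℕ.* n)) (N ℕ.* n)
  blocks {N = N} i = Vec.concat (Vec.tabulate λ t → block (combine {n = N} i t))

  sel-blocks : ∀ {a} {A : Set a} {n N p} (B : Vec (Vec (Vec A n) N) p) i →
    sel (blocks i) (Vec.concat (Vec.concat B)) ≡ Vec.concat (lookup B i)
  sel-blocks {N = N} B i = trans (Vec.map-concat (lookup V) (Vec.tabulate ρ)) (cong Vec.concat
    (trans (sym (Vec.tabulate-∘ (λ τ → sel τ V) ρ))
    (trans (Vec.tabulate-cong λ t → trans (sel-block (Vec.concat B) (combine i t)) (Vec.lookup-concat B i t))
           (Vec.tabulate∘lookup (lookup B i)))))
    where
    V = Vec.concat (Vec.concat B)
    ρ = λ t → block (combine {n = N} i t)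

  infix 3 _is_
  _is_ : ∀ {a} → Set a → Bool → Set a
  P is b = P ⇔ (b ≡ true)

  is-resp : ∀ {a b} {P : Set a} {Q : Set b} {s : Bool} → P ⇔ Q → P is s → Q is s
  is-resp e p = mk⇔ (to p ∘ from e) (to e ∘ from p)
    where open Equivalence

open Selection public

-- Definable families, parameters, automorphisms

module Logic (em : ∀ {a} → ExcludedMiddle a) {ℓ} {L : Language ℓ} where
  open Classical em
  open Language L
  open Structure
  open Equivalence

  liftᶠ : ∀ {n m} → (Fin n → Fin m) → Fin (suc n) → Fin (suc m)
  liftᶠ ρ zero    = zero
  liftᶠ ρ (suc i) = suc (ρ i)

  mutual
    renT : ∀ {n m} → (Fin n → Fin m) → Term L n → Term L m
    renT ρ (var i)    = var (ρ i)
    renT ρ (fun f ts) = fun f (renTs ρ ts)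

    renTs : ∀ {n m k} → (Fin n → Fin m) → Vec (Term L n) k → Vec (Term L m) k
    renTs ρ []       = []
    renTs ρ (t ∷ ts) = renT ρ t ∷ renTs ρ ts

  ren : ∀ {n m} → (Fin n → Fin m) → Formula L n → Formula L m
  ren ρ (s ≈′ t)   = renT ρ s ≈′ renT ρ t
  ren ρ (rel R ts) = rel R (renTs ρ ts)
  ren ρ false      = false
  ren ρ (φ ⟹ ψ)   = ren ρ φ ⟹ ren ρ ψ
  ren ρ (∀′ φ)     = ∀′ (ren (liftᶠ ρ) φ)

  module _ (N : Structure L) where

    mutual
      eval-ren : ∀ {n m} (ρ : Fin n → Fin m) v w → (∀ i → lookup w i ≡ lookup v (ρ i)) →
        ∀ t → eval N v (renT ρ t) ≡ eval N w t
      eval-ren ρ v w h (var i)    = sym (h i)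
      eval-ren ρ v w h (fun f ts) = cong (⟦fun⟧ N f) (evals-ren ρ v w h ts)

      evals-ren : ∀ {n m k} (ρ : Fin n → Fin m) v w → (∀ i → lookup w i ≡ lookup v (ρ i)) →
        ∀ (ts : Vec _ k) → evals N v (renTs ρ ts) ≡ evals N w ts
      evals-ren ρ v w h []       = refl
      evals-ren ρ v w h (t ∷ ts) = cong₂ _∷_ (eval-ren ρ v w h t) (evals-ren ρ v w h ts)

    sat-ren : ∀ {n m} (ρ : Fin n → Fin m) v w → (∀ i → lookup w i ≡ lookup v (ρ i)) →
      ∀ φ → Sat N (ren ρ φ) v ⇔ Sat N φ w
    sat-ren ρ v w h (s ≈′ t) rewrite eval-ren ρ v w h s | eval-ren ρ v w h t = mk⇔ id id
    sat-ren ρ v w h (rel R ts) rewrite evals-ren ρ v w h ts = mk⇔ id id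
    sat-ren ρ v w h false = mk⇔ id id
    sat-ren ρ v w h (φ ⟹ ψ) =
      let i = sat-ren ρ v w h φ ; j = sat-ren ρ v w h ψ
      in mk⇔ (λ f → to j ∘ f ∘ from i) (λ f → from j ∘ f ∘ to i)
    sat-ren ρ v w h (∀′ φ) = mk⇔ (λ f x → to (e x) (f x)) (λ f x → from (e x) (f x))
      where
      e : ∀ x → Sat N (ren (liftᶠ ρ) φ) (x ∷ v) ⇔ Sat N φ (x ∷ w)
      e x = sat-ren (liftᶠ ρ) (x ∷ v) (x ∷ w) (λ { zero → refl ; (suc i) → h i }) φ

  -- A property of tuples given in all structures at once. `Definable` asks for one formula that
  -- works in each of them, which allows sentences to be carried between models of a complete
  -- theory.
  Family : ℕ → Set (lsuc ℓ)
  Family n = (N : Structure L) → Vec (Domain N) n → Set ℓ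

  record Definable {n} (D : Family n) : Set (lsuc ℓ) where
    constructor defines
    field
      formula : Formula L n
      correct : ∀ N v → Sat N formula v ⇔ D N v

  open Definable

  by-formula : ∀ {n} (φ : Formula L n) → Definable (λ N → Sat N φ)
  by-formula φ = defines φ λ N v → mk⇔ id id

  def-resp : ∀ {n} {D E : Family n} → Definable D → (∀ N v → D N v ⇔ E N v) → Definable E
  def-resp d h = defines (formula d) λ N v → mk⇔ (to (h N v) ∘ to (correct d N v)) (from (correct d N v) ∘ from (h N v))

  def-sel : ∀ {m n} {D : Family n} → Definable D → (ρ : Vec (Fin m) n) → Definable (λ N v → D N (sel ρ v))
  def-sel d ρ = defines (ren (lookup ρ) (formula d)) λ N v →
    let e = sat-ren N (lookup ρ) v (sel ρ v) (λ i → Vec.lookup-map i (lookup v) ρ) (formula d)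
    in mk⇔ (to (correct d N (sel ρ v)) ∘ to e) (from e ∘ from (correct d N (sel ρ v)))

  def-⊤ : ∀ {n} → Definable {n} (λ N v → Lift ℓ ⊤)
  def-⊤ = defines (false ⟹ false) λ N v → mk⇔ _ λ _ → id

  def-¬ : ∀ {n} {D : Family n} → Definable D → Definable (λ N v → ¬ D N v)
  def-¬ d = defines (¬′ formula d) λ N v →
    mk⇔ (λ f x → lower (f (from (correct d N v) x))) (λ f x → lift (f (to (correct d N v) x)))

  def-∩ : ∀ {n} {D E : Family n} → Definable D → Definable E → Definable (λ N v → D N v × E N v)
  def-∩ d e = defines (¬′ (formula d ⟹ (¬′ formula e))) λ N v → mk⇔
    (λ f → dne λ ¬de → lower (f λ p q → lift (¬de (to (correct d N v) p , to (correct e N v) q))))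
    (λ (p , q) f → f (from (correct d N v) p) (from (correct e N v) q))

  def-∃ : ∀ {n} {D : Family (suc n)} → Definable D → Definable (λ N v → ∃[ x ] D N (x ∷ v))
  def-∃ d = defines (¬′ (∀′ (¬′ formula d))) λ N v → mk⇔
    (λ f → dne λ none → lower (f λ x p → lift (none (x , to (correct d N (x ∷ v)) p))))
    (λ (x , p) f → f x (from (correct d N (x ∷ v)) p))

  def-∃* : ∀ m {n} {D : Family (m ℕ.+ n)} → Definable D →
    Definable (λ N (v : Vec (Domain N) n) → Σ[ a ∈ Vec (Domain N) m ] D N (a ++ v))
  def-∃* zero    d = def-resp d λ N v → mk⇔ ([] ,_) λ { ([] , p) → p }
  def-∃* (suc m) d = def-resp (def-∃* m (def-∃ d)) λ N v →
    mk⇔ (λ (a , x , p) → x ∷ a , p) λ { (x ∷ a , p) → a , x , p }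

  def-is : ∀ {n} {D : Family n} → Definable D → ∀ b → Definable (λ N v → D N v is b)
  def-is d true  = def-resp d λ N v → mk⇔ (λ p → mk⇔ (λ _ → refl) (λ _ → p)) (λ e → from e refl)
  def-is d false = def-resp (def-¬ d) λ N v →
    mk⇔ (λ ¬p → mk⇔ (⊥-elim ∘ ¬p) λ ()) (λ e p → case to e p of λ ())

  def-∀Fin : ∀ {n} p {D : Fin p → Family n} → (∀ i → Definable (D i)) → Definable (λ N v → ∀ i → D i N v)
  def-∀Fin zero    d = def-resp def-⊤ λ N v → mk⇔ (λ _ ()) _
  def-∀Fin (suc p) d = def-resp (def-∩ (d zero) (def-∀Fin p (d ∘ suc))) λ N v →
    mk⇔ (λ { (a , b) zero → a ; (a , b) (suc i) → b i }) (λ f → f zero , f ∘ suc)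

  def-∀Bits : ∀ {n} p {D : Vec Bool p → Family n} → (∀ s → Definable (D s)) → Definable (λ N v → ∀ s → D s N v)
  def-∀Bits zero    d = def-resp (d []) λ N v → mk⇔ (λ { p [] → p }) (λ f → f [])
  def-∀Bits (suc p) d = def-resp (def-∩ (def-∀Bits p (d ∘ (true ∷_))) (def-∀Bits p (d ∘ (false ∷_)))) λ N v →
    mk⇔ (λ { (f , g) (true ∷ s) → f s ; (f , g) (false ∷ s) → g s }) (λ f → f ∘ (true ∷_) , f ∘ (false ∷_))

  module _ {m n} (φ : Formula L (m ℕ.+ n)) where

    Pattern : ∀ (N : Structure L) {p} → (Fin p → Vec (Domain N) n) → Vec Bool p → Set ℓ
    Pattern N b s = Σ[ a ∈ Vec (Domain N) m ] (∀ i → Sat N φ (a ++ b i) is lookup s i)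

    def-Pattern : ∀ {r} p (ρ : Fin p → Vec (Fin r) n) s → Definable (λ N v → Pattern N (λ i → sel (ρ i) v) s)
    def-Pattern p ρ s = def-resp
      (def-∃* m (def-∀Fin p λ i → def-is (def-sel (by-formula φ) (under m (ρ i))) (lookup s i)))
      λ N v → mk⇔ (λ (a , f) → a , λ i → subst (λ u → Sat N φ u is lookup s i) (sel-under a v (ρ i)) (f i))
                  (λ (a , f) → a , λ i → subst (λ u → Sat N φ u is lookup s i) (sym (sel-under a v (ρ i))) (f i))

    Shatters : ∀ (N : Structure L) {p} → (Fin p → Vec (Domain N) n) → Set ℓ
    Shatters N b = ∀ s → Pattern N b s

    def-Shatters : ∀ {r} p (ρ : Fin p → Vec (Fin r) n) → Definable (λ N v → Shatters N (λ i → sel (ρ i) v))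
    def-Shatters p ρ = def-∀Bits p (def-Pattern p ρ)

    IPIn : Structure L → Set ℓ
    IPIn N = ∀ p → ∃[ b ] Shatters N {p} b

    -- For each fixed `p`, the existence of `p` shattered tuples is one sentence. Completeness
    -- decides it, and its negation fails in `M`. The selection `left (p ℕ.* n) 0` drops the empty
    -- tuple that `def-∃*` leaves after the quantified block.
    IPIn-transfer : ∀ {T} → IsComplete T → ∀ {M} → IsModelOf M T → IPIn M → ∀ {N} → IsModelOf N T → IPIn N
    IPIn-transfer {T} (_ , decided) {M} M⊨T ip {N} N⊨T p =
      (λ i → sel (block i) (sel (left (p ℕ.* n) 0) (proj₁ inN ++ []))) , proj₂ inN
      where
      d : Definable {0} (λ N v → Σ[ V ∈ Vec (Domain N) (p ℕ.* n) ] Shatters N (λ i → sel (block {n} {p} i) (sel (left (p ℕ.* n) 0) (V ++ v))))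
      d = def-∃* (p ℕ.* n) (def-sel (def-Shatters p block) (left (p ℕ.* n) 0))
      inM : Sat M (formula d) []
      inM = let (b , h) = ip p in from (correct d M []) (Vec.concat (Vec.tabulate b) , λ s → let (a , f) = h s in
        a , λ i → subst (λ u → Sat M φ (a ++ u) is lookup s i)
          (sym (trans (cong (sel (block i)) (sel-left (Vec.concat (Vec.tabulate b)) [])) (trans (sel-block (Vec.tabulate b) i) (Vec.lookup∘tabulate b i)))) (f i))
      inN = to (correct d N []) ([ (λ t → t N N⊨T) , (λ t → ⊥-elim (lower (t M M⊨T inM))) ]′ (decided (formula d)))

    HasIP⇒IPIn : ∀ {T} → HasIP T m n φ → ∀ {N} → IsModelOf N T → IPIn N
    HasIP⇒IPIn ip {N} N⊨T p = let (b , h) = ip N N⊨T p in b , λ s → let (a , f) = h s in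
      a , λ i → mk⇔ (λ x → Vec.[]=⇒lookup (to (f i) x)) (λ e → from (f i) (Vec.lookup⇒[]= i s e))

    IPIn⇒HasIP : ∀ {T} → (∀ {N} → IsModelOf N T → IPIn N) → HasIP T m n φ
    IPIn⇒HasIP ip N N⊨T p = let (b , h) = ip N⊨T p in b , λ s → let (a , f) = h s in
      a , λ i → mk⇔ (λ x → Vec.lookup⇒[]= i s (to (f i) x)) (λ e → from (f i) (Vec.[]=⇒lookup e))

  module Parameters (M : Structure L) where
    -- Serves to bring formulas with different parameters over one common tuple `q`.
    weaken : ∀ {k} (ψ : FormulaWithParams M k) {c} (q : Vec (Domain M) c) (τ : Vec (Fin c) (FormulaWithParams.arity ψ)) →
      sel τ q ≡ FormulaWithParams.params ψ →
      Σ[ χ ∈ Formula L (k ℕ.+ c) ] (∀ x → Sat M χ (x ++ q) ⇔ _satisfies_ M x ψ)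
    weaken {k} ψ q τ eq =
      let d = def-sel (by-formula (FormulaWithParams.formula ψ)) (under k τ)
      in formula d , λ x → subst (λ u → Sat M (formula d) (x ++ q) ⇔ Sat M (FormulaWithParams.formula ψ) u)
        (trans (sel-under x q τ) (cong (x ++_) eq)) (correct d M (x ++ q))

    conjunction : ∀ {k} (A : Pred (Domain M) ℓ) (ψs : List (FormulaWithParams M k)) → ListAll (IsOver M A) ψs →
      Σ[ χ ∈ FormulaWithParams M k ] IsOver M A χ × (∀ x → _satisfies_ M x χ ⇔ ListAll (_satisfies_ M x) ψs)
    conjunction A [] [] = record { formula = false ⟹ false ; params = [] } , [] , λ x → mk⇔ (λ _ → []) λ _ → id
    conjunction A (ψ ∷ ψs) (o ∷ os) with conjunction A ψs os
    ... | χ , χ-over , χ-sat = record { formula = formula d ; params = q } , VecAll.++⁺ o χ-over , λ x → mk⇔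
        (λ s → let (a , b) = to (correct d M (x ++ q)) s in to (proj₂ l x) a ∷ to (χ-sat x) (to (proj₂ r x) b))
        (λ { (a ∷ b) → from (correct d M (x ++ q)) (from (proj₂ l x) a , from (proj₂ r x) (from (χ-sat x) b)) })
      where
      p₁ = FormulaWithParams.params ψ
      p₂ = FormulaWithParams.params χ
      q  = p₁ ++ p₂
      l  = weaken ψ q (left _ _) (sel-left p₁ p₂)
      r  = weaken χ q (right _ _) (sel-right p₁ p₂)
      d  = def-∩ (by-formula (proj₁ l)) (by-formula (proj₁ r))

    module _ {k : ℕ} where
      Def-resp : ∀ {D E : Subset M k} → Def M k D → D ≐ E → Def M k E
      Def-resp (ψ , f , g) (p , q) = ψ , f ∘ q , p ∘ g

      Def-∁ : ∀ {D : Subset M k} → Def M k D → Def M k (∁ D)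
      Def-∁ (ψ , f , g) = record { formula = ¬′ formula′ ; params = params } ,
          (λ ¬d s → lift (¬d (g s))) , (λ s d → lower (s (f d)))
        where open FormulaWithParams ψ renaming (formula to formula′)

      Def-∩ : ∀ {D E : Subset M k} → Def M k D → Def M k E → Def M k (D ∩ E)
      Def-∩ (ψ , f , g) (χ , f′ , g′) with conjunction (λ _ → Lift ℓ ⊤) (ψ ∷ χ ∷ []) (VecAll.universal (λ _ → _) _ ∷ VecAll.universal (λ _ → _) _ ∷ [])
      ... | ω , _ , ω-sat = ω , (λ {x} (d , e) → from (ω-sat x) (f d ∷ f′ e ∷ [])) ,
          λ {x} s → both (to (ω-sat x) s)
        where
        both : ∀ {x} → ListAll (_satisfies_ M x) (ψ ∷ χ ∷ []) → _
        both (a ∷ b ∷ []) = g a , g′ b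

      Def-∪ : ∀ {D E : Subset M k} → Def M k D → Def M k E → Def M k (D ∪ E)
      Def-∪ {D} {E} d e = Def-resp (Def-∁ (Def-∩ (Def-∁ d) (Def-∁ e))) (cover , λ { (inj₁ p) (¬p , _) → ¬p p ; (inj₂ q) (_ , ¬q) → ¬q q })
        where
        cover : ∀ {x} → x ∈ ∁ (∁ D ∩ ∁ E) → x ∈ D ∪ E
        cover h = dne λ ¬p → h (¬p ∘ inj₁ , ¬p ∘ inj₂)

      Def-U : Def M k (λ _ → Lift ℓ ⊤)
      Def-U = record { formula = false ⟹ false ; params = [] } , (λ _ → id) , _

  module Action {M : Structure L} (σ : Automorphism M) where
    open Automorphism σ using (bijection; preserves-fun; preserves-rel)
    private
      g = Automorphism.to σ
      h = Automorphism.from σ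

    mutual
      eval-σ : ∀ {n} v (t : Term L n) → eval M (Vec.map g v) t ≡ g (eval M v t)
      eval-σ v (var i)    = Vec.lookup-map i g v
      eval-σ v (fun f ts) = trans (cong (⟦fun⟧ M f) (evals-σ v ts)) (sym (preserves-fun f _))

      evals-σ : ∀ {n k} v (ts : Vec (Term L n) k) → evals M (Vec.map g v) ts ≡ Vec.map g (evals M v ts)
      evals-σ v []       = refl
      evals-σ v (t ∷ ts) = cong₂ _∷_ (eval-σ v t) (evals-σ v ts)

    gh : ∀ x → g (h x) ≡ x
    gh = Inverse.strictlyInverseˡ bijection

    hg : ∀ x → h (g x) ≡ x
    hg = Inverse.strictlyInverseʳ bijection

    map-gh : ∀ {k} (v : Vec (Domain M) k) → Vec.map g (Vec.map h v) ≡ v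
    map-gh v = trans (sym (Vec.map-∘ g h v)) (trans (Vec.map-cong gh v) (Vec.map-id v))

    map-hg : ∀ {k} (v : Vec (Domain M) k) → Vec.map h (Vec.map g v) ≡ v
    map-hg v = trans (sym (Vec.map-∘ h g v)) (trans (Vec.map-cong hg v) (Vec.map-id v))

    sat-σ : ∀ {n} (φ : Formula L n) v → Sat M φ v ⇔ Sat M φ (Vec.map g v)
    sat-σ (s ≈′ t) v rewrite eval-σ v s | eval-σ v t =
      mk⇔ (cong g) (λ e → trans (sym (hg _)) (trans (cong h e) (hg _)))
    sat-σ (rel R ts) v rewrite evals-σ v ts = preserves-rel R _
    sat-σ false v = mk⇔ id id
    sat-σ (φ ⟹ ψ) v = let i = sat-σ φ v ; j = sat-σ ψ v in mk⇔ (λ f → to j ∘ f ∘ from i) (λ f → from j ∘ f ∘ to i)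
    sat-σ (∀′ φ) v = mk⇔ (λ f y → subst (λ z → Sat M φ (z ∷ Vec.map g v)) (gh y) (to (sat-σ φ (h y ∷ v)) (f (h y))))
                         (λ f x → from (sat-σ φ (x ∷ v)) (f (g x)))

    pullback : ∀ {k} → FormulaWithParams M k → FormulaWithParams M k
    pullback ψ = record { formula = FormulaWithParams.formula ψ ; params = Vec.map h (FormulaWithParams.params ψ) }

    pullback-sat : ∀ {k} (ψ : FormulaWithParams M k) x → _satisfies_ M x (pullback ψ) ⇔ _satisfies_ M (Vec.map g x) ψ
    pullback-sat ψ x = subst (λ u → Sat M φ (x ++ Vec.map h params) ⇔ Sat M φ u)
      (trans (Vec.map-++ g x _) (cong (Vec.map g x ++_) (map-gh params))) (sat-σ φ (x ++ Vec.map h params))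
      where open FormulaWithParams ψ renaming (formula to φ)

    Def-pullback : ∀ {k} {D : Subset M k} → Def M k D → Def M k (D ∘ Vec.map g)
    Def-pullback (ψ , p , q) = pullback ψ , (λ {x} d → from (pullback-sat ψ x) (p d)) , (λ {x} s → q (to (pullback-sat ψ x) s))

    Def-pushforward : ∀ {k} {D : Subset M k} → Def M k D → Def M k (D ∘ Vec.map h)
    Def-pushforward (ψ , p , q) = record { formula = φ ; params = Vec.map g params } , (λ {x} d → to (moved x) (p d)) , (λ {x} s → q (from (moved x) s))
      where
      open FormulaWithParams ψ renaming (formula to φ)
      moved : ∀ x → Sat M φ (Vec.map h x ++ params) ⇔ Sat M φ (x ++ Vec.map g params)
      moved x = subst (λ u → Sat M φ (Vec.map h x ++ params) ⇔ Sat M φ u)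
        (trans (Vec.map-++ g (Vec.map h x) params) (cong (_++ Vec.map g params) (map-gh x))) (sat-σ φ (Vec.map h x ++ params))

-- ℵ₁-saturation and countable compactness

module Saturation (em : ∀ {a} → ExcludedMiddle a) (ext : ∀ {a b} → Extensionality a b)
  {ℓ} {L : Language ℓ} (M : Structure L) (saturated : IsSaturated M)
  (uncountable : ¬ (Σ[ f ∈ (Structure.Domain M → ℕ) ] Injective _≡_ _≡_ f)) where
  open Classical em
  open Cardinal em ext
  open Logic em {L = L}
  open Definable
  open Structure M using (Domain)
  open Equivalence
  open Parameters M
  open FormulaWithParams using () renaming (formula to form; params to pars)

  infix 4 _⊩_
  _⊩_ : ∀ {k} → Vec Domain k → FormulaWithParams M k → Set ℓ
  x ⊩ ψ = _satisfies_ M x ψ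

  -- The code may depend on the proof of membership, which need not be unique; only the point has to
  -- be recoverable from it.
  Countable : Pred Domain ℓ → Set ℓ
  Countable A = Σ[ κ ∈ (∀ x → A x → ℕ) ] (∀ {x y} (p : A x) (q : A y) → κ x p ≡ κ y q → x ≡ y)

  -- An injection of the domain into `A`, followed by the codes, would contradict uncountability.
  -- This is how saturation becomes ℵ₁-saturation.
  Countable⇒IsSmall : ∀ {A} → Countable A → IsSmall M A
  Countable⇒IsSmall (κ , κ-inj) (f , f-inj , f∈A) =
    uncountable ((λ x → κ (f x) (f∈A x)) , λ eq → f-inj (κ-inj (f∈A _) (f∈A _) eq))

  Entries : ∀ {n} → (ℕ → Vec Domain n) → Pred Domain ℓ
  Entries c x = ∃[ i ] ∃[ t ] lookup (c i) t ≡ x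

  Entries-countable : ∀ {n} (c : ℕ → Vec Domain n) → Countable (Entries c)
  Entries-countable c = (λ x (i , t , _) → code i (toℕ t)) , inj
    where
    inj : ∀ {x y} (p : Entries c x) (q : Entries c y) → _ → x ≡ y
    inj (i , t , refl) (j , u , refl) eq =
      let (i≡j , t≡u) = code-injective eq in cong₂ (λ i t → lookup (c i) t) i≡j (Fin.toℕ-injective t≡u)

  EntriesOf : ∀ {k} → Vec Domain k → Pred Domain ℓ
  EntriesOf v x = ∃[ t ] lookup v t ≡ x

  EntriesOf-countable : ∀ {k} (v : Vec Domain k) → Countable (EntriesOf v)
  EntriesOf-countable v = (λ x (t , _) → toℕ t) , inj
    where
    inj : ∀ {x y} (p : EntriesOf v x) (q : EntriesOf v y) → _ → x ≡ y
    inj (t , refl) (u , refl) eq = cong (lookup v) (Fin.toℕ-injective eq)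

  ∪-countable : ∀ {A B : Pred Domain ℓ} → Countable A → Countable B → Countable (A ∪ B)
  ∪-countable {A} {B} (κ , κ-inj) (η , η-inj) = key , inj
    where
    key : ∀ x → (A ∪ B) x → ℕ
    key x (inj₁ p) = code (κ x p) 0
    key x (inj₂ q) = code (η x q) 1
    inj : ∀ {x y} (p : (A ∪ B) x) (q : (A ∪ B) y) → key x p ≡ key y q → x ≡ y
    inj (inj₁ p) (inj₁ q) eq = κ-inj p q (proj₁ (code-injective eq))
    inj (inj₂ p) (inj₂ q) eq = η-inj p q (proj₁ (code-injective eq))
    inj (inj₁ p) (inj₂ q) eq = case proj₂ (code-injective eq) of λ ()
    inj (inj₂ p) (inj₁ q) eq = case proj₂ (code-injective eq) of λ ()

  over-entries : ∀ {k} (v : Vec Domain k) → VecAll (EntriesOf v) v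
  over-entries []      = []
  over-entries (x ∷ v) = (zero , refl) ∷ VecAll.map (λ (t , eq) → suc t , eq) (over-entries v)

  fibre : ∀ {k} → FormulaWithParams M (suc k) → Vec Domain k → FormulaWithParams M 1
  fibre ψ x = record { formula = form ψ ; params = x ++ pars ψ }

  project : ∀ {k} → FormulaWithParams M (suc k) → FormulaWithParams M k
  project ψ = record { formula = formula (def-∃ (by-formula (form ψ))) ; params = pars ψ }

  project-sat : ∀ {k} (ψ : FormulaWithParams M (suc k)) x → (x ⊩ project ψ) ⇔ (∃[ y ] (y ∷ x) ⊩ ψ)
  project-sat ψ x = correct (def-∃ (by-formula (form ψ))) M (x ++ pars ψ)

  abstract
    -- One coordinate at a time. The last `k` coordinates `x` realise `p₀`, the formulas over `A`
    -- that follow from finite parts of `p`. Among these are the projections of finite conjunctions,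
    -- so the type `p₁` left for the first coordinate over `A` and `x` is finitely satisfiable.
    realise : ∀ k {A} → Countable A → (p : Pred (FormulaWithParams M k) ℓ) →
      (∀ ψ → ψ ∈ p → IsOver M A ψ) → FinitelySatisfiable M p → Realised M p
    realise zero A-countable p p-over fs = [] , λ ψ ψ∈p → single (fs (ψ ∷ []) (ψ∈p ∷ []))
      where
      single : ∀ {ψ} → ∃[ x ] ListAll (x ⊩_) (ψ ∷ []) → [] ⊩ ψ
      single ([] , s ∷ []) = s
    realise (suc k) {A} A-countable p p-over fs = head x′ ∷ x , λ ψ ψ∈p → unit {ψ} x′ (proj₂ fibre-type (fibre ψ x) (ψ , ψ∈p , refl))
      where
      p₀ : Pred (FormulaWithParams M k) ℓ
      p₀ χ = IsOver M A χ × Σ[ ψs ∈ List (FormulaWithParams M (suc k)) ] ListAll p ψs ×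
        (∀ y x → ListAll ((y ∷ x) ⊩_) ψs → x ⊩ χ)

      collect : ∀ χs → ListAll p₀ χs → Σ[ ψs ∈ List (FormulaWithParams M (suc k)) ] ListAll p ψs ×
        (∀ y x → ListAll ((y ∷ x) ⊩_) ψs → ListAll (x ⊩_) χs)
      collect [] [] = [] , [] , λ _ _ _ → []
      collect (χ ∷ χs) ((_ , ψs , all , h) ∷ rest) with collect χs rest
      ... | ψs′ , all′ , h′ = ψs List.++ ψs′ , ListAll.++⁺ all all′ ,
        λ y x s → h y x (ListAll.++⁻ˡ ψs s) ∷ h′ y x (ListAll.++⁻ʳ ψs s)

      fs₀ : FinitelySatisfiable M p₀
      fs₀ χs all with collect χs all
      ... | ψs , all′ , h with fs ψs all′
      ...   | y ∷ x , s = x , h y x s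

      base : Realised M p₀
      base = realise k A-countable p₀ (λ _ → proj₁) fs₀
      x : Vec Domain k
      x = proj₁ base

      p₁ : Pred (FormulaWithParams M 1) ℓ
      p₁ ω = ∃[ ψ ] ψ ∈ p × ω ≡ fibre ψ x

      over₁ : ∀ ω → ω ∈ p₁ → IsOver M (EntriesOf x ∪ A) ω
      over₁ _ (ψ , ψ∈p , refl) = VecAll.++⁺ (VecAll.map inj₁ (over-entries x)) (VecAll.map inj₂ (p-over ψ ψ∈p))

      sources : ∀ ωs → ListAll p₁ ωs → Σ[ ψs ∈ List (FormulaWithParams M (suc k)) ] ListAll p ψs ×
        (∀ y → ListAll ((y ∷ x) ⊩_) ψs → ListAll ((y ∷ []) ⊩_) ωs)
      sources [] [] = [] , [] , λ _ _ → []
      sources (_ ∷ ωs) ((ψ , ψ∈p , refl) ∷ rest) with sources ωs rest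
      ... | ψs , all , h = ψ ∷ ψs , ψ∈p ∷ all , λ { y (s ∷ ss) → s ∷ h y ss }

      fs₁ : FinitelySatisfiable M p₁
      fs₁ ωs all with sources ωs all
      ... | ψs , all′ , h with conjunction A ψs (ListAll.map (p-over _) all′)
      ...   | χ , χ-over , χ-sat with to (project-sat χ x) (proj₂ base (project χ) (χ-over , ψs , all′ ,
                λ y x′ s → from (project-sat χ x′) (y , from (χ-sat (y ∷ x′)) s)))
      ...     | y , s = y ∷ [] , h y (to (χ-sat (y ∷ x)) s)

      fibre-type : Realised M p₁
      fibre-type = saturated (EntriesOf x ∪ A) (Countable⇒IsSmall (∪-countable (EntriesOf-countable x) A-countable)) p₁ over₁ fs₁
      x′ : Vec Domain 1
      x′ = proj₁ fibre-type
      head : Vec Domain 1 → Domain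
      head = Vec.head

      unit : ∀ {ψ} (y : Vec Domain 1) → y ⊩ fibre ψ x → (head y ∷ x) ⊩ ψ
      unit (y ∷ []) s = s

  -- If no `D i` contains `A`, the sets `A ∩ ∁ (D i)` are nonempty and decreasing, hence form a
  -- finitely satisfiable type over countably many parameters; a realisation lies in `A` outside
  -- every `D i`.
  compactness : ∀ {k} {A : Subset M k} (D : ℕ → Subset M k) → Def M k A → (∀ i → Def M k (D i)) → (∀ i x → D i x → D (suc i) x) →
    (∀ x → A x → ∃[ i ] D i x) → ∃[ i ] (∀ x → A x → D i x)
  compactness {k} {A} D α d increasing covers = dne λ none → let
      (x , s) = realise k B-countable p over (fs none)
      outside : ∀ i → (A ∩ ∁ (D i)) x
      outside i = proj₂ (proj₂ (rest i)) (s (ψ i) (i , refl))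
      (i , q) = covers x (proj₁ (outside 0))
    in proj₂ (outside i) q
    where
    rest : ∀ i → Def M k (A ∩ ∁ (D i))
    rest i = Def-∩ α (Def-∁ (d i))
    ψ : ℕ → FormulaWithParams M k
    ψ i = proj₁ (rest i)
    B : Pred Domain ℓ
    B x = ∃[ i ] EntriesOf (pars (ψ i)) x
    B-countable : Countable B
    B-countable = (λ x (i , t , _) → code i (toℕ t)) , inj
      where
      inj : ∀ {x y} (p : B x) (q : B y) → code (proj₁ p) (toℕ (proj₁ (proj₂ p))) ≡ code (proj₁ q) (toℕ (proj₁ (proj₂ q))) → x ≡ y
      inj (i , t , refl) (j , u , refl) eq with code-injective {i} {toℕ t} {j} {toℕ u} eq
      ... | refl , t≡u = cong (lookup (pars (ψ i))) (Fin.toℕ-injective t≡u)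
    p : Pred (FormulaWithParams M k) ℓ
    p χ = ∃[ i ] χ ≡ ψ i
    over : ∀ χ → χ ∈ p → IsOver M B χ
    over _ (i , refl) = VecAll.map (i ,_) (over-entries (pars (ψ i)))
    raise : ∀ x e i → D i x → D (e ℕ.+ i) x
    raise x zero    i q = q
    raise x (suc e) i q = increasing (e ℕ.+ i) x (raise x e i q)
    bound : ∀ χs → ListAll p χs → ∃[ r ] (∀ x → A x → ¬ D r x → ListAll (x ⊩_) χs)
    bound [] [] = 0 , λ _ _ _ → []
    bound (_ ∷ χs) ((i , refl) ∷ more) with bound χs more
    ... | r , f = i ℕ.+ r , λ x a ¬d → proj₁ (proj₂ (rest i)) (a , λ q → ¬d (subst (λ l → D l x) (ℕ.+-comm r i) (raise x r i q)))
      ∷ f x a λ q → ¬d (raise x i r q)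
    fs : ¬ (∃[ i ] (∀ x → A x → D i x)) → FinitelySatisfiable M p
    fs none χs all with bound χs all
    ... | r , f with ¬∀⇒∃¬ {P = λ x → A x → D r x} (λ sub → none (r , sub))
    ...   | x , ¬sub = x , f x (dne λ ¬a → ¬sub λ a → ⊥-elim (¬a a)) (λ q → ¬sub λ _ → q)

-- Shattered sequences and coheir sequences

module Sequences (em : ∀ {a} → ExcludedMiddle a) (ext : ∀ {a b} → Extensionality a b)
  {ℓ} {L : Language ℓ} (M : Structure L) (saturated : IsSaturated M)
  (uncountable : ¬ (Σ[ f ∈ (Structure.Domain M → ℕ) ] Injective _≡_ _≡_ f)) where
  open Classical em
  open Ultrafilter em ext
  open Logic em {L = L}
  open Definable
  open Structure M using (Domain)
  open Equivalence
  open Parameters M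
  open Saturation em ext M saturated uncountable

  module _ {m n} (φ : Formula L (m ℕ.+ n)) where

    ShattersSequence : (ℕ → Vec Domain n) → Set ℓ
    ShattersSequence c = ∀ (s : ℕ → Bool) → ∃[ a ] (∀ i → Sat M φ (a ++ c i) is s i)

    -- For a fixed pattern the literals form a type over the countably many entries of `c`, and each
    -- finite part concerns indices below some `r`.
    shattersSequence : ∀ c → (∀ r (s : ℕ → Bool) → ∃[ a ] (∀ i → i ℕ.< r → Sat M φ (a ++ c i) is s i)) → ShattersSequence c
    shattersSequence c finite s =
      let (a , h) = realise m (Entries-countable c) p over fs
      in a , λ i → to (literal-sat i a) (h (literal i) (i , refl))
      where
      literal : ℕ → FormulaWithParams M m
      literal i = record { formula = formula (def-is (by-formula φ) (s i)) ; params = c i }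
      literal-sat : ∀ i a → a ⊩ literal i ⇔ (Sat M φ (a ++ c i) is s i)
      literal-sat i a = correct (def-is (by-formula φ) (s i)) M (a ++ c i)
      p : Pred (FormulaWithParams M m) ℓ
      p ψ = ∃[ i ] ψ ≡ literal i
      over : ∀ ψ → ψ ∈ p → IsOver M (Entries c) ψ
      over _ (i , refl) = VecAll.map (λ (t , eq) → i , t , eq) (over-entries (c i))
      bound : ∀ ψs → ListAll p ψs → ∃[ r ] (∀ a → (∀ i → i ℕ.< r → a ⊩ literal i) → ListAll (a ⊩_) ψs)
      bound [] [] = 0 , λ _ _ → []
      bound (_ ∷ ψs) ((i , refl) ∷ rest) with bound ψs rest
      ... | r , h = suc i ℕ.+ r , λ a f → f i (ℕ.m≤m+n (suc i) r) ∷ h a λ j j<r → f j (ℕ.<-≤-trans j<r (ℕ.m≤n+m r (suc i)))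
      fs : FinitelySatisfiable M p
      fs ψs all with bound ψs all
      ... | r , h with finite r s
      ...   | a , f = a , h a λ i i<r → from (literal-sat i a) (f i i<r)

    module _ (ip : IPIn {m} {n} φ M) where
      private
        -- The `r` blocks of `v` can be prolonged by `p` further tuples so that all of them together
        -- are shattered. This is a first-order condition on `v`, so it may enter a type.
        Extends : ∀ (p r : ℕ) → Family (r ℕ.* n)
        Extends zero    r N v = Shatters φ N (λ i → sel (block {n} {r} i) v)
        Extends (suc p) r N v = Σ[ y ∈ Vec (Structure.Domain N) n ] Extends p (suc r) N (y ++ v)

        def-Extends : ∀ p r → Definable (Extends p r)
        def-Extends zero    r = def-Shatters φ r (block {n} {r})
        def-Extends (suc p) r = def-∃* n (def-Extends p (suc r))

        block-zero : ∀ {r} (y : Vec Domain n) (v : Vec Domain (r ℕ.* n)) → sel (block {n} {suc r} zero) (y ++ v) ≡ y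
        block-zero y v = sel-left y v

        block-suc : ∀ {r} (y : Vec Domain n) (v : Vec Domain (r ℕ.* n)) (i : Fin r) →
          sel (block {n} {suc r} (suc i)) (y ++ v) ≡ sel (block {n} {r} i) v
        block-suc {r} y v i = trans (cong (λ ρ → sel ρ (y ++ v)) (Vec.tabulate-∘ (n Fin.↑ʳ_) (combine {r} i))) (sel-↑ʳ y v (block {n} {r} i))

        shorter : ∀ p r v → Extends (suc p) r M v → Extends p r M v
        shorter zero r v (y , h) s with h (true ∷ s)
        ... | a , f = a , λ i → subst (λ u → Sat M φ (a ++ u) is lookup s i) (block-suc y v i) (f (suc i))
        shorter (suc p) r v (y , h) = y , shorter p (suc r) (y ++ v) h

        shorter≤ : ∀ p d r v → Extends (d ℕ.+ p) r M v → Extends p r M v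
        shorter≤ p zero    r v h = h
        shorter≤ p (suc d) r v h = shorter≤ p d r v (shorter (d ℕ.+ p) r v h)

        extends : ∀ p r v (b : Fin p → Vec Domain n) →
          (∀ (s : Vec Bool p) (t : Vec Bool r) → ∃[ a ] (∀ i → Sat M φ (a ++ b i) is lookup s i) ×
            (∀ j → Sat M φ (a ++ sel (block {n} {r} j) v) is lookup t j)) → Extends p r M v
        extends zero r v b h t = let (a , _ , f) = h [] t in a , f
        extends (suc p) r v b h = b zero , extends p (suc r) (b zero ++ v) (b ∘ suc) step
          where
          step : ∀ (s : Vec Bool p) (t : Vec Bool (suc r)) → ∃[ a ] (∀ i → Sat M φ (a ++ b (suc i)) is lookup s i) ×
            (∀ j → Sat M φ (a ++ sel (block {n} {suc r} j) (b zero ++ v)) is lookup t j)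
          step s (t₀ ∷ t) with h (t₀ ∷ s) t
          ... | a , f , g = a , f ∘ suc , λ
            { zero    → subst (λ u → Sat M φ (a ++ u) is t₀) (sym (block-zero {r} (b zero) v)) (f zero)
            ; (suc j) → subst (λ u → Sat M φ (a ++ u) is lookup t j) (sym (block-suc {r} (b zero) v j)) (g j) }

        Good : ∀ r → Vec Domain (r ℕ.* n) → Set ℓ
        Good r v = ∀ p → Extends p r M v

        good-[] : Good 0 []
        good-[] p = let (b , h) = ip p in extends p 0 [] b λ { s [] → let (a , f) = h s in a , f , λ () }

        abstract
          -- The new tuple realises the conditions `Extends p` for all `p` simultaneously. They
          -- weaken as `p` decreases, so finitely many of them follow from one large `P`, and
          -- goodness of `v` at `suc P` satisfies that one.
          good-∷ : ∀ r v → Good r v → ∃[ y ] Good (suc r) (y ++ v)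
          good-∷ r v good =
            let (y , h) = realise n (EntriesOf-countable v) q over fs
            in y , λ p → to (correct (def-Extends p (suc r)) M (y ++ v)) (h (ψ p) (p , refl))
            where
            ψ : ℕ → FormulaWithParams M n
            ψ p = record { formula = formula (def-Extends p (suc r)) ; params = v }
            q : Pred (FormulaWithParams M n) ℓ
            q χ = ∃[ p ] χ ≡ ψ p
            over : ∀ χ → χ ∈ q → IsOver M (EntriesOf v) χ
            over _ (p , refl) = over-entries v
            bound : ∀ χs → ListAll q χs → ∃[ P ] (∀ y → Extends P (suc r) M (y ++ v) → ListAll (y ⊩_) χs)
            bound [] [] = 0 , λ _ _ → []
            bound (_ ∷ χs) ((p , refl) ∷ rest) with bound χs rest
            ... | P , h = P ℕ.+ p , λ y e →
                from (correct (def-Extends p (suc r)) M (y ++ v)) (shorter≤ p P (suc r) (y ++ v) e)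
              ∷ h y (shorter≤ P p (suc r) (y ++ v) (subst (λ k → Extends k (suc r) M (y ++ v)) (ℕ.+-comm P p) e))
            fs : FinitelySatisfiable M q
            fs χs all with bound χs all
            ... | P , h with good (suc P)
            ...   | y , e = y , h y e

        history : ∀ r → Σ[ v ∈ Vec Domain (r ℕ.* n) ] Good r v
        history zero    = [] , good-[]
        history (suc r) = let (v , good) = history r ; (y , good′) = good-∷ r v good in y ++ v , good′

        e : ℕ → Vec Domain n
        e r = proj₁ (good-∷ r (proj₁ (history r)) (proj₂ (history r)))

        -- Reversed, because `history` puts the latest term first.
        bits : (ℕ → Bool) → ∀ r → Vec Bool r
        bits s zero    = []
        bits s (suc r) = s r ∷ bits s r

        read : ∀ s r a → (∀ j → Sat M φ (a ++ sel (block {n} {r} j) (proj₁ (history r))) is lookup (bits s r) j) →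
          ∀ i → i ℕ.< r → Sat M φ (a ++ e i) is s i
        read s (suc r) a f i (s≤s i≤r) with ℕ.m≤n⇒m<n∨m≡n i≤r
        ... | inj₂ refl = subst (λ u → Sat M φ (a ++ u) is s r) (block-zero {r} (e r) (proj₁ (history r))) (f zero)
        ... | inj₁ i<r  = read s r a (λ j → subst (λ u → Sat M φ (a ++ u) is lookup (bits s r) j)
                            (block-suc {r} (e r) (proj₁ (history r)) j) (f (suc j))) i i<r

      abstract
        shatteredSequence : ∃[ c ] ShattersSequence c
        shatteredSequence = e , shattersSequence e λ r s →
          proj₁ (pattern′ r s) , read s r (proj₁ (pattern′ r s)) (proj₂ (pattern′ r s))
          where
          pattern′ : ∀ r s → Pattern φ M (λ i → sel (block {n} {r} i) (proj₁ (history r))) (bits s r)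
          pattern′ r s = proj₂ (history r) zero (bits s r)

  -- Each cᵣ realises, over e and the earlier terms of c, the type of the formulas true of 𝒰-almost all eᵢ.
  module Coheir {n} (e : ℕ → Vec Domain n) where
    private
      Over : ∀ {k} → Vec Domain k → Pred Domain ℓ
      Over v = Entries e ∪ EntriesOf v

      abstract
        pick : ∀ {k} (v : Vec Domain k) → ∃[ y ] (∀ ψ → IsOver M (Over v) ψ × ∀ᵁ (λ i → e i ⊩ ψ) → y ⊩ ψ)
        pick v = realise n (∪-countable (Entries-countable e) (EntriesOf-countable v)) q (λ _ → proj₁) fs
          where
          q : Pred (FormulaWithParams M n) ℓ
          q ψ = IsOver M (Over v) ψ × ∀ᵁ (λ i → e i ⊩ ψ)
          all : ∀ ψs → ListAll q ψs → ∀ᵁ (λ i → ListAll (e i ⊩_) ψs)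
          all [] [] = ∀ᵁ-eventually 0 λ _ _ → []
          all (ψ ∷ ψs) ((_ , u) ∷ us) = ∀ᵁ-zip (λ i s ss → s ∷ ss) u (all ψs us)
          fs : FinitelySatisfiable M q
          fs ψs h with ∀ᵁ-exists (all ψs h) 0
          ... | i , _ , s = e i , s

      history : ∀ r → Vec Domain (r ℕ.* n)
      history zero    = []
      history (suc r) = proj₁ (pick (history r)) ++ history r

    c : ℕ → Vec Domain n
    c r = proj₁ (pick (history r))

    private
      earlier : ∀ {j r} → j ℕ.< r → ∀ {x} → EntriesOf (c j) x → EntriesOf (history r) x
      earlier {j} {suc r} (s≤s j≤r) (t , eq) with ℕ.m≤n⇒m<n∨m≡n j≤r
      ... | inj₂ refl = t Fin.↑ˡ _ , trans (Vec.lookup-++ˡ (c r) (history r) t) eq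
      ... | inj₁ j<r with earlier j<r (t , eq)
      ...   | u , eq′ = n Fin.↑ʳ u , trans (Vec.lookup-++ʳ (c r) (history r) u) eq′

      -- The choice of `c r` gives one direction for ψ and, applied to its negation, the other: the
      -- ultrafilter decides which of the two holds almost everywhere.
      generic₁ : ∀ r ψ → IsOver M (Over (history r)) ψ → (c r ⊩ ψ) ⇔ ∀ᵁ (λ i → e i ⊩ ψ)
      generic₁ r ψ over = mk⇔
        (λ s → dne λ ¬u → lower (proj₂ (pick (history r)) (record { formula = ¬′ FormulaWithParams.formula ψ ; params = FormulaWithParams.params ψ })
          (over , ∀ᵁ-map (λ i ¬s t → lift (¬s t)) (∀ᵁ-¬ ¬u)) s))
        (λ u → proj₂ (pick (history r)) ψ (over , u))

    -- Inc α β v: the tuple v lists members of c with indices in [α, β), the latest index first.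
    data Inc (α : ℕ) : ℕ → ∀ {r} → Vec (Vec Domain n) r → Set ℓ where
      []   : Inc α α []
      more : ∀ {β r j} {v : Vec (Vec Domain n) r} → Inc α β v → β ℕ.≤ j → Inc α (suc j) (c j ∷ v)

    Inc-++ : ∀ {α β γ r r′} {v : Vec (Vec Domain n) r} {w : Vec (Vec Domain n) r′} → Inc α β v → Inc β γ w → Inc α γ (w ++ v)
    Inc-++ i []         = i
    Inc-++ i (more j p) = more (Inc-++ i j) p

    -- The iterated ultrafilter quantifier; the outermost one governs the head of the tuple, that
    -- is, its latest member. The boolean in the base case keeps all of it in `Set`.
    Q : ∀ {b} r → (Vec (Vec Domain n) r → Set b) → Set
    Q zero    D = ⌊ D [] ⌋ ≡ true
    Q (suc r) D = ∀ᵁ λ i → Q r (λ es → D (e i ∷ es))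

    Q-map : ∀ {b b′} r {D : Vec (Vec Domain n) r → Set b} {D′ : Vec (Vec Domain n) r → Set b′} →
      (∀ es → D es → D′ es) → Q r D → Q r D′
    Q-map zero    f q = holds (f [] (truth q))
    Q-map (suc r) f q = ∀ᵁ-map (λ i → Q-map r (λ es → f (e i ∷ es))) q

    private

      inc-over : ∀ {α β r} {v : Vec (Vec Domain n) r} → Inc α β v → ∀ {j} → β ℕ.≤ j → VecAll (EntriesOf (history j)) (Vec.concat v)
      inc-over [] p = []
      inc-over (more {j = j′} i q) p = VecAll.++⁺ (VecAll.map (earlier p) (over-entries (c j′))) (inc-over i (ℕ.≤-trans q (ℕ.<⇒≤ p)))

      regroup : ∀ {A C} → Vec (Fin (n ℕ.+ (A ℕ.+ C))) ((n ℕ.+ A) ℕ.+ C)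
      regroup {A} {C} = (left n (A ℕ.+ C) ++ Vec.map (n Fin.↑ʳ_) (left A C)) ++ Vec.map (n Fin.↑ʳ_) (right A C)

      sel-regroup : ∀ {A C} (y : Vec Domain n) (v : Vec Domain A) (d : Vec Domain C) →
        sel (regroup {A} {C}) (y ++ (v ++ d)) ≡ (y ++ v) ++ d
      sel-regroup {A} {C} y v d = trans (sel-++ (left n _ ++ Vec.map (n Fin.↑ʳ_) (left A C)) _ (y ++ (v ++ d))) (cong₂ _++_
        (trans (sel-++ (left n _) (Vec.map (n Fin.↑ʳ_) (left A C)) (y ++ (v ++ d)))
          (cong₂ _++_ (sel-left y (v ++ d)) (trans (sel-↑ʳ y (v ++ d) (left A C)) (sel-left v d))))
        (trans (sel-↑ʳ y (v ++ d) (right A C)) (sel-right v d)))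

      swap : ∀ {A C} → Vec (Fin (A ℕ.+ (n ℕ.+ C))) ((n ℕ.+ A) ℕ.+ C)
      swap {A} {C} = (Vec.map (A Fin.↑ʳ_) (left n C) ++ left A (n ℕ.+ C)) ++ Vec.map (A Fin.↑ʳ_) (right n C)

      sel-swap : ∀ {A C} (y : Vec Domain n) (v : Vec Domain A) (d : Vec Domain C) →
        sel (swap {A} {C}) (v ++ (y ++ d)) ≡ (y ++ v) ++ d
      sel-swap {A} {C} y v d = trans (sel-++ (Vec.map (A Fin.↑ʳ_) (left n C) ++ left A _) _ (v ++ (y ++ d))) (cong₂ _++_
        (trans (sel-++ (Vec.map (A Fin.↑ʳ_) (left n C)) (left A _) (v ++ (y ++ d)))
          (cong₂ _++_ (trans (sel-↑ʳ v (y ++ d) (left n C)) (sel-left y d)) (sel-left v (y ++ d))))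
        (trans (sel-↑ʳ v (y ++ d) (right n C)) (sel-right y d)))

      -- Parameters from e are needed for the induction: the latest member of c is
      -- replaced by e i, which then joins the parameters.
      genericWith : ∀ {C} r (θ : Formula L (r ℕ.* n ℕ.+ C)) (d : Vec Domain C) → VecAll (Entries e) d →
        ∀ {α β} {v : Vec (Vec Domain n) r} → Inc α β v →
        Sat M θ (Vec.concat v ++ d) ⇔ Q r (λ es → Sat M θ (Vec.concat es ++ d))
      genericWith zero θ d d-over [] = mk⇔ holds truth
      genericWith {C} (suc r) θ d d-over (more {j = j} {v} i β≤j) = mk⇔
          (λ s → ∀ᵁ-map (λ i₀ t → Q-map r (λ es → to (swapped i₀ es)) (to (step i₀) (from (swapped i₀ v) (to (grouped (e i₀)) t))))
                   (to (generic₁ j ψ ψ-over) (from (grouped (c j)) s)))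
          (λ q → to (grouped (c j)) (from (generic₁ j ψ ψ-over)
                   (∀ᵁ-map (λ i₀ t → from (grouped (e i₀)) (to (swapped i₀ v) (from (step i₀) (Q-map r (λ es → from (swapped i₀ es)) t)))) q)))
        where
        θ₁ = def-sel (by-formula θ) (regroup {r ℕ.* n} {C})
        ψ : FormulaWithParams M n
        ψ = record { formula = formula θ₁ ; params = Vec.concat v ++ d }
        ψ-over : IsOver M (Over (history j)) ψ
        ψ-over = VecAll.++⁺ (VecAll.map inj₂ (inc-over i β≤j)) (VecAll.map inj₁ d-over)
        grouped : ∀ y → (y ⊩ ψ) ⇔ Sat M θ (Vec.concat (y ∷ v) ++ d)
        grouped y = subst (λ u → (y ⊩ ψ) ⇔ Sat M θ u) (sel-regroup y (Vec.concat v) d) (correct θ₁ M (y ++ (Vec.concat v ++ d)))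
        θ₂ = def-sel (by-formula θ) (swap {r ℕ.* n} {C})
        swapped : ∀ i₀ es → Sat M (formula θ₂) (Vec.concat es ++ (e i₀ ++ d)) ⇔ Sat M θ (Vec.concat (e i₀ ∷ es) ++ d)
        swapped i₀ es = subst (λ u → Sat M (formula θ₂) (Vec.concat es ++ (e i₀ ++ d)) ⇔ Sat M θ u)
          (sel-swap (e i₀) (Vec.concat es) d) (correct θ₂ M (Vec.concat es ++ (e i₀ ++ d)))
        step : ∀ i₀ → _
        step i₀ = genericWith r (formula θ₂) (e i₀ ++ d)
          (VecAll.++⁺ (VecAll.map (λ (t , eq) → i₀ , t , eq) (over-entries (e i₀))) d-over) i

    generic : ∀ {r} {D : Family (r ℕ.* n)} → Definable D → ∀ {α β} {v : Vec (Vec Domain n) r} → Inc α β v →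
      D M (Vec.concat v) ⇔ Q r (λ es → D M (Vec.concat es))
    generic {r} {D} d {v = v} i = mk⇔
        (λ p → Q-map r (λ es → to (padded es)) (to (genericWith r (formula d₀) [] [] i) (from (padded v) p)))
        (λ q → to (padded v) (from (genericWith r (formula d₀) [] [] i) (Q-map r (λ es → from (padded es)) q)))
      where
      d₀ = def-sel d (left (r ℕ.* n) 0)
      padded : ∀ es → Sat M (formula d₀) (Vec.concat es ++ []) ⇔ D M (Vec.concat es)
      padded es = subst (λ u → Sat M (formula d₀) (Vec.concat es ++ []) ⇔ D M u) (sel-left (Vec.concat es) [])
        (correct d₀ M (Vec.concat es ++ []))

    -- The right-hand side of `generic` depends on the tuple only through its length.
    indiscernible : ∀ {r} {D : Family (r ℕ.* n)} → Definable D →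
      ∀ {α β α′ β′} {v w : Vec (Vec Domain n) r} → Inc α β v → Inc α′ β′ w → D M (Vec.concat v) → D M (Vec.concat w)
    indiscernible d i j p = from (generic d j) (to (generic d i) p)

    down : ∀ {b} {B : Set b} → (ℕ → B) → ∀ r → Vec B r
    down f zero    = []
    down f (suc r) = f r ∷ down f r

    downIndex : ∀ r i → i ℕ.< r → Fin r
    downIndex (suc r) i (s≤s i≤r) with ℕ.m≤n⇒m<n∨m≡n i≤r
    ... | inj₂ refl = zero
    ... | inj₁ i<r  = suc (downIndex r i i<r)

    down-lookup : ∀ {b} {B : Set b} (f : ℕ → B) r i i<r → lookup (down f r) (downIndex r i i<r) ≡ f i
    down-lookup f (suc r) i (s≤s i≤r) with ℕ.m≤n⇒m<n∨m≡n i≤r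
    ... | inj₂ refl = refl
    ... | inj₁ i<r  = down-lookup f r i i<r

    Inc-down : ∀ d r → Inc d (d ℕ.+ r) (down (λ i → c (d ℕ.+ i)) r)
    Inc-down d zero    rewrite ℕ.+-identityʳ d = []
    Inc-down d (suc r) rewrite ℕ.+-suc d r = more (Inc-down d r) ℕ.≤-refl

    module _ {m} (φ : Formula L (m ℕ.+ n)) (shattered : ShattersSequence φ e) where
      private
        update : (ℕ → Bool) → ℕ → Bool → ℕ → Bool
        update s i b j = if ⌊ j ≡ i ⌋ then b else s j

        update-at : ∀ s i b → update s i b i ≡ b
        update-at s i b rewrite holds (refl {x = i}) = refl

        update-off : ∀ s i b j → j ≢ i → update s i b j ≡ s j
        update-off s i b j ne rewrite fails ne = refl

        -- Values at the indices below `N` are prescribed as well, to make the induction work: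
        -- almost every next index `i` is at least `N`, so its value can still be set by updating
        -- `s` at `i`, and the bound then rises to `suc i`.
        patterns : ∀ r (t : Vec Bool r) N (s : ℕ → Bool) → Q r (λ es → ∃[ a ]
          (∀ i → i ℕ.< N → Sat M φ (a ++ e i) is s i) × (∀ j → Sat M φ (a ++ lookup es j) is lookup t j))
        patterns zero [] N s = let (a , f) = shattered s in holds (a , (λ i _ → f i) , λ ())
        patterns (suc r) (t₀ ∷ t) N s = ∀ᵁ-eventually N λ i N≤i → Q-map r
          (λ es (a , f , g) → a
            , (λ k k<N → subst (Sat M φ (a ++ e k) is_) (update-off s i t₀ k (ℕ.<⇒≢ (ℕ.<-≤-trans k<N N≤i))) (f k (ℕ.m<n⇒m<1+n (ℕ.<-≤-trans k<N N≤i))))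
            , λ { zero → subst (Sat M φ (a ++ e i) is_) (update-at s i t₀) (f i ℕ.≤-refl) ; (suc j) → g j })
          (patterns r t (suc i) (update s i t₀))

      abstract
        coheir-shattered : ShattersSequence φ c
        coheir-shattered = shattersSequence φ c λ r s →
          let (a , f) = from (generic (def-Pattern φ r (block {n} {r}) (down s r)) (Inc-down 0 r))
                (Q-map r (λ es (a , _ , g) → a , λ j → subst (λ u → Sat M φ (a ++ u) is lookup (down s r) j) (sym (sel-block es j)) (g j))
                  (patterns r (down s r) 0 s))
          in a , λ i i<r → subst₂ (λ u b → Sat M φ (a ++ u) is b)
               (trans (sel-block (down c r) (downIndex r i i<r)) (down-lookup c r i i<r)) (down-lookup s r i i<r) (f (downIndex r i i<r))

-- Reduction to one object variable

module Reduction (em : ∀ {a} → ExcludedMiddle a) (ext : ∀ {a b} → Extensionality a b)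
  {ℓ} {L : Language ℓ} (M : Structure L) (saturated : IsSaturated M)
  (uncountable : ¬ (Σ[ f ∈ (Structure.Domain M → ℕ) ] Injective _≡_ _≡_ f)) where
  open Classical em
  open Logic em {L = L}
  open Definable
  open Structure M using (Domain)
  open Equivalence
  open Saturation em ext M saturated uncountable
  open Sequences em ext M saturated uncountable

  private
    parity : ℕ → Bool
    parity zero    = true
    parity (suc n) = not (parity n)

    hit : ∀ β b → ∃[ j ] β ℕ.≤ j × parity j ≡ b
    hit β b with parity β in eq | b
    ... | true  | true  = β , ℕ.≤-refl , eq
    ... | false | false = β , ℕ.≤-refl , eq
    ... | true  | false = suc β , ℕ.n≤1+n β , cong not eq
    ... | false | true  = suc β , ℕ.n≤1+n β , cong not eq

    uniformBound : ∀ {a} N {P : Vec Bool N → ℕ → Set a} → (∀ ε α β → α ℕ.≤ β → P ε α → P ε β) →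
      (∀ ε → ∃[ α ] P ε α) → ∃[ α ] (∀ ε → P ε α)
    uniformBound zero    mono h = let (α , p) = h [] in α , λ { [] → p }
    uniformBound (suc N) mono h =
      let (α , p) = uniformBound N (λ ε → mono (true ∷ ε)) (λ ε → h (true ∷ ε))
          (β , q) = uniformBound N (λ ε → mono (false ∷ ε)) (λ ε → h (false ∷ ε))
      in α ℕ.+ β , λ { (true ∷ ε) → mono _ _ _ (ℕ.m≤m+n α β) (p ε) ; (false ∷ ε) → mono _ _ _ (ℕ.m≤n+m β α) (q ε) }

  -- With φ(a₀,a₁;cᵢ) alternating along an indiscernible sequence, either all the formulas
  -- ψ_ε(a₁;ȳ) = ∃x₀ ⋀ₜ φ(x₀,a₁;yₜ)^ε(t) hold of all late tuples, and then φ(x₀;a₁,·) shatters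
  -- these, or some ψ_ε(a₁;·) takes both values on arbitrarily late tuples.
  module _ {m n} (φ : Formula L (suc m ℕ.+ n)) (ip : IPIn {suc m} φ M) where
    private
      e : ℕ → Vec Domain n
      e = proj₁ (shatteredSequence {suc m} φ ip)
      open Coheir e
      alternating : ∃[ a ] (∀ i → Sat M φ (a ++ c i) is parity i)
      alternating = coheir-shattered {suc m} φ (proj₂ (shatteredSequence {suc m} φ ip)) parity
      a₀ : Domain
      a₀ = Vec.head (proj₁ alternating)
      a₁ : Vec Domain m
      a₁ = Vec.tail (proj₁ alternating)
      alternates : ∀ i → Sat M φ (a₀ ∷ a₁ ++ c i) is parity i
      alternates = uncons (proj₁ alternating) (proj₂ alternating)
        where
        uncons : ∀ a → (∀ i → Sat M φ (a ++ c i) is parity i) → ∀ i → Sat M φ (Vec.head a ∷ Vec.tail a ++ c i) is parity i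
        uncons (x ∷ v) h = h

      module _ {N} (ε : Vec Bool N) where
        Ψ : Family (m ℕ.+ N ℕ.* n)
        Ψ N′ v = ∃[ x ] (∀ t → Sat N′ φ (x ∷ sel (under m (block {n} {N} t)) v) is lookup ε t)

        abstract
          def-Ψ : Definable Ψ
          def-Ψ = def-resp (def-∃ (def-∀Fin N λ t → def-is (def-sel (by-formula φ) (under 1 (under m (block {n} {N} t)))) (lookup ε t)))
            λ N′ v → mk⇔ (λ (x , h) → x , λ t → subst (λ u → Sat N′ φ u is lookup ε t) (sel-under (x ∷ []) v (under m (block {n} {N} t))) (h t))
                         (λ (x , h) → x , λ t → subst (λ u → Sat N′ φ u is lookup ε t) (sym (sel-under (x ∷ []) v (under m (block {n} {N} t)))) (h t))

        ψ : Formula L (m ℕ.+ N ℕ.* n)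
        ψ = formula def-Ψ

        ψ-at : ∀ v → Sat M ψ (a₁ ++ Vec.concat v) ⇔ (∃[ x ] (∀ t → Sat M φ (x ∷ a₁ ++ lookup v t) is lookup ε t))
        ψ-at v = mk⇔
            (λ s → map₂ (λ h t → subst (λ u → Sat M φ (_ ∷ u) is lookup ε t) (at t) (h t)) (to (correct def-Ψ M (a₁ ++ Vec.concat v)) s))
            (λ (x , h) → from (correct def-Ψ M (a₁ ++ Vec.concat v)) (x , λ t → subst (λ u → Sat M φ (x ∷ u) is lookup ε t) (sym (at t)) (h t)))
          where
          at : ∀ t → sel (under m (block {n} {N} t)) (a₁ ++ Vec.concat v) ≡ a₁ ++ lookup v t
          at t = trans (sel-under a₁ (Vec.concat v) (block {n} {N} t)) (cong (a₁ ++_) (sel-block v t))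

        Always : ℕ → Set ℓ
        Always α = ∀ β (v : Vec (Vec Domain n) N) → Inc α β v → Sat M ψ (a₁ ++ Vec.concat v)

      -- The lower bound constrains the earliest member only. An empty tuple forces the two bounds
      -- to coincide, hence the length `suc r`.
      Inc-weaken : ∀ {α α′ β r} {v : Vec (Vec Domain n) (suc r)} → α′ ℕ.≤ α → Inc α β v → Inc α′ β v
      Inc-weaken {r = zero}  le (more [] p) = more [] (ℕ.≤-trans le p)
      Inc-weaken {r = suc r} le (more i p)  = more (Inc-weaken le i) p

      matching : ∀ {N} (ε : Vec Bool N) α → Σ[ v ∈ Vec (Vec Domain n) N ] ∃[ β ] Inc α β v ×
        (∀ t → Sat M φ (a₀ ∷ a₁ ++ lookup v t) is lookup ε t)
      matching [] α = [] , α , [] , λ ()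
      matching (b ∷ ε) α with matching ε α
      ... | v , β , i , h with hit β b
      ...   | j , β≤j , refl = c j ∷ v , suc j , more i β≤j , λ { zero → alternates j ; (suc t) → h t }

      matching-true : ∀ {N} (ε : Vec Bool N) α → Σ[ v ∈ Vec (Vec Domain n) N ] ∃[ β ] Inc α β v × Sat M (ψ ε) (a₁ ++ Vec.concat v)
      matching-true ε α with matching ε α
      ... | v , β , i , h = v , β , i , from (ψ-at ε v) (a₀ , h)

      module _ {N} (ε : Vec Bool N) (never : ¬ (∃[ α ] Always ε α)) where

        tuple : ∀ b α → Σ[ v ∈ Vec (Vec Domain n) N ] ∃[ β ] Inc α β v × (Sat M (ψ ε) (a₁ ++ Vec.concat v) is b)
        tuple true α with matching-true ε α
        ... | v , β , i , h = v , β , i , mk⇔ (λ _ → refl) (λ _ → h)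
        tuple false α = dne λ none → never (α , λ β v i → dne λ ¬s →
          none (v , β , i , mk⇔ (⊥-elim ∘ ¬s) λ ()))

        tuples : ∀ {p} (s : Vec Bool p) → Σ[ B ∈ Vec (Vec (Vec Domain n) N) p ] ∃[ β ] Inc 0 β (Vec.concat B) ×
          (∀ i → Sat M (ψ ε) (a₁ ++ Vec.concat (lookup B i)) is lookup s i)
        tuples [] = [] , 0 , [] , λ ()
        tuples (b ∷ s) with tuples s
        ... | B , β , i , h with tuple b β
        ...   | v , γ , j , k = v ∷ B , γ , Inc-++ i j , λ { zero → k ; (suc t) → h t }

        ip-ψ : IPIn {m} (ψ ε) M
        ip-ψ p with tuples (Vec.replicate p true)
        ... | B , β , i , _ = (λ t → sel (blocks {n} {N} {p} t) (Vec.concat (Vec.concat B))) , λ s → shatter s (tuples s)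
          where
          shatter : ∀ s → (Σ[ B′ ∈ Vec (Vec (Vec Domain n) N) p ] ∃[ β ] Inc 0 β (Vec.concat B′) ×
            (∀ i → Sat M (ψ ε) (a₁ ++ Vec.concat (lookup B′ i)) is lookup s i)) →
            Pattern {m} (ψ ε) M (λ t → sel (blocks {n} {N} {p} t) (Vec.concat (Vec.concat B))) s
          -- `B′` depends on `s`, but it is an increasing tuple of the same length as `B`; the
          -- existence of a witness for the pattern `s` therefore passes to the fixed `B`.
          shatter s (B′ , _ , j , h) = indiscernible (def-Pattern {m} (ψ ε) p (blocks {n} {N} {p}) s) j i
            (a₁ , λ t → subst (λ u → Sat M (ψ ε) (a₁ ++ u) is lookup s t) (sym (sel-blocks B′ t)) (h t))

    reduceOne : IPIn {1} {m ℕ.+ n} φ M ⊎ (∃[ N ] Σ[ ψ ∈ Formula L (m ℕ.+ N) ] IPIn {m} {N} ψ M)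
    reduceOne with em {P = ∃[ N ] ∃[ ε ] ¬ (∃[ α ] Always {suc N} ε α)}
    ... | yes (N , ε , never) = inj₂ (suc N ℕ.* n , ψ ε , ip-ψ ε never)
    ... | no none = inj₁ λ
      { zero → (λ ()) , λ s → a₀ ∷ [] , λ ()
      ; (suc N) → let (α , h) = uniformBound (suc N) {Always} (λ ε α α′ le f β v i → f β v (Inc-weaken le i))
                                  (λ ε → dne λ ¬p → none (N , ε , ¬p))
                      (v , β , i , _) = matching (Vec.replicate (suc N) true) α
                  in (λ t → a₁ ++ lookup v t) , λ ε → let (x , k) = to (ψ-at ε v) (h ε β v i) in x ∷ [] , k }

  reduce : ∀ m {n} (φ : Formula L (m ℕ.+ n)) → IPIn {m} φ M → ∃[ n′ ] Σ[ ψ ∈ Formula L (1 ℕ.+ n′) ] IPIn {1} {n′} ψ M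
  -- Without object variables the witness is the empty tuple, and the two patterns on one tuple
  -- contradict each other.
  reduce zero φ ip with ip 1
  ... | b , h with h (true ∷ []) | h (false ∷ [])
  ...   | [] , f | [] , g = case to (g zero) (from (f zero) refl) of λ ()
  reduce (suc m) φ ip with reduceOne {m} φ ip
  ... | inj₁ ip₁           = _ , φ , ip₁
  ... | inj₂ (N , ψ , ip′) = reduce m ψ ip′

-- Extending countable elementary maps to automorphisms

module Homogeneity (em : ∀ {a} → ExcludedMiddle a) (ext : ∀ {a b} → Extensionality a b)
  {ℓ} {L : Language ℓ} (M : Structure L) (saturated : IsSaturated M)
  (uncountable : ¬ (Σ[ f ∈ (Structure.Domain M → ℕ) ] Injective _≡_ _≡_ f)) where
  open Classical em
  open Cardinal em ext
  open Logic em {L = L}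
  open Definable
  open Structure M using (Domain; ⟦fun⟧; ⟦rel⟧)
  open Equivalence
  open Saturation em ext M saturated uncountable

  Relation : Set (lsuc ℓ)
  Relation = Domain → Domain → Set ℓ

  -- A partial elementary map as a relation: preservation of the formula x = y makes it functional,
  -- and preservation of negations makes its converse elementary, hence also functional.
  record Elementary (Q : Relation) : Set ℓ where
    constructor elementary
    field
      preserve : ∀ k (v w : Vec Domain k) → (∀ i → Q (lookup v i) (lookup w i)) → ∀ φ → Sat M φ v → Sat M φ w

  open Elementary

  Elementary-flip : ∀ {Q} → Elementary Q → Elementary (flip Q)
  Elementary-flip el = elementary λ k v w h φ s → dne λ ¬s → lower (preserve el k w v h (¬′ φ) (λ t → lift (¬s t)) s)

  Elementary-⊆ : ∀ {Q Q′ : Relation} → (∀ {x y} → Q x y → Q′ x y) → Elementary Q′ → Elementary Q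
  Elementary-⊆ sub el = elementary λ k v w h → preserve el k v w (sub ∘ h)

  Range : Relation → Pred Domain ℓ
  Range Q y = ∃[ x ] Q x y

  infixl 5 _⊕_
  _⊕_ : Relation → Domain × Domain → Relation
  (Q ⊕ (a , b)) x y = Q x y ⊎ x ≡ a × y ≡ b

  abstract
    -- The point `b` realises the type of `a` over the domain of `Q`, transported along `Q` to its
    -- small range. A finite part of it is satisfiable because `Q` preserves the existential formula
    -- that `a` witnesses.
    forth : ∀ {Q} → Elementary Q → IsSmall M (Range Q) → ∀ a → ∃[ b ] Elementary (Q ⊕ (a , b))
    forth {Q} el small a = b , elementary extended
      where
      p : Pred (FormulaWithParams M 1) ℓ
      p ψ = Σ[ v ∈ Vec Domain (FormulaWithParams.arity ψ) ]
        (∀ i → Q (lookup v i) (lookup (FormulaWithParams.params ψ) i)) × Sat M (FormulaWithParams.formula ψ) (a ∷ v)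

      over′ : ∀ {k} (v w : Vec Domain k) → (∀ i → Q (lookup v i) (lookup w i)) → VecAll (Range Q) w
      over′ []      []      h = []
      over′ (x ∷ v) (y ∷ w) h = (x , h zero) ∷ over′ v w (h ∘ suc)

      combine′ : ∀ ψs → ListAll p ψs → ∃[ k ] Σ[ v ∈ Vec Domain k ] Σ[ w ∈ Vec Domain k ] Σ[ χ ∈ Formula L (suc k) ]
        (∀ i → Q (lookup v i) (lookup w i)) × Sat M χ (a ∷ v) × (∀ y → Sat M χ (y ∷ w) → ListAll ((y ∷ []) ⊩_) ψs)
      combine′ [] [] = 0 , [] , [] , (false ⟹ false) , (λ ()) , id , λ _ _ → []
      combine′ (ψ ∷ ψs) ((v , h , s) ∷ rest) with combine′ ψs rest
      ... | k , v′ , w′ , χ , h′ , s′ , g =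
          _ , v ++ v′ , w ++ w′ , formula d , related ,
          from (correct d M (a ∷ v ++ v′))
            ( subst (Sat M (FormulaWithParams.formula ψ)) (sym (sel-under (a ∷ []) (v ++ v′) (left _ k))) (subst (λ u → Sat M (FormulaWithParams.formula ψ) (a ∷ u)) (sym (sel-left v v′)) s)
            , subst (Sat M χ) (sym (sel-under (a ∷ []) (v ++ v′) (right _ k))) (subst (λ u → Sat M χ (a ∷ u)) (sym (sel-right v v′)) s′)) ,
          λ y t → let (t₁ , t₂) = to (correct d M (y ∷ w ++ w′)) t in
              subst (λ u → Sat M (FormulaWithParams.formula ψ) (y ∷ u)) (sel-left w w′) (subst (Sat M (FormulaWithParams.formula ψ)) (sel-under (y ∷ []) (w ++ w′) (left _ k)) t₁)
            ∷ g y (subst (λ u → Sat M χ (y ∷ u)) (sel-right w w′) (subst (Sat M χ) (sel-under (y ∷ []) (w ++ w′) (right _ k)) t₂))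
        where
        w : Vec Domain (FormulaWithParams.arity ψ)
        w = FormulaWithParams.params ψ
        d : Definable (λ N u → Sat N (FormulaWithParams.formula ψ) (sel (under 1 (left _ k)) u) × Sat N χ (sel (under 1 (right _ k)) u))
        d = def-∩ (def-sel (by-formula (FormulaWithParams.formula ψ)) (under 1 (left _ k))) (def-sel (by-formula χ) (under 1 (right _ k)))
        append : ∀ {j} (v w : Vec Domain j) → (∀ i → Q (lookup v i) (lookup w i)) → ∀ i → Q (lookup (v ++ v′) i) (lookup (w ++ w′) i)
        append []      []      f i       = h′ i
        append (x ∷ v) (y ∷ w) f zero    = f zero
        append (x ∷ v) (y ∷ w) f (suc i) = append v w (f ∘ suc) i
        related : ∀ i → Q (lookup (v ++ v′) i) (lookup (w ++ w′) i)
        related = append v w h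

      fs : FinitelySatisfiable M p
      fs ψs all with combine′ ψs all
      ... | k , v , w , χ , h , s , g with to (correct (def-∃ (by-formula χ)) M w)
              (preserve el k v w h (formula (def-∃ (by-formula χ))) (from (correct (def-∃ (by-formula χ)) M v) (a , s)))
      ...   | y , t = y ∷ [] , g y t

      realised : Realised M p
      realised = saturated (Range Q) small p (λ ψ (v , h , _) → over′ v _ h) fs

      b : Domain
      b = Vec.head (proj₁ realised)

      b-sat : ∀ {k} (v w : Vec Domain k) → (∀ i → Q (lookup v i) (lookup w i)) → ∀ χ → Sat M χ (a ∷ v) → Sat M χ (b ∷ w)
      b-sat v w h χ s = go (proj₁ realised) (proj₂ realised (record { formula = χ ; params = w }) (v , h , s))
        where
        go : ∀ (y : Vec Domain 1) → Sat M χ (y ++ w) → Sat M χ (Vec.head y ∷ w)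
        go (y ∷ []) t = t

      shift : ∀ {k} → Fin (suc k) → Fin (suc (suc k))
      shift zero    = zero
      shift (suc i) = suc (suc i)

      -- Collects all occurrences of the new pair in a single variable, so that a formula at `v` and
      -- `w` becomes one at `a ∷ v′` and `b ∷ w′`, to which `b-sat` applies.
      separate : ∀ k (v w : Vec Domain k) → (∀ i → (Q ⊕ (a , b)) (lookup v i) (lookup w i)) →
        ∃[ j ] Σ[ v′ ∈ Vec Domain j ] Σ[ w′ ∈ Vec Domain j ] Σ[ ρ ∈ Vec (Fin (suc j)) k ]
          (∀ i → Q (lookup v′ i) (lookup w′ i)) × sel ρ (a ∷ v′) ≡ v × sel ρ (b ∷ w′) ≡ w
      separate zero [] [] h = 0 , [] , [] , [] , (λ ()) , refl , refl
      separate (suc k) (x ∷ v) (y ∷ w) h with separate k v w (h ∘ suc) | h zero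
      ... | j , v′ , w′ , ρ , h′ , v≡ , w≡ | inj₂ (refl , refl) =
        j , v′ , w′ , zero ∷ ρ , h′ , cong (a ∷_) v≡ , cong (b ∷_) w≡
      ... | j , v′ , w′ , ρ , h′ , v≡ , w≡ | inj₁ q =
          suc j , x ∷ v′ , y ∷ w′ , suc zero ∷ Vec.map shift ρ , (λ { zero → q ; (suc i) → h′ i }) ,
          cong (x ∷_) (trans (shifted ρ) v≡) , cong (y ∷_) (trans (shifted ρ) w≡)
        where
        shifted : ∀ {i j} {x y : Domain} {u : Vec Domain j} (ρ : Vec (Fin (suc j)) i) → sel (Vec.map shift ρ) (y ∷ x ∷ u) ≡ sel ρ (y ∷ u)
        shifted []            = refl
        shifted (zero ∷ ρ)    = cong (_ ∷_) (shifted ρ)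
        shifted (suc i ∷ ρ)   = cong (_ ∷_) (shifted ρ)

      extended : ∀ k (v w : Vec Domain k) → (∀ i → (Q ⊕ (a , b)) (lookup v i) (lookup w i)) → ∀ φ → Sat M φ v → Sat M φ w
      extended k v w h φ s with separate k v w h
      ... | j , v′ , w′ , ρ , h′ , v≡ , w≡ = subst (Sat M φ) w≡ (to (correct d M (b ∷ w′))
              (b-sat v′ w′ h′ (formula d) (from (correct d M (a ∷ v′)) (subst (Sat M φ) (sym v≡) s))))
        where
        d : Definable (λ N u → Sat N φ (sel ρ u))
        d = def-sel (by-formula φ) ρ

    back : ∀ {Q} → Elementary Q → IsSmall M (Range (flip Q)) → ∀ b → ∃[ a ] Elementary (Q ⊕ (a , b))
    back el small b with forth (Elementary-flip el) small b
    ... | a , el′ = a , Elementary-⊆ (λ { (inj₁ q) → inj₁ q ; (inj₂ (p , q)) → inj₂ (q , p) }) (Elementary-flip el′)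

  module Extension (R : Relation) (R-elementary : Elementary R)
    (R-range : Countable (Range R)) (R-domain : Countable (Range (flip R))) where
    private
      W : WellOrder Domain
      W = proj₁ (initialWellOrder Domain)
      open WellOrder W
      open Segments W (proj₂ (initialWellOrder Domain)) uncountable

      -- Stage α adds the pairs (α, r) and (d, α), recorded as (r, d).
      Stage : Domain → Domain × Domain → Relation
      Stage α (r , d) x y = x ≡ α × y ≡ r ⊎ x ≡ d × y ≡ α

      Before : ∀ α → (∀ {β} → β ≺ α → Domain × Domain) → Relation
      Before α g x y = R x y ⊎ (∃[ β ] Σ[ p ∈ β ≺ α ] Stage β (g p) x y)

      -- Choosing without a proof of elementarity lets `g` be defined by plain well-founded
      -- recursion; `Q≤-elementary` then shows inductively that the default pair never occurs.
      choose : Relation → Domain → Domain × Domain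
      choose Q α with em {P = Σ[ (r , d) ∈ Domain × Domain ] Elementary (Q ⊕ (α , r) ⊕ (d , α))}
      ... | yes (rd , _) = rd
      ... | no _         = α , α

      choose-elementary : ∀ Q α → (Σ[ (r , d) ∈ Domain × Domain ] Elementary (Q ⊕ (α , r) ⊕ (d , α))) →
        Elementary (Q ⊕ (α , proj₁ (choose Q α)) ⊕ (proj₂ (choose Q α) , α))
      choose-elementary Q α some with em {P = Σ[ (r , d) ∈ Domain × Domain ] Elementary (Q ⊕ (α , r) ⊕ (d , α))}
      ... | yes (_ , el) = el
      ... | no none      = ⊥-elim (none some)

      g-acc : ∀ α → Acc _≺_ α → Domain × Domain
      g-acc α (acc rs) = choose (Before α (λ {β} p → g-acc β (rs p))) α

      g-irrelevant : ∀ α p q → g-acc α p ≡ g-acc α q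
      g-irrelevant α (acc rs) (acc rs′) = cong (λ Q → choose Q α) (ext λ x → ext λ y →
        cong (λ (S : ∀ β → β ≺ α → Set ℓ) → R x y ⊎ (∃[ β ] Σ[ p ∈ β ≺ α ] S β p))
          (ext λ β → ext λ p → cong (λ rd → Stage β rd x y) (g-irrelevant β (rs p) (rs′ p))))

      g : Domain → Domain × Domain
      g α = g-acc α (≺-wf α)

      Q< : Domain → Relation
      Q< α = Before α (λ {β} _ → g β)

      g-unfold : ∀ α → g α ≡ choose (Q< α) α
      g-unfold α with ≺-wf α
      ... | acc rs = cong (λ Q → choose Q α) (ext λ x → ext λ y →
        cong (λ (S : ∀ β → β ≺ α → Set ℓ) → R x y ⊎ (∃[ β ] Σ[ p ∈ β ≺ α ] S β p))
          (ext λ β → ext λ p → cong (λ rd → Stage β rd x y) (g-irrelevant β (rs p) (≺-wf β))))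

      Q≤ : Domain → Relation
      Q≤ α x y = Q< α x y ⊎ Stage α (g α) x y

      Q≤-mono : ∀ {α β x y} → β ≺ α → Q≤ β x y → Q≤ α x y
      Q≤-mono p (inj₁ (inj₁ r))           = inj₁ (inj₁ r)
      Q≤-mono p (inj₁ (inj₂ (γ , q , s))) = inj₁ (inj₂ (γ , ≺-trans q p , s))
      Q≤-mono p (inj₂ s)                  = inj₁ (inj₂ (_ , p , s))

      Union : Pred Domain ℓ → Relation
      Union P x y = R x y ⊎ (∃[ β ] P β × Stage β (g β) x y)

      -- Finitely many pairs of the union already occur at the latest stage among them.
      union-elementary : ∀ P → (∀ β → P β → Elementary (Q≤ β)) → Elementary (Union P)
      union-elementary P el = elementary λ k v w h φ s →
          [ (λ rs → preserve R-elementary k v w rs φ s) , (λ (β , b , qs) → preserve (el β b) k v w qs φ s) ]′ (late k v w h)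
        where
        late : ∀ k (v w : Vec Domain k) → (∀ i → Union P (lookup v i) (lookup w i)) →
          (∀ i → R (lookup v i) (lookup w i)) ⊎ (∃[ β ] P β × (∀ i → Q≤ β (lookup v i) (lookup w i)))
        late zero    []      []      h = inj₁ λ ()
        late (suc k) (x ∷ v) (y ∷ w) h with h zero | late k v w (h ∘ suc)
        ... | inj₁ r            | inj₁ rs           = inj₁ λ { zero → r ; (suc i) → rs i }
        ... | inj₁ r            | inj₂ (β , b , qs) = inj₂ (β , b , λ { zero → inj₁ (inj₁ r) ; (suc i) → qs i })
        ... | inj₂ (β , b , st) | inj₁ rs           = inj₂ (β , b , λ { zero → inj₂ st ; (suc i) → inj₁ (inj₁ (rs i)) })
        ... | inj₂ (β , b , st) | inj₂ (γ , c , qs) with ≺-cmp β γ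
        ...   | inj₁ β≺γ         = inj₂ (γ , c , λ { zero → inj₁ (inj₂ (β , β≺γ , st)) ; (suc i) → qs i })
        ...   | inj₂ (inj₁ refl) = inj₂ (β , b , λ { zero → inj₂ st ; (suc i) → qs i })
        ...   | inj₂ (inj₂ γ≺β)  = inj₂ (β , b , λ { zero → inj₂ st ; (suc i) → Q≤-mono γ≺β (qs i) })

      Bounded : Domain → Pred Domain ℓ → Set ℓ
      Bounded α A = Σ[ κ ∈ (∀ x → A x → Domain × ℕ) ] (∀ x p → ¬ (α ≺ proj₁ (κ x p))) ×
        (∀ {x y} (p : A x) (q : A y) → κ x p ≡ κ y q → x ≡ y)

      Bounded⇒IsSmall : ∀ {α A} → Bounded α A → IsSmall M A
      Bounded⇒IsSmall {α} (κ , κ≼α , κ-inj) (f , f-inj , f∈A) = closedSegment-small α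
        ((λ x → κ (f x) (f∈A x)) , (λ eq → f-inj (κ-inj (f∈A _) (f∈A _) eq)) , λ x → κ≼α (f x) (f∈A x))

      -- Such a set consists of countably many points and two for each `β` up to `α`; the tags 0, 1,
      -- 2 code it injectively into the closed segment times ℕ, and `closedSegment-small` applies.
      bounded : ∀ (A : Pred Domain ℓ) (f : Domain → Domain) → Countable A → ∀ α →
        Bounded α (λ x → A x ⊎ (∃[ β ] ¬ (α ≺ β) × (x ≡ β ⊎ x ≡ f β)))
      bounded A f (κ , κ-inj) α = key , key≼α , inj
        where
        B : Pred Domain ℓ
        B x = A x ⊎ (∃[ β ] ¬ (α ≺ β) × (x ≡ β ⊎ x ≡ f β))
        key : ∀ x → B x → Domain × ℕ
        key x (inj₁ r)                = α , code 0 (κ x r)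
        key x (inj₂ (β , _ , inj₁ _)) = β , code 1 0
        key x (inj₂ (β , _ , inj₂ _)) = β , code 2 0
        key≼α : ∀ x p → ¬ (α ≺ proj₁ (key x p))
        key≼α x (inj₁ r)                = ≺-irrefl
        key≼α x (inj₂ (β , n , inj₁ _)) = n
        key≼α x (inj₂ (β , n , inj₂ _)) = n
        inj : ∀ {x y} (p : B x) (q : B y) → key x p ≡ key y q → x ≡ y
        inj (inj₁ r) (inj₁ s) eq = κ-inj r s (proj₂ (code-injective {0} {_} {0} (cong proj₂ eq)))
        inj (inj₂ (β , _ , inj₁ refl)) (inj₂ (γ , _ , inj₁ refl)) eq = cong proj₁ eq
        inj (inj₂ (β , _ , inj₂ refl)) (inj₂ (γ , _ , inj₂ refl)) eq = cong (f ∘ proj₁) eq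
        inj (inj₁ _) (inj₂ (_ , _ , inj₁ _)) eq = case proj₁ (code-injective (cong proj₂ eq)) of λ ()
        inj (inj₁ _) (inj₂ (_ , _ , inj₂ _)) eq = case proj₁ (code-injective (cong proj₂ eq)) of λ ()
        inj (inj₂ (_ , _ , inj₁ _)) (inj₁ _) eq = case proj₁ (code-injective (cong proj₂ eq)) of λ ()
        inj (inj₂ (_ , _ , inj₂ _)) (inj₁ _) eq = case proj₁ (code-injective (cong proj₂ eq)) of λ ()
        inj (inj₂ (_ , _ , inj₁ _)) (inj₂ (_ , _ , inj₂ _)) eq = case proj₁ (code-injective (cong proj₂ eq)) of λ ()
        inj (inj₂ (_ , _ , inj₂ _)) (inj₂ (_ , _ , inj₁ _)) eq = case proj₁ (code-injective (cong proj₂ eq)) of λ ()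

      small-⊆ : ∀ {A B : Pred Domain ℓ} → (∀ x → A x → B x) → IsSmall M B → IsSmall M A
      small-⊆ sub small (f , f-inj , f∈A) = small (f , f-inj , λ x → sub _ (f∈A x))

      Q≤-elementary : ∀ α → Acc _≺_ α → Elementary (Q≤ α)
      Q≤-elementary α (acc rs) = Elementary-⊆
          (λ { (inj₁ q) → inj₁ (inj₁ q) ; (inj₂ (inj₁ (p , q))) → inj₁ (inj₂ (p , trans q (cong proj₁ (g-unfold α))))
             ; (inj₂ (inj₂ (p , q))) → inj₂ (trans p (cong proj₂ (g-unfold α)) , q) })
          (choose-elementary (Q< α) α ((r , proj₁ backward) , proj₂ backward))
        where
        before : Elementary (Q< α)
        before = Elementary-⊆ (λ { (inj₁ r) → inj₁ r ; (inj₂ (β , p , s)) → inj₂ (β , lift p , s) })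
          (union-elementary (λ β → Lift ℓ (β ≺ α)) (λ β p → Q≤-elementary β (rs (lower p))))
        ran : ∀ y → Range (Q< α) y → Range R y ⊎ (∃[ β ] ¬ (α ≺ β) × (y ≡ β ⊎ y ≡ proj₁ (g β)))
        ran y (x , inj₁ r)                             = inj₁ (x , r)
        ran y (x , inj₂ (β , p , inj₁ (_ , q)))        = inj₂ (β , ≺-asym p , inj₂ q)
        ran y (x , inj₂ (β , p , inj₂ (_ , q)))        = inj₂ (β , ≺-asym p , inj₁ q)
        forward : ∃[ r ] Elementary (Q< α ⊕ (α , r))
        forward = forth before (small-⊆ ran (Bounded⇒IsSmall (bounded (Range R) (proj₁ ∘ g) R-range α))) α
        r : Domain
        r = proj₁ forward
        dom : ∀ x → Range (flip (Q< α ⊕ (α , r))) x → Range (flip R) x ⊎ (∃[ β ] ¬ (α ≺ β) × (x ≡ β ⊎ x ≡ proj₂ (g β)))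
        dom x (y , inj₁ (inj₁ r))                      = inj₁ (y , r)
        dom x (y , inj₁ (inj₂ (β , p , inj₁ (q , _)))) = inj₂ (β , ≺-asym p , inj₁ q)
        dom x (y , inj₁ (inj₂ (β , p , inj₂ (q , _)))) = inj₂ (β , ≺-asym p , inj₂ q)
        -- After the forward step `α` itself is in the domain, which is why closed segments are
        -- counted.
        dom x (y , inj₂ (q , _))                       = inj₂ (α , ≺-irrefl , inj₁ q)
        backward : ∃[ d ] Elementary (Q< α ⊕ (α , r) ⊕ (d , α))
        backward = back (proj₂ forward) (small-⊆ dom (Bounded⇒IsSmall (bounded (Range (flip R)) (proj₂ ∘ g) R-domain α))) α

      Q∞ : Relation
      Q∞ = Union (λ _ → Lift ℓ ⊤)

      Q∞-elementary : Elementary Q∞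
      Q∞-elementary = union-elementary _ λ β _ → Q≤-elementary β (≺-wf β)

      functional : ∀ {Q : Relation} → Elementary Q → ∀ {x y y′} → Q x y → Q x y′ → y ≡ y′
      functional el {x} {y} {y′} q q′ = preserve el 2 (x ∷ x ∷ []) (y ∷ y′ ∷ []) (λ { zero → q ; (suc zero) → q′ })
        (var zero ≈′ var (suc zero)) refl

      f h : Domain → Domain
      f = proj₁ ∘ g
      h = proj₂ ∘ g

      f-graph : ∀ α → Q∞ α (f α)
      f-graph α = inj₂ (α , _ , inj₁ (refl , refl))

      h-graph : ∀ α → Q∞ (h α) α
      h-graph α = inj₂ (α , _ , inj₂ (refl , refl))

      map-graph : ∀ {k} (v : Vec Domain k) i → Q∞ (lookup v i) (lookup (Vec.map f v) i)
      map-graph v i = subst (Q∞ (lookup v i)) (sym (Vec.lookup-map i f v)) (f-graph (lookup v i))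

      vars : ∀ {n k} → (Fin k → Fin n) → Vec (Term L n) k
      vars ρ = Vec.tabulate (var ∘ ρ)

      evals-vars : ∀ {n k} (ρ : Fin k → Fin n) (v : Vec Domain n) (w : Vec Domain k) →
        (∀ i → lookup v (ρ i) ≡ lookup w i) → evals M v (vars ρ) ≡ w
      evals-vars ρ v []      eq = refl
      evals-vars ρ v (x ∷ w) eq = cong₂ _∷_ (eq zero) (evals-vars (ρ ∘ suc) v w (eq ∘ suc))

    automorphism : Automorphism M
    automorphism = record
      { bijection     = mk↔ₛ′ f h (λ y → functional Q∞-elementary (f-graph (h y)) (h-graph y))
                                  (λ x → functional (Elementary-flip Q∞-elementary) (h-graph (f x)) (f-graph x))
      ; preserves-fun = λ {k} F xs →
          let t = var zero ≈′ fun F (vars suc)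
              e : ∀ x (xs : Vec Domain k) → evals M (x ∷ xs) (vars suc) ≡ xs
              e x xs = evals-vars suc (x ∷ xs) xs λ _ → refl
          in trans (preserve Q∞-elementary (suc k) (⟦fun⟧ F xs ∷ xs) (Vec.map f (⟦fun⟧ F xs ∷ xs)) (map-graph (⟦fun⟧ F xs ∷ xs)) t
                     (cong (⟦fun⟧ F) (sym (e _ xs))))
                   (cong (⟦fun⟧ F) (e _ (Vec.map f xs)))
      ; preserves-rel = λ {k} P xs →
          let e : ∀ (xs : Vec Domain k) → evals M xs (vars id) ≡ xs
              e xs = evals-vars id xs xs λ _ → refl
          in mk⇔ (λ s → subst (⟦rel⟧ P) (e (Vec.map f xs)) (preserve Q∞-elementary k xs (Vec.map f xs) (map-graph xs) (rel P (vars id)) (subst (⟦rel⟧ P) (sym (e xs)) s)))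
                 (λ s → subst (⟦rel⟧ P) (e xs) (preserve (Elementary-flip Q∞-elementary) k (Vec.map f xs) xs (map-graph xs) (rel P (vars id)) (subst (⟦rel⟧ P) (sym (e (Vec.map f xs))) s)))
      }

    extends-R : ∀ {x y} → R x y → Automorphism.to automorphism x ≡ y
    extends-R {x} r = functional Q∞-elementary (f-graph x) (inj₁ r)

-- Arithmetic of the ordered field

module Reals (em : ∀ {a} → ExcludedMiddle a) (𝓡 : RealNumbers) where
  open Classical em
  open RealNumbers 𝓡 public

  ring : CommutativeRing 0ℓ 0ℓ
  ring = record { isCommutativeRing = isCommutativeRing }

  open CommutativeRing ring public
    using (+-assoc; +-comm; +-identityˡ; +-identityʳ; *-assoc; *-comm; *-identityˡ; *-identityʳ; distribˡ; distribʳ; zeroˡ; zeroʳ; -‿inverseʳ; -‿inverseˡ)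
  open IsTotalOrder isTotalOrder public
    using () renaming (refl to ≤-refl; reflexive to ≤-reflexive; trans to ≤-trans; antisym to ≤-antisym; total to ≤-total)
  private
    module Ring = Algebra.Properties.Ring (CommutativeRing.ring ring)
    module Group = Algebra.Properties.AbelianGroup (CommutativeRing.+-abelianGroup ring)

  fromℕ-+ : ∀ m n → fromℕ (m ℕ.+ n) ≡ fromℕ m + fromℕ n
  fromℕ-+ zero    n = sym (+-identityˡ _)
  fromℕ-+ (suc m) n = trans (cong (1# +_) (fromℕ-+ m n)) (sym (+-assoc _ _ _))

  fromℕ-* : ∀ m n → fromℕ (m ℕ.* n) ≡ fromℕ m * fromℕ n
  fromℕ-* zero    n = sym (zeroˡ _)
  fromℕ-* (suc m) n = trans (fromℕ-+ n (m ℕ.* n)) (trans (cong₂ _+_ (sym (*-identityˡ _)) (fromℕ-* m n)) (sym (distribʳ _ _ _)))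

  module IntegerCoefficients where
    ⟦_⟧ℤ : ℤ → ℝ
    ⟦ ℤ.+ n ⟧ℤ      = fromℕ n
    ⟦ ℤ.-[1+ n ] ⟧ℤ = - fromℕ (suc n)

    neg-homo : ∀ i → ⟦ ℤ.- i ⟧ℤ ≡ - ⟦ i ⟧ℤ
    neg-homo (ℤ.+ zero)    = sym Ring.-0#≈0#
    neg-homo (ℤ.+ suc n)   = refl
    neg-homo ℤ.-[1+ n ]    = sym (Ring.-‿involutive _)

    ⊖-homo : ∀ m n → ⟦ m ℤ.⊖ n ⟧ℤ ≡ fromℕ m - fromℕ n
    ⊖-homo m       zero    = sym (trans (cong (fromℕ m +_) Ring.-0#≈0#) (+-identityʳ _))
    ⊖-homo zero    (suc n) = sym (+-identityˡ _)
    ⊖-homo (suc m) (suc n) = trans (cong ⟦_⟧ℤ (ℤ.[1+m]⊖[1+n]≡m⊖n m n)) (trans (⊖-homo m n) (sym cancel))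
      where
      cancel : (1# + fromℕ m) - (1# + fromℕ n) ≡ fromℕ m - fromℕ n
      cancel = trans (cong₂ _+_ (+-comm 1# (fromℕ m)) (sym (Group.⁻¹-∙-comm 1# (fromℕ n))))
        (trans (+-assoc _ _ _) (cong (fromℕ m +_) (trans (sym (+-assoc _ _ _))
          (trans (cong (_+ (- fromℕ n)) (-‿inverseʳ 1#)) (+-identityˡ _)))))

    +-homo : ∀ i j → ⟦ i ℤ.+ j ⟧ℤ ≡ ⟦ i ⟧ℤ + ⟦ j ⟧ℤ
    +-homo (ℤ.+ m)    (ℤ.+ n)    = fromℕ-+ m n
    +-homo (ℤ.+ m)    ℤ.-[1+ n ] = ⊖-homo m (suc n)
    +-homo ℤ.-[1+ m ] (ℤ.+ n)    = trans (⊖-homo n (suc m)) (+-comm _ _)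
    +-homo ℤ.-[1+ m ] ℤ.-[1+ n ] = trans (cong -_ (trans (cong (λ k → 1# + fromℕ k) (sym (ℕ.+-suc m n))) (fromℕ-+ (suc m) (suc n))))
      (sym (Group.⁻¹-∙-comm _ _))

    neg-◃ : ∀ n → ⟦ Sign.- ℤ.◃ n ⟧ℤ ≡ - fromℕ n
    neg-◃ zero    = sym Ring.-0#≈0#
    neg-◃ (suc n) = refl

    *-homo : ∀ i j → ⟦ i ℤ.* j ⟧ℤ ≡ ⟦ i ⟧ℤ * ⟦ j ⟧ℤ
    *-homo (ℤ.+ m)    (ℤ.+ n)    = trans (cong ⟦_⟧ℤ (ℤ.+◃n≡+n (m ℕ.* n))) (fromℕ-* m n)
    *-homo (ℤ.+ m)    ℤ.-[1+ n ] = trans (neg-◃ (m ℕ.* suc n)) (trans (cong -_ (fromℕ-* m (suc n))) (Ring.-‿distribʳ-* _ _))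
    *-homo ℤ.-[1+ m ] (ℤ.+ n)    = trans (neg-◃ (suc m ℕ.* n)) (trans (cong -_ (fromℕ-* (suc m) n)) (Ring.-‿distribˡ-* _ _))
    *-homo ℤ.-[1+ m ] ℤ.-[1+ n ] = trans (fromℕ-* (suc m) (suc n))
      (trans (sym (Ring.-‿involutive _)) (trans (cong -_ (Ring.-‿distribˡ-* _ _)) (Ring.-‿distribʳ-* _ _)))

    ℝ-almost : AlmostCommutativeRing 0ℓ 0ℓ
    ℝ-almost = fromCommutativeRing ring

    morphism : ℤ.+-*-rawRing -Raw-AlmostCommutative⟶ ℝ-almost
    morphism = record { ⟦_⟧ = ⟦_⟧ℤ ; +-homo = +-homo ; *-homo = *-homo ; -‿homo = neg-homo ; 0-homo = refl ; 1-homo = +-identityʳ 1# }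

    _≟ℤ_ : ∀ i j → Maybe (⟦ i ⟧ℤ ≡ ⟦ j ⟧ℤ)
    i ≟ℤ j with i ℤ.≟ j
    ... | yes eq = just (cong ⟦_⟧ℤ eq)
    ... | no _   = nothing

  module Solver = Algebra.Solver.Ring ℤ.+-*-rawRing IntegerCoefficients.ℝ-almost
    IntegerCoefficients.morphism IntegerCoefficients._≟ℤ_
  open Solver using (solve; _:=_; _:+_; _:*_; :-_; _:-_; con) public

  ≤-by : ∀ {x y} c → 0# ≤ c → x + c ≡ y → x ≤ y
  ≤-by {x} c 0≤c refl = subst₂ _≤_ (+-identityˡ x) (+-comm c x) (+-monoˡ-≤ x 0≤c)

  0≤- : ∀ {x y} → x ≤ y → 0# ≤ y - x
  0≤- {x} x≤y = subst (_≤ _) (-‿inverseʳ x) (+-monoˡ-≤ (- x) x≤y)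

  +-mono-≤ : ∀ {x y u v} → x ≤ y → u ≤ v → x + u ≤ y + v
  +-mono-≤ {x} {y} {u} {v} p q = ≤-trans (+-monoˡ-≤ u p) (subst₂ _≤_ (+-comm u y) (+-comm v y) (+-monoˡ-≤ y q))

  +-monoʳ-≤ : ∀ z {x y} → x ≤ y → z + x ≤ z + y
  +-monoʳ-≤ z = +-mono-≤ ≤-refl

  neg-mono : ∀ {x y} → x ≤ y → - y ≤ - x
  neg-mono {x} {y} p = ≤-by (y - x) (0≤- p) (solve 2 (λ x y → (:- y) :+ (y :- x) := :- x) refl x y)

  *-monoˡ-≤ : ∀ {z x y} → 0# ≤ z → x ≤ y → z * x ≤ z * y
  *-monoˡ-≤ {z} {x} {y} 0≤z p = ≤-by (z * (y - x)) (*-nonNeg 0≤z (0≤- p)) (solve 3 (λ x y z → z :* x :+ z :* (y :- x) := z :* y) refl x y z)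

  *-mono-≤ : ∀ {x y u v} → 0# ≤ x → 0# ≤ v → x ≤ y → u ≤ v → x * u ≤ y * v
  *-mono-≤ {x} {y} {u} {v} 0≤x 0≤v p q = ≤-trans (*-monoˡ-≤ 0≤x q) (subst₂ _≤_ (*-comm v x) (*-comm v y) (*-monoˡ-≤ 0≤v p))

  ≤-+-nonNeg : ∀ {x y} → 0# ≤ y → x ≤ x + y
  ≤-+-nonNeg {x} {y} p = ≤-by y p refl

  +-nonNeg : ∀ {x y} → 0# ≤ x → 0# ≤ y → 0# ≤ x + y
  +-nonNeg {x} p q = ≤-trans p (≤-+-nonNeg q)

  ≰⇒≥ : ∀ {x y} → ¬ (x ≤ y) → y ≤ x
  ≰⇒≥ {x} {y} ¬p = [ (λ p → ⊥-elim (¬p p)) , id ]′ (≤-total x y)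

  ≰⇒> : ∀ {x y} → ¬ (x ≤ y) → y < x
  ≰⇒> ¬p = ≰⇒≥ ¬p , λ eq → ¬p (≤-reflexive (sym eq))

  <⇒≤ : ∀ {x y} → x < y → x ≤ y
  <⇒≤ = proj₁

  <⇒≱ : ∀ {x y} → x < y → ¬ (y ≤ x)
  <⇒≱ (p , ne) q = ne (≤-antisym p q)

  <-≤-trans : ∀ {x y z} → x < y → y ≤ z → x < z
  <-≤-trans p@(x≤y , _) y≤z = ≤-trans x≤y y≤z , λ { refl → <⇒≱ p y≤z }

  ≤-<-trans : ∀ {x y z} → x ≤ y → y < z → x < z
  ≤-<-trans x≤y p@(y≤z , _) = ≤-trans x≤y y≤z , λ { refl → <⇒≱ p x≤y }

  +-cancelʳ-≤ : ∀ z {x y} → x + z ≤ y + z → x ≤ y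
  +-cancelʳ-≤ z {x} {y} p = subst₂ _≤_ (cancel x) (cancel y) (+-monoˡ-≤ (- z) p)
    where
    cancel : ∀ x → x + z + (- z) ≡ x
    cancel x = solve 2 (λ x z → x :+ z :+ (:- z) := x) refl x z

  +-monoˡ-< : ∀ z {x y} → x < y → x + z < y + z
  +-monoˡ-< z p = +-monoˡ-≤ z (<⇒≤ p) , λ eq → <⇒≱ p (+-cancelʳ-≤ z (≤-reflexive (sym eq)))

  0≤1 : 0# ≤ 1#
  0≤1 with ≤-total 0# 1#
  ... | inj₁ p = p
  ... | inj₂ p = subst (0# ≤_) (trans (solve 1 (λ o → (:- o) :* (:- o) := o :* o) refl 1#) (*-identityʳ 1#)) (*-nonNeg 0≤-1 0≤-1)
    where
    0≤-1 : 0# ≤ - 1#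
    0≤-1 = subst (_≤ - 1#) Ring.-0#≈0# (neg-mono p)

  0<1 : 0# < 1#
  0<1 = 0≤1 , λ eq → 1≢0 (sym eq)

  *-cancel-0 : ∀ {x y} → x ≢ 0# → x * y ≡ 0# → y ≡ 0#
  *-cancel-0 {x} {y} x≢0 eq = trans (sym (*-identityˡ y)) (trans (cong (_* y) (trans (sym (*-inverseʳ x x≢0)) (*-comm x (x ⁻¹))))
    (trans (*-assoc _ _ _) (trans (cong (x ⁻¹ *_) eq) (zeroʳ _))))

  *-pos : ∀ {x y} → 0# < x → 0# < y → 0# < x * y
  *-pos (p , p′) (q , q′) = *-nonNeg p q , λ eq → q′ (sym (*-cancel-0 (λ e → p′ (sym e)) (sym eq)))

  ≢0 : ∀ {x} → 0# < x → x ≢ 0#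
  ≢0 (_ , ne) eq = ne (sym eq)

  *-inverse : ∀ {x} → 0# < x → x * x ⁻¹ ≡ 1#
  *-inverse p = *-inverseʳ _ (≢0 p)

  ⁻¹-pos : ∀ {x} → 0# < x → 0# < x ⁻¹
  ⁻¹-pos {x} p = ≰⇒> λ q → <⇒≱ 0<1 (subst₂ _≤_ (*-inverse p) (zeroʳ x) (*-monoˡ-≤ (<⇒≤ p) q))

  *-cancelˡ-≤ : ∀ {z x y} → 0# < z → z * x ≤ z * y → x ≤ y
  *-cancelˡ-≤ {z} {x} {y} p q = subst₂ _≤_ (cancel x) (cancel y) (*-monoˡ-≤ (<⇒≤ (⁻¹-pos p)) q)
    where
    cancel : ∀ x → z ⁻¹ * (z * x) ≡ x
    cancel x = trans (sym (*-assoc _ _ _)) (trans (cong (_* x) (trans (*-comm _ _) (*-inverse p))) (*-identityˡ x))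

  +-pos-nonNeg : ∀ {x y} → 0# < x → 0# ≤ y → 0# < x + y
  +-pos-nonNeg p q = <-≤-trans p (≤-+-nonNeg q)

  fromℕ-nonNeg : ∀ n → 0# ≤ fromℕ n
  fromℕ-nonNeg zero    = ≤-refl
  fromℕ-nonNeg (suc n) = +-nonNeg 0≤1 (fromℕ-nonNeg n)

  fromℕ-pos : ∀ n → 0# < fromℕ (suc n)
  fromℕ-pos n = +-pos-nonNeg 0<1 (fromℕ-nonNeg n)

  fromℕ-mono : ∀ {m n} → m ℕ.≤ n → fromℕ m ≤ fromℕ n
  fromℕ-mono {n = n} z≤n = fromℕ-nonNeg n
  fromℕ-mono (s≤s p)     = +-monoʳ-≤ 1# (fromℕ-mono p)

  2# ½ : ℝ
  2# = 1# + 1#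
  ½  = 2# ⁻¹

  0<2 : 0# < 2#
  0<2 = +-pos-nonNeg 0<1 0≤1

  0<½ : 0# < ½
  0<½ = ⁻¹-pos 0<2

  ½+½ : ½ + ½ ≡ 1#
  ½+½ = trans (cong₂ _+_ (sym (*-identityˡ ½)) (sym (*-identityˡ ½))) (trans (sym (distribʳ ½ 1# 1#)) (*-inverse 0<2))

  half : ∀ x → ½ * x + ½ * x ≡ x
  half x = trans (sym (distribʳ x ½ ½)) (trans (cong (_* x) ½+½) (*-identityˡ x))

  half-pos : ∀ {x} → 0# < x → 0# < ½ * x
  half-pos = *-pos 0<½

  0<- : ∀ {x y} → x < y → 0# < y - x
  0<- {x} {y} p = 0≤- (<⇒≤ p) , λ eq → proj₂ p (trans (sym (+-identityˡ x)) (trans (cong (_+ x) eq) (solve 2 (λ x y → y :- x :+ x := y) refl x y)))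

  ≤-limit : ∀ {x y} → (∀ ε → 0# < ε → x ≤ y + ε) → x ≤ y
  ≤-limit {x} {y} h = dne λ ¬p → let gap = 0<- (≰⇒> ¬p) in
    <⇒≱ (half-pos gap) (+-cancelʳ-≤ (½ * (x - y) + y) (subst₂ _≤_
      (trans (solve 2 (λ x y → x := (x :- y) :+ y) refl x y) (trans (cong (_+ y) (sym (half (x - y)))) (+-assoc _ _ _)))
      (trans (+-comm _ _) (sym (+-identityˡ _))) (h _ (half-pos gap))))

  abstract
    -- Completeness is stated for predicates of level zero; the truth value of `S r` brings a
    -- predicate of any level down to it.
    supremum : ∀ {a} (S : Pred ℝ a) → ∃ S → ∃ (IsUpperBound S) → ∃ (IsSupremum S)
    supremum S (x , x∈S) (b , b-ub) with complete (λ r → ⌊ S r ⌋ ≡ true) (x , holds x∈S) (b , λ y p → b-ub y (truth p))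
    ... | s , ub , least = s , (λ y y∈S → ub y (holds y∈S)) , λ c c-ub → least c λ y p → c-ub y (truth p)

    archimedean : ∀ x → ∃[ n ] x < fromℕ n
    archimedean x = dne λ none → let
        bounded : ∀ y → (∃[ n ] y ≡ fromℕ n) → y ≤ x
        bounded = λ { _ (n , refl) → ≰⇒≥ λ p → none (suc n , ≤-<-trans p (subst (_< fromℕ (suc n)) (+-identityˡ _) (+-monoˡ-< (fromℕ n) 0<1))) }
        (s , ub , least) = supremum (λ y → ∃[ n ] y ≡ fromℕ n) (0# , 0 , refl) (x , bounded)
      in <⇒≱ 0<1 (+-cancelʳ-≤ s (subst (1# + s ≤_) (sym (+-identityˡ s))
           (subst (_≤ s) (+-comm s 1#) (shift s (least (s - 1#) λ { _ (n , refl) → unshift {n} (ub (fromℕ (suc n)) (suc n , refl)) })))))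
      where
      shift : ∀ s → s ≤ s - 1# → s + 1# ≤ s
      shift s p = subst (s + 1# ≤_) (solve 2 (λ s o → s :- o :+ o := s) refl s 1#) (+-monoˡ-≤ 1# p)
      unshift : ∀ {n s} → 1# + fromℕ n ≤ s → fromℕ n ≤ s - 1#
      unshift {n} p = subst (_≤ _) (solve 2 (λ n o → o :+ n :- o := n) refl (fromℕ n) 1#) (+-monoˡ-≤ (- 1#) p)

-- Finite sums, powers and logarithms

module Analysis (em : ∀ {a} → ExcludedMiddle a) (𝓡 : RealNumbers) where
  open Classical em
  open Reals em 𝓡

  ∑<-cong : ∀ n {f g : ℕ → ℝ} → (∀ i → i ℕ.< n → f i ≡ g i) → ∑< n f ≡ ∑< n g
  ∑<-cong zero    h = refl
  ∑<-cong (suc n) h = cong₂ _+_ (∑<-cong n λ i p → h i (ℕ.m<n⇒m<1+n p)) (h n ℕ.≤-refl)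

  ∑<-+ : ∀ n (f g : ℕ → ℝ) → ∑< n (λ i → f i + g i) ≡ ∑< n f + ∑< n g
  ∑<-+ zero    f g = sym (+-identityˡ 0#)
  ∑<-+ (suc n) f g = trans (cong (_+ (f n + g n)) (∑<-+ n f g))
    (solve 4 (λ a b c d → a :+ b :+ (c :+ d) := a :+ c :+ (b :+ d)) refl (∑< n f) (∑< n g) (f n) (g n))

  ∑<-nonNeg : ∀ n {f : ℕ → ℝ} → (∀ i → 0# ≤ f i) → 0# ≤ ∑< n f
  ∑<-nonNeg zero    h = ≤-refl
  ∑<-nonNeg (suc n) h = +-nonNeg (∑<-nonNeg n h) (h n)

  ∑<-mono : ∀ n {f g : ℕ → ℝ} → (∀ i → f i ≤ g i) → ∑< n f ≤ ∑< n g
  ∑<-mono zero    h = ≤-refl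
  ∑<-mono (suc n) h = +-mono-≤ (∑<-mono n h) (h n)

  ∑<-const : ∀ n x → ∑< n (λ _ → x) ≡ fromℕ n * x
  ∑<-const zero    x = sym (zeroˡ x)
  ∑<-const (suc n) x = trans (cong (_+ x) (∑<-const n x)) (trans (+-comm _ _)
    (trans (cong (_+ fromℕ n * x) (sym (*-identityˡ x))) (sym (distribʳ x 1# (fromℕ n)))))

  ∑<-split : ∀ m n (f : ℕ → ℝ) → ∑< (m ℕ.+ n) f ≡ ∑< m f + ∑< n (λ i → f (m ℕ.+ i))
  ∑<-split m zero    f rewrite ℕ.+-identityʳ m = sym (+-identityʳ _)
  ∑<-split m (suc n) f rewrite ℕ.+-suc m n = trans (cong (_+ f (m ℕ.+ n)) (∑<-split m n f)) (+-assoc _ _ _)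

  ∑Fin-cong : ∀ {n} {f g : Fin n → ℝ} → (∀ i → f i ≡ g i) → ∑Fin f ≡ ∑Fin g
  ∑Fin-cong {zero}  h = refl
  ∑Fin-cong {suc n} h = cong₂ _+_ (h zero) (∑Fin-cong (h ∘ suc))

  ∑Fin-mono : ∀ {n} {f g : Fin n → ℝ} → (∀ i → f i ≤ g i) → ∑Fin f ≤ ∑Fin g
  ∑Fin-mono {zero}  h = ≤-refl
  ∑Fin-mono {suc n} h = +-mono-≤ (h zero) (∑Fin-mono (h ∘ suc))

  ∑Fin-+ : ∀ {n} (f g : Fin n → ℝ) → ∑Fin (λ i → f i + g i) ≡ ∑Fin f + ∑Fin g
  ∑Fin-+ {zero}  f g = sym (+-identityˡ 0#)
  ∑Fin-+ {suc n} f g = trans (cong (f zero + g zero +_) (∑Fin-+ (f ∘ suc) (g ∘ suc)))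
    (solve 4 (λ a b c d → a :+ b :+ (c :+ d) := a :+ c :+ (b :+ d)) refl (f zero) (g zero) _ _)

  ∑Fin-0 : ∀ n → ∑Fin {n} (λ _ → 0#) ≡ 0#
  ∑Fin-0 zero    = refl
  ∑Fin-0 (suc n) = trans (+-identityˡ _) (∑Fin-0 n)

  ∑Fin-* : ∀ {n} x (f : Fin n → ℝ) → ∑Fin (λ i → x * f i) ≡ x * ∑Fin f
  ∑Fin-* {zero}  x f = sym (zeroʳ x)
  ∑Fin-* {suc n} x f = trans (cong (x * f zero +_) (∑Fin-* x (f ∘ suc))) (sym (distribˡ x _ _))

  ∑Fin-const : ∀ n x → ∑Fin {n} (λ _ → x) ≡ fromℕ n * x
  ∑Fin-const zero    x = sym (zeroˡ x)
  ∑Fin-const (suc n) x = trans (cong₂ _+_ (sym (*-identityˡ x)) (∑Fin-const n x)) (sym (distribʳ x 1# (fromℕ n)))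

  ∑Fin-neg : ∀ {n} (f : Fin n → ℝ) → - ∑Fin f ≡ ∑Fin (λ i → - f i)
  ∑Fin-neg {zero}  f = solve 0 (:- con (ℤ.+ 0) := con (ℤ.+ 0)) refl
  ∑Fin-neg {suc n} f = trans (solve 2 (λ a b → :- (a :+ b) := (:- a) :+ (:- b)) refl (f zero) (∑Fin (f ∘ suc))) (cong (- f zero +_) (∑Fin-neg (f ∘ suc)))

  ∑Fin-nonNeg : ∀ {n} {f : Fin n → ℝ} → (∀ i → 0# ≤ f i) → 0# ≤ ∑Fin f
  ∑Fin-nonNeg {zero}  h = ≤-refl
  ∑Fin-nonNeg {suc n} h = +-nonNeg (h zero) (∑Fin-nonNeg (h ∘ suc))

  ∑Fin-term : ∀ {n} {f : Fin n → ℝ} → (∀ i → 0# ≤ f i) → ∀ i → f i ≤ ∑Fin f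
  ∑Fin-term h zero    = ≤-+-nonNeg (∑Fin-nonNeg (h ∘ suc))
  ∑Fin-term {f = f} h (suc i) = ≤-trans (∑Fin-term (h ∘ suc) i) (≤-by (f zero) (h zero) (+-comm _ _))

  ∑Fin-∑< : ∀ m n (f : Fin m → ℕ → ℝ) → ∑Fin (λ i → ∑< n (f i)) ≡ ∑< n (λ j → ∑Fin (λ i → f i j))
  ∑Fin-∑< m zero    f = ∑Fin-0 m
  ∑Fin-∑< m (suc n) f = trans (∑Fin-+ (λ i → ∑< n (f i)) (λ i → f i n)) (cong (_+ ∑Fin (λ i → f i n)) (∑Fin-∑< m n f))

  ∑Fin-swap : ∀ m n (f : Fin m → Fin n → ℝ) → ∑Fin (λ i → ∑Fin (f i)) ≡ ∑Fin (λ j → ∑Fin (λ i → f i j))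
  ∑Fin-swap zero    n f = sym (∑Fin-0 n)
  ∑Fin-swap (suc m) n f = trans (cong (∑Fin (f zero) +_) (∑Fin-swap m n (f ∘ suc))) (sym (∑Fin-+ (f zero) (λ j → ∑Fin (λ i → f (suc i) j))))

  ∑Fin-split : ∀ a b (f : Fin (a ℕ.+ b) → ℝ) → ∑Fin f ≡ ∑Fin (λ i → f (i Fin.↑ˡ b)) + ∑Fin (λ j → f (a Fin.↑ʳ j))
  ∑Fin-split zero    b f = sym (+-identityˡ _)
  ∑Fin-split (suc a) b f = trans (cong (f zero +_) (∑Fin-split a b (f ∘ suc))) (sym (+-assoc _ _ _))

  ∑Fin-combine : ∀ m n (f : Fin (m ℕ.* n) → ℝ) → ∑Fin f ≡ ∑Fin (λ i → ∑Fin (λ j → f (combine {m} {n} i j)))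
  ∑Fin-combine zero    n f = refl
  ∑Fin-combine (suc m) n f = trans (∑Fin-split n (m ℕ.* n) f) (cong (∑Fin (λ j → f (j Fin.↑ˡ m ℕ.* n)) +_) (∑Fin-combine m n (λ c → f (n Fin.↑ʳ c))))

  ∑Fin-remQuot : ∀ m n (F : Fin m × Fin n → ℝ) → ∑Fin (λ c → F (remQuot {m} n c)) ≡ ∑Fin (λ i → ∑Fin (λ j → F (i , j)))
  ∑Fin-remQuot m n F = trans (∑Fin-combine m n _) (∑Fin-cong λ i → ∑Fin-cong λ j → cong F (Fin.remQuot-combine i j))

  infixr 9 _^_
  _^_ : ℝ → ℕ → ℝ
  x ^ zero  = 1#
  x ^ suc n = x * x ^ n

  ^-pos : ∀ {x} → 0# < x → ∀ n → 0# < x ^ n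
  ^-pos p zero    = 0<1
  ^-pos p (suc n) = *-pos p (^-pos p n)

  ^-fromℕ : ∀ m n → fromℕ (m ℕ.^ n) ≡ fromℕ m ^ n
  ^-fromℕ m zero    = +-identityʳ 1#
  ^-fromℕ m (suc n) = trans (fromℕ-* m (m ℕ.^ n)) (cong (fromℕ m *_) (^-fromℕ m n))

  convergesTo-≤ : ∀ {s : ℕ → ℝ} {l b} N → ConvergesTo s l → (∀ n → N ℕ.≤ n → s n ≤ b) → l ≤ b
  convergesTo-≤ {s} {l} {b} N conv h = ≤-limit λ ε 0<ε → let
      (K , k) = conv ε 0<ε
      lower′ = proj₁ (proj₁ (k (N ℕ.+ K) (ℕ.m≤n+m K N)))
    in subst (_≤ b + ε) (solve 2 (λ l e → l :- e :+ e := l) refl l ε) (+-monoˡ-≤ ε (≤-trans lower′ (h (N ℕ.+ K) (ℕ.m≤m+n N K))))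

  convergesTo-≥ : ∀ {s : ℕ → ℝ} {l b} N → ConvergesTo s l → (∀ n → N ℕ.≤ n → b ≤ s n) → b ≤ l
  convergesTo-≥ {s} {l} {b} N conv h = ≤-limit λ ε 0<ε → let
      (K , k) = conv ε 0<ε
    in ≤-trans (h (N ℕ.+ K) (ℕ.m≤m+n N K)) (<⇒≤ (proj₂ (k (N ℕ.+ K) (ℕ.m≤n+m K N))))

  convergesTo-const : ∀ {s : ℕ → ℝ} {l x} N → ConvergesTo s l → (∀ n → N ℕ.≤ n → s n ≡ x) → l ≡ x
  convergesTo-const N conv h = ≤-antisym (convergesTo-≤ N conv λ n p → ≤-reflexive (h n p))
    (convergesTo-≥ N conv λ n p → ≤-reflexive (sym (h n p)))

  module Logarithm (log : ℝ → ℝ) (isLog : IsLogarithm log) where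
    open IsLogarithm isLog

    log-1 : log 1# ≡ 0#
    log-1 = trans (sym (+-identityˡ _)) (trans (cong (_+ log 1#) (sym (-‿inverseˡ (log 1#)))) (trans (+-assoc _ _ _)
      (trans (cong (- log 1# +_) (trans (sym (log-* 1# 1# 0<1 0<1)) (cong log (*-identityˡ 1#)))) (-‿inverseˡ (log 1#)))))

    log-≤ : ∀ {x y} → 0# < x → x ≤ y → log x ≤ log y
    log-≤ {x} {y} 0<x x≤y with em {P = x ≡ y}
    ... | yes refl = ≤-refl
    ... | no x≢y   = <⇒≤ (log-mono x y 0<x (x≤y , x≢y))

    log-⁻¹ : ∀ {x} → 0# < x → log (x ⁻¹) ≡ - log x
    log-⁻¹ {x} 0<x = trans (solve 2 (λ a b → a := (b :+ a) :- b) refl (log (x ⁻¹)) (log x))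
      (trans (cong (_- log x) (trans (sym (log-* x (x ⁻¹) 0<x (⁻¹-pos 0<x))) (trans (cong log (*-inverse 0<x)) log-1))) (+-identityˡ _))

    log-^ : ∀ {x} → 0# < x → ∀ n → log (x ^ n) ≡ fromℕ n * log x
    log-^ 0<x zero    = trans log-1 (sym (zeroˡ _))
    log-^ {x} 0<x (suc n) = trans (log-* x (x ^ n) 0<x (^-pos 0<x n))
      (trans (cong₂ _+_ (sym (*-identityˡ (log x))) (log-^ 0<x n)) (sym (distribʳ (log x) 1# (fromℕ n))))

    log-nonNeg : ∀ {x} → 1# ≤ x → 0# ≤ log x
    log-nonNeg p = subst (_≤ log _) log-1 (log-≤ 0<1 p)

    log-nonPos : ∀ {x} → 0# < x → x ≤ 1# → log x ≤ 0#
    log-nonPos 0<x p = subst (log _ ≤_) log-1 (log-≤ 0<x p)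

    1<2 : 1# < 2#
    1<2 = subst (_< 2#) (+-identityˡ 1#) (+-monoˡ-< 1# 0<1)

    log2>0 : 0# < log 2#
    log2>0 = subst (_< log 2#) log-1 (log-mono 1# 2# 0<1 1<2)

    1+n≤2^n : ∀ n → fromℕ (suc n) ≤ 2# ^ n
    1+n≤2^n zero    = ≤-reflexive (+-identityʳ 1#)
    1+n≤2^n (suc n) = ≤-trans (+-mono-≤ (≤-trans (≤-+-nonNeg (fromℕ-nonNeg n)) (1+n≤2^n n)) (1+n≤2^n n))
      (≤-reflexive (trans (cong₂ _+_ (sym (*-identityˡ _)) (sym (*-identityˡ _))) (sym (distribʳ (2# ^ n) 1# 1#))))

    -- For t ∈ [2ⁿ, 2ⁿ⁺¹] we have log t ≤ (n + 1) log 2 ≤ 2ⁿ log 2 ≤ t log 2.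
    log-≤-linear : ∀ {t} → 0# < t → log t ≤ log 2# * t
    log-≤-linear {t} 0<t with ≤-total t 1#
    ... | inj₁ t≤1 = ≤-trans (log-nonPos 0<t t≤1) (*-nonNeg (<⇒≤ log2>0) (<⇒≤ 0<t))
    ... | inj₂ 1≤t = let (N , t<N) = archimedean t in go N (≤-trans (<⇒≤ t<N) (≤-trans (fromℕ-mono (ℕ.n≤1+n N)) (1+n≤2^n N)))
      where
      go : ∀ n → t ≤ 2# ^ n → log t ≤ log 2# * t
      go zero    p = ≤-trans (log-nonPos 0<t p) (*-nonNeg (<⇒≤ log2>0) (<⇒≤ 0<t))
      go (suc n) p with ≤-total t (2# ^ n)
      ... | inj₁ q = go n q
      ... | inj₂ q = ≤-trans (log-≤ 0<t p) (≤-trans (≤-reflexive (trans (log-^ 0<2 (suc n)) (*-comm _ _)))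
        (*-monoˡ-≤ (<⇒≤ log2>0) (≤-trans (1+n≤2^n n) q)))

    -- log y = log T + log (y / T) ≤ log T + (log 2 / T) y, with T large.
    abstract
      log-sublinear : ∀ A B ε → 0# ≤ B → 0# < ε → ∃[ N ] (∀ n → N ℕ.≤ n → A + B * log (fromℕ (suc n)) ≤ ε * fromℕ n)
      log-sublinear A B ε 0≤B 0<ε = N , λ n N≤n → ≤-trans (+-monoʳ-≤ A (*-monoˡ-≤ 0≤B (split n)))
          (≤-trans (≤-reflexive (solve 5 (λ a b t s y → a :+ b :* (t :+ s :* y) := a :+ b :* t :+ (b :* s) :* y) refl A B (log T) (log 2# * T ⁻¹) (fromℕ (suc n))))
          (≤-trans (+-monoʳ-≤ _ (subst₂ _≤_ (*-comm _ _) (*-comm _ _) (*-monoˡ-≤ (fromℕ-nonNeg (suc n)) slope)))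
          (≤-trans (≤-reflexive (trans (cong (A + B * log T +_) (trans (distribˡ _ _ _) (cong (_+ ½ * ε * fromℕ n) (*-identityʳ _)))) (sym (+-assoc _ _ _))))
          (≤-trans (+-monoˡ-≤ _ (≤-trans constant (*-monoˡ-≤ (<⇒≤ (half-pos 0<ε)) (fromℕ-mono N≤n))))
            (≤-reflexive (trans (sym (distribʳ _ _ _)) (cong (_* fromℕ n) (half ε))))))))
        where
        T₀ : ∃[ n ] (B * log 2#) * (½ * ε) ⁻¹ < fromℕ n
        T₀ = archimedean _
        T : ℝ
        T = fromℕ (suc (proj₁ T₀))
        0<T : 0# < T
        0<T = fromℕ-pos (proj₁ T₀)
        slope : B * (log 2# * T ⁻¹) ≤ ½ * ε
        slope = *-cancelˡ-≤ 0<T (≤-trans (≤-reflexive (trans (solve 4 (λ t b l i → t :* (b :* (l :* i)) := (t :* i) :* (b :* l)) refl T B (log 2#) (T ⁻¹)) (trans (cong (_* (B * log 2#)) (*-inverse 0<T)) (*-identityˡ _))))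
          (*-cancelˡ-≤ (⁻¹-pos (half-pos 0<ε)) (≤-trans (≤-trans (≤-reflexive (*-comm _ _)) (≤-trans (<⇒≤ (proj₂ T₀)) (fromℕ-mono (ℕ.n≤1+n (proj₁ T₀)))))
            (≤-reflexive (sym (trans (solve 3 (λ i t e → i :* (t :* e) := t :* (e :* i)) refl ((½ * ε) ⁻¹) T (½ * ε)) (trans (cong (T *_) (*-inverse (half-pos 0<ε))) (*-identityʳ T))))))))
        split : ∀ n → log (fromℕ (suc n)) ≤ log T + log 2# * T ⁻¹ * fromℕ (suc n)
        split n = ≤-trans (≤-reflexive (trans (cong log (sym (trans (solve 3 (λ t i y → t :* (i :* y) := (t :* i) :* y) refl T (T ⁻¹) (fromℕ (suc n))) (trans (cong (_* fromℕ (suc n)) (*-inverse 0<T)) (*-identityˡ _)))))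
            (log-* T (T ⁻¹ * fromℕ (suc n)) 0<T (*-pos (⁻¹-pos 0<T) (fromℕ-pos n)))))
          (+-monoʳ-≤ (log T) (≤-trans (log-≤-linear (*-pos (⁻¹-pos 0<T) (fromℕ-pos n))) (≤-reflexive (sym (*-assoc _ _ _)))))
        N₀ : ∃[ n ] (½ * ε) ⁻¹ * (A + B * log T + ½ * ε) < fromℕ n
        N₀ = archimedean _
        N : ℕ
        N = proj₁ N₀
        constant : A + B * log T + ½ * ε ≤ ½ * ε * fromℕ N
        constant = *-cancelˡ-≤ (⁻¹-pos (half-pos 0<ε)) (≤-trans (<⇒≤ (proj₂ N₀))
          (≤-reflexive (sym (trans (sym (*-assoc _ _ _)) (trans (cong (_* fromℕ N) (trans (*-comm _ _) (*-inverse (half-pos 0<ε)))) (*-identityˡ _))))))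

    bernoulli : ∀ {y} → 0# ≤ y → y ≤ 1# → ∀ n → 1# - fromℕ n * y ≤ (1# - y) ^ n
    bernoulli {y} 0≤y y≤1 zero    = ≤-reflexive (solve 2 (λ o y → o :- con (ℤ.+ 0) :* y := o) refl 1# y)
    bernoulli {y} 0≤y y≤1 (suc n) = ≤-trans
      (≤-by (fromℕ n * y * y) (*-nonNeg (*-nonNeg (fromℕ-nonNeg n) 0≤y) 0≤y)
        (trans (cong (λ z → 1# - z + fromℕ n * y * y) (trans (distribʳ y 1# (fromℕ n)) (cong (_+ fromℕ n * y) (*-identityˡ y))))
        (trans (solve 3 (λ o n y → o :- (y :+ n :* y) :+ n :* y :* y := o :- n :* y :- y :* (con (ℤ.+ 1) :- n :* y)) refl 1# (fromℕ n) y)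
        (sym (trans (distribʳ _ _ _) (cong₂ _+_ (*-identityˡ _) (trans (solve 3 (λ o n y → (:- y) :* (o :- n :* y) := :- (y :* (o :- n :* y))) refl 1# (fromℕ n) y)
          (cong (λ o → - (y * (o - fromℕ n * y))) (sym (+-identityʳ 1#))))))))))
      (*-monoˡ-≤ (0≤- y≤1) (bernoulli 0≤y y≤1 n))

    -- y = 1/(2N) with N large: (1 - y)ᴺ ≥ 1/2, so -log (1 - y) ≤ (log 2) / N.
    abstract
      near-one : ∀ ε → 0# < ε → ∃[ y ] 0# < y × y ≤ ½ × - log (1# - y) ≤ ε
      near-one ε 0<ε with archimedean (ε ⁻¹ * log 2#)
      ... | N₀ , big = y , 0<y , y≤½ , *-cancelˡ-≤ 0<N
            (≤-trans (≤-reflexive (trans (solve 2 (λ n l → n :* (:- l) := :- (n :* l)) refl (fromℕ N) (log (1# - y))) (cong -_ (sym (log-^ 0<α N)))))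
            (≤-trans (neg-mono (log-≤ 0<½ (≤-trans ½≤ (bernoulli (<⇒≤ 0<y) y≤1 N)))) (≤-trans (≤-reflexive (trans (cong -_ (log-⁻¹ 0<2)) (solve 1 (λ l → :- (:- l) := l) refl (log 2#)))) log2≤)))
        where
        N : ℕ
        N = suc N₀
        0<N : 0# < fromℕ N
        0<N = fromℕ-pos N₀
        y : ℝ
        y = ½ * fromℕ N ⁻¹
        0<y : 0# < y
        0<y = half-pos (⁻¹-pos 0<N)
        y≤½ : y ≤ ½
        y≤½ = subst (y ≤_) (*-identityʳ ½) (*-monoˡ-≤ (<⇒≤ 0<½) (*-cancelˡ-≤ 0<N (subst₂ _≤_ (sym (*-inverse 0<N)) (sym (*-identityʳ _)) (≤-+-nonNeg (fromℕ-nonNeg N₀)))))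
        y≤1 : y ≤ 1#
        y≤1 = ≤-trans y≤½ (subst (½ ≤_) ½+½ (≤-+-nonNeg (<⇒≤ 0<½)))
        0<α : 0# < 1# - y
        0<α = <-≤-trans 0<½ (subst (_≤ 1# - y) (trans (cong (_- ½) (sym ½+½)) (solve 1 (λ h → h :+ h :- h := h) refl ½)) (+-monoʳ-≤ 1# (neg-mono y≤½)))
        ½≤ : ½ ≤ 1# - fromℕ N * y
        ½≤ = ≤-reflexive (sym (trans (cong (λ z → 1# - z) (trans (solve 3 (λ n h i → n :* (h :* i) := h :* (n :* i)) refl (fromℕ N) ½ (fromℕ N ⁻¹)) (trans (cong (½ *_) (*-inverse 0<N)) (*-identityʳ ½))))
          (trans (cong (_- ½) (sym ½+½)) (solve 1 (λ h → h :+ h :- h := h) refl ½))))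
        log2≤ : log 2# ≤ fromℕ N * ε
        log2≤ = *-cancelˡ-≤ (⁻¹-pos 0<ε) (≤-trans (<⇒≤ big) (≤-trans (fromℕ-mono (ℕ.n≤1+n N₀))
          (≤-reflexive (sym (trans (solve 3 (λ i n e → i :* (n :* e) := n :* (e :* i)) refl (ε ⁻¹) (fromℕ N) ε) (trans (cong (fromℕ N *_) (*-inverse 0<ε)) (*-identityʳ _)))))))

-- Limits along the ultrafilter

module UltraLimit (em : ∀ {a} → ExcludedMiddle a) (ext : ∀ {a b} → Extensionality a b) (𝓡 : RealNumbers) where
  open Classical em
  open Ultrafilter em ext
  open Reals em 𝓡

  record IsLim (s : ℕ → ℝ) (l : ℝ) : Set where
    constructor isLim
    field
      close : ∀ ε → 0# < ε → ∀ᵁ λ n → l ≤ s n + ε × s n ≤ l + ε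

  open IsLim

  lim-≤ : ∀ {s t l u} → IsLim s l → IsLim t u → ∀ᵁ (λ n → s n ≤ t n) → l ≤ u
  lim-≤ {s} {t} {l} {u} p q st = ≤-limit λ ε 0<ε →
    let (n , _ , (a , _) , (_ , b) , le) = ∀ᵁ-exists (∀ᵁ-zip (λ _ x (y , z) → x , y , z) (close p (½ * ε) (half-pos 0<ε))
          (∀ᵁ-zip (λ _ x y → x , y) (close q (½ * ε) (half-pos 0<ε)) st)) 0
    in ≤-trans a (≤-trans (+-monoˡ-≤ (½ * ε) (≤-trans le b)) (≤-reflexive (trans (+-assoc _ _ _) (cong (u +_) (half ε)))))

  lim-unique : ∀ {s l u} → IsLim s l → IsLim s u → l ≡ u
  lim-unique p q = ≤-antisym (lim-≤ p q (∀ᵁ-eventually 0 λ _ _ → ≤-refl)) (lim-≤ q p (∀ᵁ-eventually 0 λ _ _ → ≤-refl))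

  lim-+ : ∀ {s t l u} → IsLim s l → IsLim t u → IsLim (λ n → s n + t n) (l + u)
  lim-+ {s} {t} {l} {u} p q = isLim λ ε 0<ε → ∀ᵁ-zip
    (λ n (a , b) (c , d) → ≤-trans (+-mono-≤ a c) (≤-reflexive (regroup (s n) (t n) ε)) , ≤-trans (+-mono-≤ b d) (≤-reflexive (regroup l u ε)))
    (close p (½ * ε) (half-pos 0<ε)) (close q (½ * ε) (half-pos 0<ε))
    where
    regroup : ∀ x y ε → x + ½ * ε + (y + ½ * ε) ≡ x + y + ε
    regroup x y ε = trans (solve 3 (λ x y h → x :+ h :+ (y :+ h) := x :+ y :+ (h :+ h)) refl x y (½ * ε)) (cong (x + y +_) (half ε))

  lim-eventually : ∀ {s x} N → (∀ n → N ℕ.≤ n → s n ≡ x) → IsLim s x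
  lim-eventually {s} {x} N h = isLim λ ε 0<ε → ∀ᵁ-eventually N λ n N≤n →
    subst (λ y → x ≤ y + ε × y ≤ x + ε) (sym (h n N≤n)) (≤-+-nonNeg (<⇒≤ 0<ε) , ≤-+-nonNeg (<⇒≤ 0<ε))

  -- The limit is the supremum of the numbers lying below almost all terms.
  lim-exists : ∀ s → (∀ n → 0# ≤ s n) → (∀ n → s n ≤ 1#) → ∃ (IsLim s)
  lim-exists s nonneg ≤1 with supremum (λ r → ∀ᵁ λ n → r ≤ s n) (0# , ∀ᵁ-eventually 0 λ n _ → nonneg n)
    (1# , λ r u → let (n , _ , p) = ∀ᵁ-exists u 0 in ≤-trans p (≤1 n))
  ... | l , ub , least = l , isLim λ ε 0<ε → ∀ᵁ-zip (λ n a b → a , b) (below ε 0<ε) (above ε 0<ε)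
    where
    l<l+ : ∀ {l} ε → 0# < ε → l < l + ε
    l<l+ {l} ε p = subst₂ _<_ (+-identityˡ l) (+-comm ε l) (+-monoˡ-< l p)
    above : ∀ ε → 0# < ε → ∀ᵁ λ n → s n ≤ l + ε
    above ε 0<ε = ∀ᵁ-map (λ n → ≰⇒≥) (∀ᵁ-¬ λ u → <⇒≱ (l<l+ ε 0<ε) (ub (l + ε) u))
    below : ∀ ε → 0# < ε → ∀ᵁ λ n → l ≤ s n + ε
    below ε 0<ε = dne λ ¬u → <⇒≱ (l<l+ {l - ε} ε 0<ε) (subst (_≤ l - ε) (solve 2 (λ l e → l := l :- e :+ e) refl l ε)
      (least (l - ε) λ r u → ≰⇒≥ λ p → ¬u (∀ᵁ-map (λ n q → subst (_≤ s n + ε) (solve 2 (λ l e → l :- e :+ e := l) refl l ε)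
        (+-monoˡ-≤ ε (≤-trans p q))) u)))

  Lim : (ℕ → ℝ) → ℝ
  Lim s with em {P = ∃ (IsLim s)}
  ... | yes (l , _) = l
  ... | no _        = 0#

  Lim-isLim : ∀ {s} → ∃ (IsLim s) → IsLim s (Lim s)
  Lim-isLim {s} e with em {P = ∃ (IsLim s)}
  ... | yes (_ , p) = p
  ... | no none     = ⊥-elim (none e)

-- Finitely additive probabilities

module Charge (em : ∀ {a} → ExcludedMiddle a) (ext : ∀ {a b} → Extensionality a b) (𝓡 : RealNumbers) {ℓ} (X : Set ℓ) where
  open Classical em
  open Reals em 𝓡
  open Analysis em 𝓡
  open UltraLimit em ext 𝓡

  Set′ : Set (lsuc ℓ)
  Set′ = Pred X ℓ

  -- Additivity is over all subsets, definable or not: point masses have it, and mixtures, averages,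
  -- ultralimits and pullbacks preserve it.
  record IsCharge (m : Set′ → ℝ) : Set (lsuc ℓ) where
    field
      m-cong   : ∀ {D E} → D ≐ E → m D ≡ m E
      nonNeg   : ∀ D → 0# ≤ m D
      total    : m U ≡ 1#
      additive : ∀ {D E} → D ⊥′ E → m (D ∪ E) ≡ m D + m E

    mono : ∀ {D E} → (∀ x → D x → E x) → m D ≤ m E
    mono {D} {E} sub = ≤-trans (≤-+-nonNeg (nonNeg (E ∩ ∁ D))) (≤-reflexive (trans (sym (additive (λ x (d , _ , ¬d) → ¬d d)))
      (m-cong ([ sub _ , proj₁ ]′ , λ {x} e → split x e))))
      where
      split : ∀ x → E x → (D ∪ (E ∩ ∁ D)) x
      split x e with em {P = D x}
      ... | yes d = inj₁ d
      ... | no ¬d = inj₂ (e , ¬d)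

    ≤1 : ∀ D → m D ≤ 1#
    ≤1 D = subst (m D ≤_) total (mono λ _ _ → _)

    subadditive : ∀ D E → m (D ∪ E) ≤ m D + m E
    subadditive D E = ≤-trans (≤-reflexive (trans (m-cong ((λ {x} → split x) , [ inj₁ , inj₂ ∘ proj₁ ]′)) (additive (λ x (d , _ , ¬d) → ¬d d))))
      (+-monoʳ-≤ (m D) (mono λ x → proj₁))
      where
      split : ∀ x → (D ∪ E) x → (D ∪ (E ∩ ∁ D)) x
      split x (inj₁ d) = inj₁ d
      split x (inj₂ e) with em {P = D x}
      ... | yes d = inj₁ d
      ... | no ¬d = inj₂ (e , ¬d)

    modular : ∀ D E → m D + m E ≡ m (D ∪ E) + m (D ∩ E)
    modular D E = trans (cong (m D +_) (trans (m-cong ((λ {x} → split x) , [ proj₁ , proj₂ ]′)) (additive λ x ((_ , ¬d) , d , _) → ¬d d)))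
      (trans (sym (+-assoc _ _ _)) (cong (_+ m (D ∩ E)) (trans (sym (additive λ x (d , _ , ¬d) → ¬d d))
        (m-cong ([ inj₁ , inj₂ ∘ proj₁ ]′ , λ {x} → split′ x)))))
      where
      split : ∀ x → E x → ((E ∩ ∁ D) ∪ (D ∩ E)) x
      split x e with em {P = D x}
      ... | yes d = inj₂ (d , e)
      ... | no ¬d = inj₁ (e , ¬d)
      split′ : ∀ x → (D ∪ E) x → (D ∪ (E ∩ ∁ D)) x
      split′ x (inj₁ d) = inj₁ d
      split′ x (inj₂ e) with em {P = D x}
      ... | yes d = inj₁ d
      ... | no ¬d = inj₂ (e , ¬d)

  indicator : Bool → ℝ
  indicator true  = 1#
  indicator false = 0#

  δ : X → Set′ → ℝ
  δ x D = indicator ⌊ D x ⌋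

  δ-isCharge : ∀ x → IsCharge (δ x)
  δ-isCharge x = record
    { m-cong   = λ (f , g) → cong indicator (⌊⌋-cong f g)
    ; nonNeg   = λ D → nn ⌊ D x ⌋
    ; total    = cong indicator (holds {P = U x} _)
    ; additive = λ {D} {E} disjoint → add disjoint
    }
    where
    nn : ∀ b → 0# ≤ indicator b
    nn true  = 0≤1
    nn false = ≤-refl
    add : ∀ {D E : Set′} → D ⊥′ E → δ x (D ∪ E) ≡ δ x D + δ x E
    add {D} {E} disjoint with em {P = D x} | em {P = E x}
    ... | yes d | yes e = ⊥-elim (disjoint x (d , e))
    ... | yes d | no ¬e = trans (cong indicator (holds {P = (D ∪ E) x} (inj₁ d))) (sym (+-identityʳ 1#))
    ... | no ¬d | yes e = trans (cong indicator (holds {P = (D ∪ E) x} (inj₂ e))) (sym (+-identityˡ 1#))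
    ... | no ¬d | no ¬e = trans (cong indicator (fails {P = (D ∪ E) x} [ ¬d , ¬e ]′)) (sym (+-identityˡ 0#))

  mix-isCharge : ∀ {m m′} → IsCharge m → IsCharge m′ → IsCharge (λ D → ½ * m D + ½ * m′ D)
  mix-isCharge {m} {m′} c c′ = record
    { m-cong   = λ eq → cong₂ (λ x y → ½ * x + ½ * y) (m-cong c eq) (m-cong c′ eq)
    ; nonNeg   = λ D → +-nonNeg (*-nonNeg (<⇒≤ 0<½) (nonNeg c D)) (*-nonNeg (<⇒≤ 0<½) (nonNeg c′ D))
    ; total    = trans (cong₂ (λ x y → ½ * x + ½ * y) (total c) (total c′)) (half 1#)
    ; additive = λ {D} {E} dis → trans (cong₂ (λ x y → ½ * x + ½ * y) (additive c dis) (additive c′ dis))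
        (solve 5 (λ h a b c d → h :* (a :+ b) :+ h :* (c :+ d) := h :* a :+ h :* c :+ (h :* b :+ h :* d)) refl ½ (m D) (m E) (m′ D) (m′ E))
    }
    where open IsCharge

  average : ℕ → (ℕ → Set′ → ℝ) → Set′ → ℝ
  average n m D = fromℕ (suc n) ⁻¹ * ∑< (suc n) (λ j → m j D)

  average-isCharge : ∀ n {m} → (∀ j → IsCharge (m j)) → IsCharge (average n m)
  average-isCharge n {m} c = record
    { m-cong   = λ eq → cong (fromℕ (suc n) ⁻¹ *_) (∑<-cong (suc n) λ j _ → m-cong (c j) eq)
    ; nonNeg   = λ D → *-nonNeg (<⇒≤ (⁻¹-pos (fromℕ-pos n))) (∑<-nonNeg (suc n) λ j → nonNeg (c j) D)
    ; total    = trans (cong (fromℕ (suc n) ⁻¹ *_) (trans (∑<-cong (suc n) λ j _ → total (c j)) (trans (∑<-const (suc n) 1#) (*-identityʳ _))))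
        (trans (*-comm _ _) (*-inverse (fromℕ-pos n)))
    ; additive = λ {D} {E} dis → trans (cong (fromℕ (suc n) ⁻¹ *_) (trans (∑<-cong (suc n) λ j _ → additive (c j) dis) (∑<-+ (suc n) (λ j → m j D) (λ j → m j E))))
        (distribˡ _ _ _)
    }
    where open IsCharge

  Lim-isCharge : ∀ {m : ℕ → Set′ → ℝ} → (∀ n → IsCharge (m n)) → IsCharge (λ D → Lim (λ n → m n D))
  Lim-isCharge {m} c = record
    { m-cong   = λ {D} {E} eq → ≤-antisym (lim-≤ (lim D) (lim E) (everywhere λ n → ≤-reflexive (m-cong (c n) eq)))
                                          (lim-≤ (lim E) (lim D) (everywhere λ n → ≤-reflexive (sym (m-cong (c n) eq))))
    ; nonNeg   = λ D → lim-≤ (lim-eventually {λ _ → 0#} 0 λ _ _ → refl) (lim D) (everywhere λ n → nonNeg (c n) D)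
    ; total    = lim-unique (lim U) (lim-eventually 0 λ n _ → total (c n))
    ; additive = λ {D} {E} dis → lim-unique (lim (D ∪ E)) (subst-lim (λ n → sym (additive (c n) dis)) (lim-+ (lim D) (lim E)))
    }
    where
    open IsCharge
    open Ultrafilter em ext using (∀ᵁ; ∀ᵁ-eventually)
    everywhere : ∀ {P : ℕ → Set} → (∀ n → P n) → ∀ᵁ P
    everywhere h = ∀ᵁ-eventually 0 λ n _ → h n
    lim : ∀ D → IsLim (λ n → m n D) (Lim (λ n → m n D))
    lim D = Lim-isLim (lim-exists (λ n → m n D) (λ n → nonNeg (c n) D) (λ n → ≤1 (c n) D))
    subst-lim : ∀ {s t : ℕ → ℝ} {l} → (∀ n → s n ≡ t n) → IsLim s l → IsLim t l
    subst-lim {s} {t} eq p = subst (λ u → IsLim u _) (ext eq) p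

  pullback-isCharge : ∀ {m} (f : X → X) → IsCharge m → IsCharge (λ D → m (D ∘ f))
  pullback-isCharge f c = record
    { m-cong   = λ (p , q) → m-cong c (p , q)
    ; nonNeg   = λ D → nonNeg c (D ∘ f)
    ; total    = total c
    ; additive = λ dis → additive c (λ x → dis (f x))
    }
    where open IsCharge

-- Finite unions and symmetric differences

module FiniteUnions (em : ∀ {a} → ExcludedMiddle a) {ℓ} {X : Set ℓ} where
  open Classical em

  infix 4 _⊑_
  _⊑_ : Pred X ℓ → Pred X ℓ → Set ℓ
  A ⊑ B = ∀ x → A x → B x

  ⋃< : ℕ → (ℕ → Pred X ℓ) → Pred X ℓ
  ⋃< n F x = ∃[ j ] j ℕ.< n × F j x

  ⋃<-suc : ∀ n F → ⋃< (suc n) F ≐ ⋃< n F ∪ F n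
  ⋃<-suc n F = to , [ (λ (j , p , q) → j , ℕ.m<n⇒m<1+n p , q) , (λ q → n , ℕ.≤-refl , q) ]′
    where
    to : ∀ {x} → ⋃< (suc n) F x → (⋃< n F ∪ F n) x
    to (j , s≤s j≤n , q) with ℕ.m≤n⇒m<n∨m≡n j≤n
    ... | inj₁ j<n  = inj₁ (j , j<n , q)
    ... | inj₂ refl = inj₂ q

  fresh : (ℕ → Pred X ℓ) → ℕ → Pred X ℓ
  fresh F i = F i ∩ ∁ (⋃< i F)

  fresh-disjoint : ∀ F i j → i ≢ j → fresh F i ⊥′ fresh F j
  fresh-disjoint F i j i≢j x ((p , ¬p) , (q , ¬q)) with ℕ.<-cmp i j
  ... | tri< i<j _ _ = ¬q (i , i<j , p)
  ... | tri≈ _ eq _  = i≢j eq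
  ... | tri> _ _ j<i = ¬p (j , j<i , q)

  ⋃<-fresh : ∀ n F → ⋃< n (fresh F) ≐ ⋃< n F
  ⋃<-fresh n F = (λ (j , p , q , _) → j , p , q) , λ {x} (j , p , q) → first x j p q
    where
    first : ∀ x j → j ℕ.< n → F j x → ⋃< n (fresh F) x
    first x j j<n q = go j (<-wellFounded j) j<n q
      where
      go : ∀ j → Acc ℕ._<_ j → j ℕ.< n → F j x → ⋃< n (fresh F) x
      go j (acc rs) j<n q with em {P = ⋃< j F x}
      ... | yes (i , i<j , r) = go i (rs i<j) (ℕ.<-trans i<j j<n) r
      ... | no none           = j , j<n , q , none

  ⋃-fresh : ∀ F → ⋃ ℕ (fresh F) ≐ ⋃ ℕ F
  ⋃-fresh F = (λ (j , q , _) → j , q) ,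
    λ (j , q) → let (i , _ , r) = proj₂ (⋃<-fresh (suc j) F) (j , ℕ.≤-refl , q) in i , r

  infix 8 _△_
  _△_ : Pred X ℓ → Pred X ℓ → Pred X ℓ
  A △ D = (A ∩ ∁ D) ∪ (D ∩ ∁ A)

  ⊑-△ : ∀ A D → A ⊑ D ∪ A △ D
  ⊑-△ A D x p with em {P = D x}
  ... | yes d = inj₁ d
  ... | no ¬d = inj₂ (inj₁ (p , ¬d))

  ⊒-△ : ∀ A D → D ⊑ A ∪ A △ D
  ⊒-△ A D x p with em {P = A x}
  ... | yes a = inj₁ a
  ... | no ¬a = inj₂ (inj₂ (p , ¬a))

  △-∁ : ∀ A D → ∁ A △ ∁ D ⊑ A △ D
  △-∁ A D x (inj₁ (¬a , ¬¬d)) = inj₂ (dne ¬¬d , ¬a)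
  △-∁ A D x (inj₂ (¬d , ¬¬a)) = inj₁ (dne ¬¬a , ¬d)

  △-∪ : ∀ A B D E → (A ∪ B) △ (D ∪ E) ⊑ A △ D ∪ B △ E
  △-∪ A B D E x (inj₁ (inj₁ a , ¬d)) = inj₁ (inj₁ (a , ¬d ∘ inj₁))
  △-∪ A B D E x (inj₁ (inj₂ b , ¬d)) = inj₂ (inj₁ (b , ¬d ∘ inj₂))
  △-∪ A B D E x (inj₂ (inj₁ d , ¬a)) = inj₁ (inj₂ (d , ¬a ∘ inj₁))
  △-∪ A B D E x (inj₂ (inj₂ e , ¬a)) = inj₂ (inj₂ (e , ¬a ∘ inj₂))

  △-resp : ∀ {A B} D → A ≐ B → B △ D ⊑ A △ D
  △-resp D (f , g) x (inj₁ (b , ¬d)) = inj₁ (g b , ¬d)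
  △-resp D (f , g) x (inj₂ (d , ¬b)) = inj₂ (d , ¬b ∘ f)

  △-trans : ∀ A B D → A △ D ⊑ A △ B ∪ B △ D
  △-trans A B D x (inj₁ (a , ¬d)) with em {P = B x}
  ... | yes b = inj₂ (inj₁ (b , ¬d))
  ... | no ¬b = inj₁ (inj₁ (a , ¬b))
  △-trans A B D x (inj₂ (d , ¬a)) with em {P = B x}
  ... | yes b = inj₁ (inj₂ (b , ¬a))
  ... | no ¬b = inj₂ (inj₂ (d , ¬b))

-- Extension to a countably additive measure

-- A set is covered by increasing sequences of 𝒜; countable compactness makes the resulting outer
-- measure agree with m on 𝒜, and the sets approximable by 𝒜 form a σ-algebra on which it is additive.
module OuterMeasure (em : ∀ {a} → ExcludedMiddle a) (ext : ∀ {a b} → Extensionality a b) (𝓡 : RealNumbers)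
  {ℓ a} {X : Set ℓ} (𝒜 : Pred (Pred X ℓ) a)
  (𝒜-U : 𝒜 U) (𝒜-∁ : ∀ {D} → 𝒜 D → 𝒜 (∁ D)) (𝒜-∪ : ∀ {D E} → 𝒜 D → 𝒜 E → 𝒜 (D ∪ E)) (𝒜-resp : ∀ {D E} → 𝒜 D → D ≐ E → 𝒜 E)
  (compact : ∀ {A} (D : ℕ → Pred X ℓ) → 𝒜 A → (∀ i → 𝒜 (D i)) → (∀ i x → D i x → D (suc i) x) →
    (∀ x → A x → ∃[ i ] D i x) → ∃[ i ] (∀ x → A x → D i x))
  (m : Pred X ℓ → RealNumbers.ℝ 𝓡) (isCharge : Charge.IsCharge em ext 𝓡 X m) where
  open Classical em
  open Reals em 𝓡
  open Analysis em 𝓡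
  open FiniteUnions em {X = X}
  open Charge em ext 𝓡 X
  open IsCharge isCharge

  -- As the sequence increases, a common bound on the `m (D i)` plays the part of the usual infinite
  -- sum.
  Cover : Pred X ℓ → ℝ → Set (lsuc ℓ ⊔ a)
  Cover A r = Σ[ D ∈ (ℕ → Pred X ℓ) ] (∀ i → 𝒜 (D i)) × (∀ i → D i ⊑ D (suc i)) × (∀ x → A x → ∃[ i ] D i x) × (∀ i → m (D i) ≤ r)

  abstract
    -- Minus the supremum of the negated bounds; the constant cover by the whole space makes the set
    -- nonempty, and nonnegativity of `m` bounds it.
    infimum : ∀ A → ∃[ o ] (∀ r → Cover A r → o ≤ r) × (∀ ε → 0# < ε → ∃[ r ] Cover A r × r ≤ o + ε)
    infimum A with supremum (λ y → Cover A (- y)) (- 1# , (λ _ → U) , (λ _ → 𝒜-U) , (λ _ _ _ → _) , (λ _ _ → 0 , _) ,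
        λ _ → ≤-reflexive (trans total (solve 1 (λ o → o := :- (:- o)) refl 1#)))
      (0# , λ y (D , _ , _ , _ , b) → subst₂ _≤_ (solve 1 (λ y → :- (:- y) := y) refl y) (solve 0 (:- con (ℤ.+ 0) := con (ℤ.+ 0)) refl)
        (neg-mono (≤-trans (nonNeg (D 0)) (b 0))))
    ... | s , ub , least = - s
        , (λ r c → subst (- s ≤_) (solve 1 (λ r → :- (:- r) := r) refl r) (neg-mono (ub (- r) (subst (Cover A) (solve 1 (λ r → r := :- (:- r)) refl r) c))))
        , λ ε 0<ε → dne λ none → <⇒≱ 0<ε (+-cancelʳ-≤ (s - ε) (subst₂ _≤_
            (solve 2 (λ s e → s := e :+ (s :- e)) refl s ε) (solve 2 (λ s e → s :- e := con (ℤ.+ 0) :+ (s :- e)) refl s ε)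
            (least (s - ε) λ y c → subst₂ _≤_ (solve 1 (λ y → :- (:- y) := y) refl y) (solve 2 (λ s e → :- ((:- s) :+ e) := s :- e) refl s ε)
              (neg-mono (≰⇒≥ λ p → none (- y , c , p))))))

  out : Pred X ℓ → ℝ
  out A = proj₁ (infimum A)

  out-≤ : ∀ {A r} → Cover A r → out A ≤ r
  out-≤ {A} {r} = proj₁ (proj₂ (infimum A)) r

  out-cover : ∀ A ε → 0# < ε → ∃[ r ] Cover A r × r ≤ out A + ε
  out-cover A = proj₂ (proj₂ (infimum A))

  out-greatest : ∀ {A x} → (∀ r → Cover A r → x ≤ r) → x ≤ out A
  out-greatest {A} h = ≤-limit λ ε 0<ε → let (r , c , p) = out-cover A ε 0<ε in ≤-trans (h r c) p

  out-nonNeg : ∀ A → 0# ≤ out A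
  out-nonNeg A = out-greatest λ r (D , _ , _ , _ , b) → ≤-trans (nonNeg (D 0)) (b 0)

  out-mono : ∀ {A B} → A ⊑ B → out A ≤ out B
  out-mono sub = out-greatest λ r (D , d , inc , cov , b) → out-≤ (D , d , inc , (λ x p → cov x (sub x p)) , b)

  out-cong : ∀ {A B} → A ≐ B → out A ≡ out B
  out-cong (f , g) = ≤-antisym (out-mono λ _ → f) (out-mono λ _ → g)

  out-𝒜 : ∀ {A} → 𝒜 A → out A ≡ m A
  out-𝒜 {A} α = ≤-antisym (out-≤ ((λ _ → A) , (λ _ → α) , (λ _ _ p → p) , (λ _ p → 0 , p) , λ _ → ≤-refl))
    (out-greatest λ r (D , d , inc , cov , b) → let (i , sub) = compact D α d inc cov in ≤-trans (mono sub) (b i))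

  out-∪ : ∀ A B → out (A ∪ B) ≤ out A + out B
  out-∪ A B = ≤-limit λ ε 0<ε → let
      (r , (D , d , inc , cov , b) , r≤) = out-cover A (½ * ε) (half-pos 0<ε)
      (r′ , (D′ , d′ , inc′ , cov′ , b′) , r′≤) = out-cover B (½ * ε) (half-pos 0<ε)
    in ≤-trans (out-≤ ((λ i → D i ∪ D′ i) , (λ i → 𝒜-∪ (d i) (d′ i)) , (λ i x → [ inj₁ ∘ inc i x , inj₂ ∘ inc′ i x ]′)
          , (λ x → [ map₂ inj₁ ∘ cov x , map₂ inj₂ ∘ cov′ x ]′) , λ i → ≤-trans (subadditive (D i) (D′ i)) (+-mono-≤ (b i) (b′ i))))
        (≤-trans (+-mono-≤ r≤ r′≤) (≤-reflexive (trans (solve 3 (λ x y h → x :+ h :+ (y :+ h) := x :+ y :+ (h :+ h)) refl (out A) (out B) (½ * ε))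
          (cong (out A + out B +_) (half ε)))))

  𝒜-⋃< : ∀ n {F} → (∀ j → 𝒜 (F j)) → 𝒜 (⋃< n F)
  𝒜-⋃< zero    f = 𝒜-resp (𝒜-∁ 𝒜-U) ((λ p → ⊥-elim (p _)) , λ ())
  𝒜-⋃< (suc n) {F} f = 𝒜-resp (𝒜-∪ (𝒜-⋃< n f) (f n)) (proj₂ (⋃<-suc n F) , proj₁ (⋃<-suc n F))

  m-⋃< : ∀ n F → m (⋃< n F) ≤ ∑< n (λ j → m (F j))
  m-⋃< zero    F = ≤-reflexive (trans (m-cong {E = ∁ U} ((λ ()) , λ p → ⊥-elim (p _))) empty)
    where
    empty : m (∁ U) ≡ 0#
    empty = trans (solve 2 (λ a b → a := (b :+ a) :- b) refl (m (∁ U)) (m U)) (trans (cong (_- m U)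
      (trans (sym (additive {U} {∁ U} λ x (_ , p) → p _)) (m-cong ((λ _ → _) , λ _ → inj₁ _)))) (-‿inverseʳ _))
  m-⋃< (suc n) F = ≤-trans (≤-reflexive (m-cong (⋃<-suc n F))) (≤-trans (subadditive (⋃< n F) (F n)) (+-monoˡ-≤ _ (m-⋃< n F)))

  geometric : ∀ ε n → ∑< n (λ j → ε * ½ ^ suc j) + ε * ½ ^ n ≡ ε
  geometric ε zero    = trans (+-identityˡ _) (*-identityʳ ε)
  geometric ε (suc n) = trans (+-assoc _ _ _) (trans (cong (∑< n (λ j → ε * ½ ^ suc j) +_)
    (trans (solve 3 (λ e h p → e :* (h :* p) :+ e :* (h :* p) := e :* (h :* p :+ h :* p)) refl ε ½ (½ ^ n)) (cong (ε *_) (half (½ ^ n))))) (geometric ε n))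

  -- Covers of `A j` with error `ε * ½ ^ suc j` are combined diagonally: the set at stage `i` is the
  -- union of the stage-`i` sets of the first `i` covers.
  out-⋃ : ∀ A {r} → (∀ n → ∑< n (λ j → out (A j)) ≤ r) → out (⋃ ℕ A) ≤ r
  out-⋃ A {r} h = ≤-limit λ ε 0<ε → let
      pos : ∀ j → 0# < ε * ½ ^ suc j
      pos j = *-pos 0<ε (^-pos 0<½ (suc j))
      cover : ∀ j → ∃[ s ] Cover (A j) s × s ≤ out (A j) + ε * ½ ^ suc j
      cover j = out-cover (A j) (ε * ½ ^ suc j) (pos j)
      D : ℕ → ℕ → Pred X ℓ
      D j = proj₁ (proj₁ (proj₂ (cover j)))
      inc : ∀ j i → D j i ⊑ D j (suc i)
      inc j = proj₁ (proj₂ (proj₂ (proj₁ (proj₂ (cover j)))))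
    in out-≤ ((λ i → ⋃< i (λ j → D j i)) , (λ i → 𝒜-⋃< i λ j → proj₁ (proj₂ (proj₁ (proj₂ (cover j)))) i)
      , (λ i x (j , j<i , p) → j , ℕ.m<n⇒m<1+n j<i , inc j i x p)
      , (λ x (j , p) → let (i , q) = proj₁ (proj₂ (proj₂ (proj₂ (proj₁ (proj₂ (cover j)))))) x p in
           suc j ℕ.+ i , j , ℕ.m≤m+n (suc j) i , raise (D j) (inc j) x (suc j) i q)
      , λ i → ≤-trans (m-⋃< i (λ j → D j i)) (≤-trans (∑<-mono i λ j → ≤-trans (proj₂ (proj₂ (proj₂ (proj₂ (proj₁ (proj₂ (cover j)))))) i) (proj₂ (proj₂ (cover j))))
          (≤-trans (≤-reflexive (∑<-+ i (λ j → out (A j)) (λ j → ε * ½ ^ suc j))) (+-mono-≤ (h i)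
            (≤-trans (≤-+-nonNeg (<⇒≤ (*-pos 0<ε (^-pos 0<½ i)))) (≤-reflexive (geometric ε i)))))))
    where
    raise : ∀ (D : ℕ → Pred X ℓ) → (∀ i → D i ⊑ D (suc i)) → ∀ x d i → D i x → D (d ℕ.+ i) x
    raise D inc x zero    i p = p
    raise D inc x (suc d) i p = inc (d ℕ.+ i) x (raise D inc x d i p)

  Good : Pred X ℓ → Set (lsuc ℓ ⊔ a)
  Good A = ∀ ε → 0# < ε → Σ[ D ∈ Pred X ℓ ] 𝒜 D × out (A △ D) ≤ ε

  good-∁ : ∀ {A} → Good A → Good (∁ A)
  good-∁ {A} g ε 0<ε = let (D , d , p) = g ε 0<ε in ∁ D , 𝒜-∁ d , ≤-trans (out-mono (△-∁ A D)) p

  good-resp : ∀ {A B} → A ≐ B → Good A → Good B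
  good-resp eq g ε 0<ε = let (D , d , p) = g ε 0<ε in D , d , ≤-trans (out-mono (△-resp D eq)) p

  good-∪ : ∀ {A B} → Good A → Good B → Good (A ∪ B)
  good-∪ {A} {B} g h ε 0<ε = let
      (D , d , p) = g (½ * ε) (half-pos 0<ε)
      (E , e , q) = h (½ * ε) (half-pos 0<ε)
    in D ∪ E , 𝒜-∪ d e , ≤-trans (out-mono (△-∪ A B D E)) (≤-trans (out-∪ (A △ D) (B △ E)) (≤-trans (+-mono-≤ p q) (≤-reflexive (half ε))))

  good-∩ : ∀ {A B} → Good A → Good B → Good (A ∩ B)
  good-∩ {A} {B} g h = good-resp ((λ ¬p → dne (λ ¬a → ¬p (inj₁ λ a → ¬a a)) , dne (λ ¬b → ¬p (inj₂ λ b → ¬b b))) , λ (a , b) → [ (λ ¬a → ¬a a) , (λ ¬b → ¬b b) ]′)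
    (good-∁ (good-∪ (good-∁ g) (good-∁ h)))

  𝒜⇒Good : ∀ {A} → 𝒜 A → Good A
  𝒜⇒Good {A} α ε 0<ε = A , α , ≤-trans (≤-reflexive (trans (out-cong (nothing′ , nothing″)) (out-𝒜 (𝒜-⋃< 0 {λ _ → A} λ _ → α)))) (≤-trans (m-⋃< 0 (λ _ → A)) (<⇒≤ 0<ε))
    where
    nothing′ : ∀ {x} → (A △ A) x → ⋃< 0 (λ _ → A) x
    nothing′ (inj₁ (a , ¬a)) = ⊥-elim (¬a a)
    nothing′ (inj₂ (a , ¬a)) = ⊥-elim (¬a a)
    nothing″ : ∀ {x} → ⋃< 0 (λ _ → A) x → (A △ A) x
    nothing″ (_ , () , _)

  -- With A, B approximated by D, E up to ε: m(D ∩ E) ≤ 2ε as A and B are disjoint.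
  out-additive : ∀ {A B} → Good A → Good B → A ⊥′ B → out (A ∪ B) ≡ out A + out B
  out-additive {A} {B} g h dis = ≤-antisym (out-∪ A B) (≤-limit λ ε 0<ε → let
      η = ½ * (½ * (½ * ε))
      0<η = half-pos (half-pos (half-pos 0<ε))
      (D , d , p) = g η 0<η
      (E , e , q) = h η 0<η
      approx : ∀ {A B C} → A ⊑ B ∪ C → out C ≤ η → out A ≤ out B + η
      approx {A} {B} {C} sub c = ≤-trans (out-mono sub) (≤-trans (out-∪ B C) (+-monoʳ-≤ (out B) c))
      bound : out D + out E ≤ (out (A ∪ B) + (η + η)) + (η + η)
      bound = ≤-trans (≤-reflexive (trans (cong₂ _+_ (out-𝒜 d) (out-𝒜 e)) (modular D E))) (+-mono-≤
        (≤-trans (≤-reflexive (sym (out-𝒜 (𝒜-∪ d e)))) (≤-trans (out-mono (λ x → [ (λ z → [ inj₁ ∘ inj₁ , inj₂ ∘ inj₁ ]′ (⊒-△ A D x z)) , (λ z → [ inj₁ ∘ inj₂ , inj₂ ∘ inj₂ ]′ (⊒-△ B E x z)) ]′))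
          (≤-trans (out-∪ (A ∪ B) (A △ D ∪ B △ E)) (+-monoʳ-≤ _ (≤-trans (out-∪ (A △ D) (B △ E)) (+-mono-≤ p q))))))
        (≤-trans (≤-reflexive (sym (out-𝒜 (𝒜-∩ d e)))) (≤-trans (out-mono (λ x (u , v) →
            [ (λ a → [ (λ b → ⊥-elim (dis x (a , b))) , inj₂ ]′ (⊒-△ B E x v)) , inj₁ ]′ (⊒-△ A D x u)))
          (≤-trans (out-∪ (A △ D) (B △ E)) (+-mono-≤ p q)))))
    in ≤-trans (+-mono-≤ (approx (⊑-△ A D) p) (approx (⊑-△ B E) q)) (≤-trans (≤-reflexive (solve 3 (λ x y z → x :+ z :+ (y :+ z) := x :+ y :+ (z :+ z)) refl (out D) (out E) η))
         (≤-trans (+-monoˡ-≤ (η + η) bound) (≤-trans (≤-reflexive (solve 2 (λ x z → x :+ (z :+ z) :+ (z :+ z) :+ (z :+ z) := x :+ ((z :+ z) :+ (z :+ z) :+ (z :+ z))) refl (out (A ∪ B)) η))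
           (+-monoʳ-≤ (out (A ∪ B)) (six ε 0<ε))))))
    where
    𝒜-∩ : ∀ {D E} → 𝒜 D → 𝒜 E → 𝒜 (D ∩ E)
    𝒜-∩ d e = 𝒜-resp (𝒜-∁ (𝒜-∪ (𝒜-∁ d) (𝒜-∁ e))) ((λ ¬p → dne (λ ¬a → ¬p (inj₁ λ a → ¬a a)) , dne (λ ¬b → ¬p (inj₂ λ b → ¬b b))) , λ (a , b) → [ (λ ¬a → ¬a a) , (λ ¬b → ¬b b) ]′)
    six : ∀ ε → 0# < ε → let η = ½ * (½ * (½ * ε)) in η + η + (η + η) + (η + η) ≤ ε
    six ε 0<ε = ≤-trans (≤-+-nonNeg (+-nonNeg (<⇒≤ 0<η) (<⇒≤ 0<η))) (≤-reflexive (trans (+-assoc (η + η + (η + η)) (η + η) (η + η))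
      (trans (cong (λ z → z + z + (z + z)) (half (½ * (½ * ε)))) (trans (cong (λ z → z + z) (half (½ * ε))) (half ε)))))
      where
      η = ½ * (½ * (½ * ε))
      0<η = half-pos (half-pos (half-pos 0<ε))

  out-≤1 : ∀ A → out A ≤ 1#
  out-≤1 A = ≤-trans (out-mono {B = U} λ _ _ → _) (≤-reflexive (trans (out-𝒜 𝒜-U) total))

  good-⋃< : ∀ n {F} → (∀ j → Good (F j)) → Good (⋃< n F)
  good-⋃< zero    {F} g = 𝒜⇒Good (𝒜-resp (𝒜-∁ 𝒜-U) ((λ p → ⊥-elim (p _)) , λ ()))
  good-⋃< (suc n) {F} g = good-resp (proj₂ (⋃<-suc n F) , proj₁ (⋃<-suc n F)) (good-∪ (good-⋃< n g) (g n))

  Disjoint : (ℕ → Pred X ℓ) → Set ℓ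
  Disjoint F = ∀ i j → i ≢ j → F i ⊥′ F j

  out-⋃< : ∀ n {F} → (∀ j → Good (F j)) → Disjoint F → out (⋃< n F) ≡ ∑< n (λ j → out (F j))
  out-⋃< zero    {F} g dis = ≤-antisym (≤-trans (≤-reflexive (out-𝒜 (𝒜-resp (𝒜-∁ 𝒜-U) ((λ p → ⊥-elim (p _)) , λ ())))) (m-⋃< 0 F)) (out-nonNeg _)
  out-⋃< (suc n) {F} g dis = trans (out-cong (⋃<-suc n F)) (trans (out-additive (good-⋃< n g) (g n)
    λ x ((j , j<n , p) , q) → dis j n (ℕ.<⇒≢ j<n) x (p , q)) (cong (_+ out (F n)) (out-⋃< n g dis)))

  later : ℕ → (ℕ → Pred X ℓ) → Pred X ℓ
  later N F = ⋃ ℕ (λ i → F (N ℕ.+ i))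

  ⋃-split : ∀ N F → ⋃ ℕ F ⊑ ⋃< N F ∪ later N F
  ⋃-split N F x (i , p) with i ℕ.<? N
  ... | yes i<N = inj₁ (i , i<N , p)
  ... | no i≮N  = inj₂ (i ℕ.∸ N , subst (λ j → F j x) (sym (ℕ.m+[n∸m]≡n (ℕ.≮⇒≥ i≮N))) p)

  -- The partial sums are bounded by 1. Once one of them comes within `ε` of their supremum, every
  -- block of later terms sums to at most `ε`, and `out-⋃` bounds the tail.
  tail-small : ∀ F → (∀ j → Good (F j)) → Disjoint F → ∀ ε → 0# < ε → ∃[ N ] out (later N F) ≤ ε
  tail-small F g dis ε 0<ε with supremum (λ r → ∃[ n ] r ≡ ∑< n (λ j → out (F j))) (0# , 0 , refl)
    (1# , λ { _ (n , refl) → ≤-trans (≤-reflexive (sym (out-⋃< n g dis))) (out-≤1 _) })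
  ... | s , ub , least = dne λ none → <⇒≱ 0<ε (+-cancelʳ-≤ (s - ε) (subst₂ _≤_
      (solve 2 (λ s e → s := e :+ (s :- e)) refl s ε) (solve 2 (λ s e → s :- e := con (ℤ.+ 0) :+ (s :- e)) refl s ε)
      (least (s - ε) λ { _ (N , refl) → ≰⇒≥ λ p → none (N , out-⋃ (λ i → F (N ℕ.+ i)) λ n → close N n p) })))
    where
    close : ∀ N n → s - ε ≤ ∑< N (λ j → out (F j)) → ∑< n (λ i → out (F (N ℕ.+ i))) ≤ ε
    close N n p = +-cancelʳ-≤ (s - ε) (≤-trans (+-monoʳ-≤ _ p) (≤-trans (≤-reflexive (trans (+-comm _ _) (sym (∑<-split N n (λ j → out (F j))))))
      (≤-trans (ub _ (N ℕ.+ n , refl)) (≤-reflexive (solve 2 (λ s e → s := e :+ (s :- e)) refl s ε)))))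

  -- Made disjoint, the union is a finite union up to a tail of size at most half of `ε`, and that
  -- finite union is approximated within the other half.
  good-⋃ : ∀ F → (∀ j → Good (F j)) → Good (⋃ ℕ F)
  good-⋃ F g ε 0<ε = let
      B = fresh F
      gB : ∀ j → Good (B j)
      gB j = good-∩ (g j) (good-∁ (good-⋃< j g))
      (N , small) = tail-small B gB (fresh-disjoint F) (½ * ε) (half-pos 0<ε)
      (D , d , p) = good-⋃< N gB (½ * ε) (half-pos 0<ε)
    in D , d , ≤-trans (out-mono (△-trans (⋃ ℕ F) (⋃< N B) D)) (≤-trans (out-∪ (⋃ ℕ F △ ⋃< N B) (⋃< N B △ D))
         (≤-trans (+-mono-≤ (≤-trans (out-mono (rest N)) small) p) (≤-reflexive (half ε))))
    where
    rest : ∀ N → ⋃ ℕ F △ ⋃< N (fresh F) ⊑ later N (fresh F)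
    rest N x (inj₁ (p , ¬q)) = [ (λ q → ⊥-elim (¬q q)) , id ]′ (⋃-split N (fresh F) x (proj₂ (⋃-fresh F) p))
    rest N x (inj₂ ((j , _ , q , _) , ¬p)) = ⊥-elim (¬p (j , q))

  out-σ-additive : ∀ F → (∀ j → Good (F j)) → Disjoint F → ConvergesTo (λ n → ∑< n (λ j → out (F j))) (out (⋃ ℕ F))
  -- The tail is bounded by half of `ε` because convergence asks for strict inequalities.
  out-σ-additive F g dis ε 0<ε = let (N , small) = tail-small F g dis (½ * ε) (half-pos 0<ε) in N , λ n N≤n →
      (let total≤ : out (⋃ ℕ F) ≤ ∑< n (λ j → out (F j)) + ½ * ε
           total≤ = ≤-trans (out-mono (⋃-split N F)) (≤-trans (out-∪ (⋃< N F) (later N F)) (+-mono-≤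
             (≤-trans (out-mono {B = ⋃< n F} (λ x (j , j<N , p) → j , ℕ.<-≤-trans j<N N≤n , p)) (≤-reflexive (out-⋃< n g dis))) small))
       in ≤-<-trans (subst (out (⋃ ℕ F) - ε ≤_) (rearrange (∑< n (λ j → out (F j))) ε) (+-monoˡ-≤ (- ε) total≤)) (minus (∑< n (λ j → out (F j))) 0<ε))
    , ≤-<-trans (≤-trans (≤-reflexive (sym (out-⋃< n g dis))) (out-mono λ x (j , _ , p) → j , p)) (plus _ 0<ε)
    where
    plus : ∀ x {ε} → 0# < ε → x < x + ε
    plus x {ε} p = subst₂ _<_ (+-identityˡ x) (+-comm ε x) (+-monoˡ-< x p)
    rearrange : ∀ x ε → x + ½ * ε - ε ≡ x - ½ * ε
    rearrange x ε = trans (cong (λ e → x + ½ * ε - e) (sym (half ε))) (solve 2 (λ x h → x :+ h :- (h :+ h) := x :- h) refl x (½ * ε))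
    minus : ∀ x {ε} → 0# < ε → x - ½ * ε < x
    minus x {ε} p = subst (x - ½ * ε <_) (solve 2 (λ x h → x :- h :+ h := x) refl x (½ * ε)) (plus (x - ½ * ε) (half-pos p))

  measurable⇒Good : ∀ {D} → D ∈ ⟨ 𝒜 ⟩ → Good D
  measurable⇒Good (generator d)  = 𝒜⇒Good d
  measurable⇒Good (complement d) = good-∁ (measurable⇒Good d)
  measurable⇒Good (union {D} d)  = good-⋃ D λ i → measurable⇒Good (d i)
  measurable⇒Good (resp-≐ eq d)  = good-resp eq (measurable⇒Good d)

  out-pullback : (f : X → X) → (∀ {D} → 𝒜 D → 𝒜 (D ∘ f)) → (∀ D → m (D ∘ f) ≡ m D) → ∀ A → out (A ∘ f) ≤ out A
  out-pullback f 𝒜-f m-f A = out-greatest λ r (D , d , inc , cov , b) →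
    out-≤ ((λ i → D i ∘ f) , (λ i → 𝒜-f (d i)) , (λ i x → inc i (f x)) , (λ x → cov (f x)) , λ i → ≤-trans (≤-reflexive (m-f (D i))) (b i))

-- An invariant measure of positive entropy from IP

module PositiveEntropy (em : ∀ {a} → ExcludedMiddle a) (ext : ∀ {a b} → Extensionality a b) (𝓡 : RealNumbers)
  {ℓ} {L : Language ℓ} (M : Structure L) (saturated : IsSaturated M)
  (uncountable : ¬ (Σ[ f ∈ (Structure.Domain M → ℕ) ] Injective _≡_ _≡_ f))
  {n} (φ : Formula L (1 ℕ.+ n)) (ip : Logic.IPIn em {L = L} {1} φ M) (k : ℕ) where
  open Classical em
  open Cardinal em ext using (code; code-injective)
  open Logic em {L = L}
  open Definable
  open Structure M using (Domain)
  open Equivalence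
  open Parameters M
  open Saturation em ext M saturated uncountable
  open Sequences em ext M saturated uncountable
  open Homogeneity em ext M saturated uncountable
  open Reals em 𝓡
  open Analysis em 𝓡
  open UltraLimit em ext 𝓡

  private
    open Coheir (proj₁ (shatteredSequence {1} φ ip))

    c-shattered : ShattersSequence {1} φ c
    c-shattered = coheir-shattered {1} φ (proj₂ (shatteredSequence {1} φ ip))

    -- The shift goes downwards so that `Event j` at the image of `x` is `Event (suc j)` at `x`:
    -- preimages under iterates of σ give the later events.
    Shift : Relation
    Shift x y = ∃[ i ] ∃[ t ] lookup (c (suc i)) t ≡ x × lookup (c i) t ≡ y

    bound : ∀ j (f : Fin j → ℕ) → ∃[ r ] (∀ p → f p ℕ.< r)
    bound zero    f = 0 , λ ()
    bound (suc j) f = let (r , h) = bound j (f ∘ suc) in suc (f zero) ℕ.+ r ,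
      λ { zero → ℕ.m≤m+n (suc (f zero)) r ; (suc p) → ℕ.<-≤-trans (h p) (ℕ.m≤n+m r (suc (f zero))) }

    -- Finitely many related pairs involve only indices below some `r`, and the first `r` terms of
    -- the sequence satisfy the same formulas as the `r` terms starting at index 1.
    shift-elementary : Elementary Shift
    shift-elementary = elementary λ j v w h θ s → let
        (r , i<r) = bound j (λ p → proj₁ (h p))
        ρ : Vec (Fin (r ℕ.* n)) j
        ρ = Vec.tabulate λ p → combine (downIndex r (proj₁ (h p)) (i<r p)) (proj₁ (proj₂ (h p)))
        at : ∀ (f : ℕ → Vec Domain n) (u : Vec Domain j) → (∀ p → lookup (f (proj₁ (h p))) (proj₁ (proj₂ (h p))) ≡ lookup u p) →
          sel ρ (Vec.concat (down f r)) ≡ u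
        at f u eq = sel-tabulate _ (Vec.concat (down f r)) u λ p →
          trans (Vec.lookup-concat (down f r) _ _) (trans (cong (λ y → lookup y (proj₁ (proj₂ (h p)))) (down-lookup f r (proj₁ (h p)) (i<r p))) (eq p))
      in subst (Sat M θ) (at c w λ p → proj₂ (proj₂ (proj₂ (h p))))
           (indiscernible (def-sel (by-formula θ) ρ) (Inc-down 1 r) (Inc-down 0 r)
             (subst (Sat M θ) (sym (at (λ i → c (suc i)) v λ p → proj₁ (proj₂ (proj₂ (h p))))) s))

    shift-range : Countable (Range Shift)
    shift-range = (λ y (x , i , t , _) → code i (toℕ t)) , inj
      where
      inj : ∀ {x y} (p : Range Shift x) (q : Range Shift y) → _ → x ≡ y
      inj (_ , i , t , _ , refl) (_ , j , u , _ , refl) eq =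
        let (i≡j , t≡u) = code-injective eq in cong₂ (λ i t → lookup (c i) t) i≡j (Fin.toℕ-injective t≡u)

    shift-domain : Countable (Range (flip Shift))
    shift-domain = (λ y (x , i , t , _) → code i (toℕ t)) , inj
      where
      inj : ∀ {x y} (p : Range (flip Shift) x) (q : Range (flip Shift) y) → _ → x ≡ y
      inj (_ , i , t , refl , _) (_ , j , u , refl , _) eq =
        let (i≡j , t≡u) = code-injective eq in cong₂ (λ i t → lookup (c (suc i)) t) i≡j (Fin.toℕ-injective t≡u)

    module Ext = Extension Shift shift-elementary shift-range shift-domain

  abstract
    σ : Automorphism M
    σ = Ext.automorphism

    σ-shift : ∀ i → Vec.map (Automorphism.to σ) (c (suc i)) ≡ c i
    σ-shift i = trans (sym (Vec.tabulate∘lookup _)) (trans (Vec.tabulate-cong λ t → trans (Vec.lookup-map t _ (c (suc i))) (Ext.extends-R (i , t , refl , refl))) (Vec.tabulate∘lookup (c i)))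

  open Action σ

  private
    X : Set ℓ
    X = Vec Domain (suc k)
    g h : X → X
    g = Vec.map (Automorphism.to σ)
    h = Vec.map (Automorphism.from σ)

  open Charge em ext 𝓡 X
  open IsCharge
  open FiniteUnions em {X = X}

  -- The formula has one object variable, so the event depends on the first coordinate only; the
  -- other `k` are padding.
  Event : ℕ → Subset M (suc k)
  Event i x = Sat M φ (Vec.head x ∷ c i)

  Event-def : ∀ i → Def M (suc k) (Event i)
  Event-def i = record { formula = formula d ; params = c i } ,
      (λ {x} s → from (correct d M (x ++ c i)) (subst (Sat M φ) (sym (at x)) s)) , (λ {x} s → subst (Sat M φ) (at x) (to (correct d M (x ++ c i)) s))
    where
    ρ : Vec (Fin (suc k ℕ.+ n)) (1 ℕ.+ n)
    ρ = zero ∷ right (suc k) n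
    d : Definable (λ N v → Sat N φ (sel ρ v))
    d = def-sel (by-formula φ) ρ
    at : ∀ (x : X) → sel ρ (x ++ c i) ≡ Vec.head x ∷ c i
    at (y ∷ x) = cong (y ∷_) (sel-right (y ∷ x) (c i))

  Event-σ : ∀ j x → Event j (g x) ⇔ Event (suc j) x
  Event-σ j (y ∷ x) = subst (λ u → Sat M φ (Automorphism.to σ y ∷ u) ⇔ Sat M φ (y ∷ c (suc j))) (σ-shift j)
    (mk⇔ (from (sat-σ φ (y ∷ c (suc j)))) (to (sat-σ φ (y ∷ c (suc j)))))

  Event-σ^ : ∀ i j x → Event j (fold x g i) ⇔ Event (i ℕ.+ j) x
  Event-σ^ zero    j x = mk⇔ id id
  Event-σ^ (suc i) j x = subst (λ l → Event j (g (fold x g i)) ⇔ Event l x) (ℕ.+-suc i j)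
    (mk⇔ (to (Event-σ^ i (suc j) x) ∘ to (Event-σ j (fold x g i))) (from (Event-σ j (fold x g i)) ∘ from (Event-σ^ i (suc j) x)))

  realisation : (ℕ → Bool) → X
  realisation s = Vec.head (proj₁ (c-shattered s)) ∷ Vec.replicate k (Vec.head (proj₁ (c-shattered s)))

  realisation-event : ∀ s i → Event i (realisation s) is s i
  realisation-event s = uncons (proj₁ (c-shattered s)) (proj₂ (c-shattered s))
    where
    uncons : ∀ (a : Vec Domain 1) → (∀ i → Sat M φ (a ++ c i) is s i) → ∀ i → Sat M φ (Vec.head a ∷ c i) is s i
    uncons (x ∷ []) f = f

  infixr 5 _∷ˢ_
  _∷ˢ_ : Bool → (ℕ → Bool) → ℕ → Bool
  (b ∷ˢ s) zero    = b
  (b ∷ˢ s) (suc i) = s i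

  -- The expectation over N fair coin tosses, the remaining entries of the sequence being false.
  𝔼 : ℕ → ((ℕ → Bool) → ℝ) → ℝ
  𝔼 zero    f = f (λ _ → false)
  𝔼 (suc N) f = ½ * 𝔼 N (λ s → f (true ∷ˢ s)) + ½ * 𝔼 N (λ s → f (false ∷ˢ s))

  𝔼-cong : ∀ N {f f′} → (∀ s → f s ≡ f′ s) → 𝔼 N f ≡ 𝔼 N f′
  𝔼-cong zero    eq = eq _
  𝔼-cong (suc N) eq = cong₂ (λ x y → ½ * x + ½ * y) (𝔼-cong N λ s → eq _) (𝔼-cong N λ s → eq _)

  𝔼-const : ∀ N x → 𝔼 N (λ _ → x) ≡ x
  𝔼-const zero    x = refl
  𝔼-const (suc N) x = trans (cong (λ y → ½ * y + ½ * y) (𝔼-const N x)) (half x)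

  𝔼-isCharge : ∀ N (a : (ℕ → Bool) → X) → IsCharge (λ D → 𝔼 N (λ s → δ (a s) D))
  𝔼-isCharge zero    a = δ-isCharge (a λ _ → false)
  𝔼-isCharge (suc N) a = mix-isCharge (𝔼-isCharge N (λ s → a (true ∷ˢ s))) (𝔼-isCharge N (λ s → a (false ∷ˢ s)))

  Agrees : ℕ → ℕ → (ℕ → Bool) → (ℕ → Bool) → Set
  Agrees j r W s = ∀ i → i ℕ.< r → s (j ℕ.+ i) ≡ W i

  -- The hypothesis keeps the tested positions among the `N` tossed ones. The first `j` tosses
  -- average out, and each of the next `r` contributes a factor ½.
  𝔼-agrees : ∀ N j r W → j ℕ.+ r ℕ.≤ N → 𝔼 N (λ s → indicator ⌊ Agrees j r W s ⌋) ≡ ½ ^ r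
  𝔼-agrees N zero zero W p = trans (𝔼-cong N λ s → cong indicator (holds {P = Agrees 0 0 W s} λ _ ())) (𝔼-const N 1#)
  𝔼-agrees (suc N) zero (suc r) W (s≤s p) = trans
      (cong₂ (λ x y → ½ * x + ½ * y) (branch true) (branch false)) (combine′ (W 0))
    where
    value : Bool → Bool → ℝ
    value true  true  = ½ ^ r
    value false false = ½ ^ r
    value _     _     = 0#
    rest : ∀ b → b ≡ W 0 → ∀ s → ⌊ Agrees 0 (suc r) W (b ∷ˢ s) ⌋ ≡ ⌊ Agrees 0 r (W ∘ suc) s ⌋
    rest b eq s = ⌊⌋-cong (λ f i i<r → f (suc i) (s≤s i<r)) λ { f zero _ → eq ; f (suc i) (s≤s i<r) → f i i<r }
    same : ∀ b → b ≡ W 0 → 𝔼 N (λ s → indicator ⌊ Agrees 0 (suc r) W (b ∷ˢ s) ⌋) ≡ ½ ^ r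
    same b eq = trans (𝔼-cong N λ s → cong indicator (rest b eq s)) (𝔼-agrees N 0 r (W ∘ suc) p)
    other : ∀ b → b ≢ W 0 → 𝔼 N (λ s → indicator ⌊ Agrees 0 (suc r) W (b ∷ˢ s) ⌋) ≡ 0#
    other b ne = trans (𝔼-cong N λ s → cong indicator (fails λ f → ne (f 0 (s≤s z≤n)))) (𝔼-const N 0#)
    branch : ∀ b → 𝔼 N (λ s → indicator ⌊ Agrees 0 (suc r) W (b ∷ˢ s) ⌋) ≡ value b (W 0)
    branch b with W 0 in eq
    branch true  | true  = same true (sym eq)
    branch true  | false = other true λ e → case trans e eq of λ ()
    branch false | true  = other false λ e → case trans e eq of λ ()
    branch false | false = same false (sym eq)
    combine′ : ∀ b → ½ * value true b + ½ * value false b ≡ ½ ^ suc r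
    combine′ true  = trans (cong (½ * ½ ^ r +_) (zeroʳ ½)) (+-identityʳ _)
    combine′ false = trans (cong (_+ ½ * ½ ^ r) (zeroʳ ½)) (+-identityˡ _)
  𝔼-agrees (suc N) (suc j) r W (s≤s p) = trans
    (cong₂ (λ x y → ½ * x + ½ * y) (𝔼-agrees N j r W p) (𝔼-agrees N j r W p)) (half _)

  -- The distribution of the chosen realisation of a random pattern, in the limit of many tosses. It
  -- need not be invariant, since the choice of realisations does not commute with σ.
  ν : Subset M (suc k) → ℝ
  ν D = Lim (λ N → 𝔼 N (λ s → δ (realisation s) D))

  ν-isCharge : IsCharge ν
  ν-isCharge = Lim-isCharge λ N → 𝔼-isCharge N realisation

  Cell : ℕ → (ℕ → Bool) → Subset M (suc k)
  Cell r W x = ∀ i → i ℕ.< r → Event i x is W i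

  is-cong : ∀ {a} {P : Set a} {s b : Bool} → P is s → ((P is b) ⇔ (s ≡ b))
  is-cong {P = P} {s} {b} p = mk⇔ (λ q → ≡-bool (to q ∘ from p) (to p ∘ from q)) λ { refl → p }

  ν-cell : ∀ r W j → ν (preimage^ σ j (Cell r W)) ≡ ½ ^ r
  ν-cell r W j = lim-unique (Lim-isLim (_ , limit)) limit
    where
    agree : ∀ s → ⌊ preimage^ σ j (Cell r W) (realisation s) ⌋ ≡ ⌊ Agrees j r W s ⌋
    agree s = ⌊⌋-cong
      (λ f i p → to (is-cong (realisation-event s (j ℕ.+ i))) (is-resp (Event-σ^ j i (realisation s)) (f i p)))
      (λ f i p → is-resp (mk⇔ (from (Event-σ^ j i (realisation s))) (to (Event-σ^ j i (realisation s)))) (from (is-cong (realisation-event s (j ℕ.+ i))) (f i p)))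
    limit : IsLim (λ N → 𝔼 N (λ s → δ (realisation s) (preimage^ σ j (Cell r W)))) (½ ^ r)
    limit = lim-eventually (j ℕ.+ r) λ N p → trans (𝔼-cong N λ s → cong indicator (agree s)) (𝔼-agrees N j r W p)

  iterate-isCharge : ∀ j → IsCharge (λ D → ν (preimage^ σ j D))
  iterate-isCharge zero    = ν-isCharge
  iterate-isCharge (suc j) = pullback-isCharge g (iterate-isCharge j)

  -- By `ν-cell` all terms of the average agree on cells, so averaging does not change the values
  -- there.
  μ₀ : Subset M (suc k) → ℝ
  μ₀ D = Lim (λ N → average N (λ j D → ν (preimage^ σ j D)) D)

  μ₀-isCharge : IsCharge μ₀
  μ₀-isCharge = Lim-isCharge λ N → average-isCharge N iterate-isCharge

  μ₀-cell : ∀ r W → μ₀ (Cell r W) ≡ ½ ^ r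
  μ₀-cell r W = lim-unique (Lim-isLim (_ , limit)) limit
    where
    limit : IsLim (λ N → average N (λ j D → ν (preimage^ σ j D)) (Cell r W)) (½ ^ r)
    limit = lim-eventually 0 λ N _ → trans (cong (fromℕ (suc N) ⁻¹ *_) (trans (∑<-cong (suc N) λ j _ → ν-cell r W j) (∑<-const (suc N) (½ ^ r))))
      (trans (sym (*-assoc _ _ _)) (trans (cong (_* ½ ^ r) (trans (*-comm _ _) (*-inverse (fromℕ-pos N)))) (*-identityˡ _)))

  lim-1/n : IsLim (λ N → fromℕ (suc N) ⁻¹) 0#
  lim-1/n = isLim λ ε 0<ε → let (N , p) = archimedean (ε ⁻¹) in Ultrafilter.∀ᵁ-eventually em ext N λ n N≤n →
      +-nonNeg (<⇒≤ (⁻¹-pos (fromℕ-pos n))) (<⇒≤ 0<ε)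
    , subst (fromℕ (suc n) ⁻¹ ≤_) (sym (+-identityˡ ε)) (*-cancelˡ-≤ (fromℕ-pos n) (subst (_≤ fromℕ (suc n) * ε) (sym (*-inverse (fromℕ-pos n)))
        (subst₂ _≤_ (*-inverse 0<ε) (*-comm ε _) (*-monoˡ-≤ (<⇒≤ 0<ε) (≤-trans (<⇒≤ p) (fromℕ-mono (ℕ.m≤n⇒m≤1+n N≤n)))))))

  private
    telescope : ∀ (f : ℕ → ℝ) N → ∑< N (f ∘ suc) + f 0 ≡ ∑< N f + f N
    telescope f zero    = refl
    telescope f (suc N) = trans (solve 3 (λ a b c → a :+ b :+ c := a :+ c :+ b) refl (∑< N (f ∘ suc)) (f (suc N)) (f 0)) (cong (_+ f (suc N)) (telescope f N))

  -- Averages over the windows [0, N] and [1, N + 1] differ by at most 1/(N + 1).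
  μ₀-invariant : ∀ D → μ₀ (D ∘ g) ≡ μ₀ D
  μ₀-invariant D = ≤-antisym
      (subst (μ₀ (D ∘ g) ≤_) (+-identityʳ _) (lim-≤ (lim (D ∘ g)) (lim-+ (lim D) lim-1/n) (everywhere λ N → near N (f ∘ suc) f (telescope f (suc N)) (nonNeg ν-isCharge D) (≤1 (iterate-isCharge (suc N)) D))))
      (subst (μ₀ D ≤_) (+-identityʳ _) (lim-≤ (lim D) (lim-+ (lim (D ∘ g)) lim-1/n) (everywhere λ N → near N f (f ∘ suc) (sym (telescope f (suc N))) (nonNeg (iterate-isCharge (suc N)) D) (≤1 ν-isCharge D))))
    where
    f : ℕ → ℝ
    f j = ν (preimage^ σ j D)
    avg : ℕ → Subset M (suc k) → ℝ
    avg N = average N (λ j D → ν (preimage^ σ j D))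
    lim : ∀ D → IsLim (λ N → avg N D) (μ₀ D)
    lim D = Lim-isLim (lim-exists (λ N → avg N D) (λ N → nonNeg (average-isCharge N iterate-isCharge) D) (λ N → ≤1 (average-isCharge N iterate-isCharge) D))
    everywhere : ∀ {P : ℕ → Set} → (∀ n → P n) → Ultrafilter.∀ᵁ em ext P
    everywhere h = Ultrafilter.∀ᵁ-eventually em ext 0 λ n _ → h n
    near : ∀ N (f f′ : ℕ → ℝ) {x y} → ∑< (suc N) f + x ≡ ∑< (suc N) f′ + y → 0# ≤ x → y ≤ 1# →
      fromℕ (suc N) ⁻¹ * ∑< (suc N) f ≤ fromℕ (suc N) ⁻¹ * ∑< (suc N) f′ + fromℕ (suc N) ⁻¹
    near N f f′ {x} {y} eq 0≤x y≤1 = ≤-trans (*-monoˡ-≤ (<⇒≤ (⁻¹-pos (fromℕ-pos N)))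
      (≤-trans (≤-+-nonNeg 0≤x) (≤-trans (≤-reflexive eq) (+-monoʳ-≤ (∑< (suc N) f′) y≤1))))
      (≤-reflexive (trans (distribˡ _ _ _) (cong (fromℕ (suc N) ⁻¹ * ∑< (suc N) f′ +_) (*-identityʳ _))))

  open OuterMeasure em ext 𝓡 (Def M (suc k)) Def-U Def-∁ Def-∪ Def-resp compactness μ₀ μ₀-isCharge

  measure : Measure 𝓡 M (suc k)
  measure = record
    { μ          = out
    ; isKeisler  = record
      { cong     = λ _ _ → out-cong
      ; nonNeg   = λ _ → out-nonNeg _
      ; total    = trans (out-𝒜 Def-U) (total μ₀-isCharge)
      ; additive = λ d e → out-additive (𝒜⇒Good d) (𝒜⇒Good e)
      }
    ; cong       = λ _ _ → out-cong
    ; nonNeg     = λ _ → out-nonNeg _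
    ; σ-additive = λ D d → out-σ-additive D (λ i → measurable⇒Good (d i))
    }

  -- The image of `D` is its preimage under the inverse `h`. `out-pullback` gives only an
  -- inequality, so it is used once for `h` and once for `g`.
  measure-invariant : IsInvariant 𝓡 σ measure
  measure-invariant D _ = trans (out-cong ((λ { (x , p , refl) → subst D (sym (map-hg x)) p }) , λ {y} p → h y , p , map-gh y))
    (≤-antisym (out-pullback h Def-pushforward (λ E → trans (sym (μ₀-invariant (E ∘ h))) (m-cong μ₀-isCharge ((λ {x} → subst E (map-hg x)) , λ {x} → subst E (sym (map-hg x))))) D)
      (≤-trans (≤-reflexive (out-cong ((λ {x} → subst D (sym (map-hg x))) , λ {x} → subst D (map-hg x)))) (out-pullback g Def-pullback μ₀-invariant (D ∘ h))))

  partition : Fin 2 → Subset M (suc k)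
  partition zero       = Event 0
  partition (suc zero) = ∁ (Event 0)

  bit : Fin 2 → Bool
  bit zero       = true
  bit (suc zero) = false

  partition-is : ∀ q x → partition q x ⇔ (Event 0 x is bit q)
  partition-is zero       x = mk⇔ (λ p → mk⇔ (λ _ → refl) λ _ → p) (λ e → from e refl)
  partition-is (suc zero) x = mk⇔ (λ ¬p → mk⇔ (⊥-elim ∘ ¬p) λ ()) (λ e p → case to e p of λ ())

  partition-def : ∀ q → Def M (suc k) (partition q)
  partition-def zero       = Event-def 0
  partition-def (suc zero) = Def-∁ (Event-def 0)

  partition-measurable : IsMeasurablePartition {M = M} partition
  partition-measurable = record
    { measurable = λ q → generator (partition-def q)
    ; disjoint   = λ { zero zero ne → ⊥-elim (ne refl) ; zero (suc zero) _ x (p , ¬p) → ¬p p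
                     ; (suc zero) zero _ x (¬p , p) → ¬p p ; (suc zero) (suc zero) ne → ⊥-elim (ne refl) }
    ; covers     = cover
    }
    where
    cover : ∀ x → ∃[ q ] x ∈ partition q
    cover x with em {P = Event 0 x}
    ... | yes p = zero , p
    ... | no ¬p = suc zero , ¬p

  preimage-def : ∀ i {D : Subset M (suc k)} → Def M (suc k) D → Def M (suc k) (preimage^ σ i D)
  preimage-def zero    d = d
  preimage-def (suc i) d = preimage-def i (Def-pullback d)

  join-def : ∀ r q → Def M (suc k) (iteratedJoin σ partition r q)
  join-def zero    q = Def-U
  join-def (suc r) q = Def-∩ (preimage-def r (partition-def (proj₁ (remQuot {2} (2 ℕ.^ r) q)))) (join-def r (proj₂ (remQuot {2} (2 ℕ.^ r) q)))

  -- `iteratedJoin` keeps the latest time in its first factor, so that factor determines the bit at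
  -- position `r`.
  decode : ∀ r → Fin (2 ℕ.^ r) → ℕ → Bool
  decode zero    q i = true
  decode (suc r) q i = if ⌊ i ≡ r ⌋ then bit (proj₁ (remQuot {2} (2 ℕ.^ r) q)) else decode r (proj₂ (remQuot {2} (2 ℕ.^ r) q)) i

  join-cell : ∀ r q → iteratedJoin σ partition r q ≐ Cell r (decode r q)
  join-cell zero    q = (λ _ _ ()) , λ _ → _
  join-cell (suc r) q = (λ {x} (p , j) i → forward x p j i) , λ {x} f →
      from (partition-is b (fold x g r)) (is-resp (sym⇔ (Event-σ^ r 0 x)) (subst₂ (λ l b → Event l x is b) (sym (ℕ.+-identityʳ r)) (at-r refl) (f r ℕ.≤-refl)))
    , proj₂ (join-cell r q′) λ i i<r → subst (Event i x is_) (off-r (ℕ.<⇒≢ i<r)) (f i (ℕ.m<n⇒m<1+n i<r))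
    where
    b : Fin 2
    b = proj₁ (remQuot {2} (2 ℕ.^ r) q)
    q′ : Fin (2 ℕ.^ r)
    q′ = proj₂ (remQuot {2} (2 ℕ.^ r) q)
    sym⇔ : ∀ {A B : Set ℓ} → A ⇔ B → B ⇔ A
    sym⇔ e = mk⇔ (from e) (to e)
    at-r : ∀ {i} → i ≡ r → decode (suc r) q i ≡ bit b
    at-r {i} eq rewrite holds eq = refl
    off-r : ∀ {i} → i ≢ r → decode (suc r) q i ≡ decode r q′ i
    off-r ne rewrite fails ne = refl
    forward : ∀ x → partition b (fold x g r) → iteratedJoin σ partition r q′ x → Cell (suc r) (decode (suc r) q) x
    forward x p j i (s≤s i≤r) with ℕ.m≤n⇒m<n∨m≡n i≤r
    ... | inj₁ i<r  = subst (Event i x is_) (sym (off-r (ℕ.<⇒≢ i<r))) (proj₁ (join-cell r q′) j i i<r)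
    ... | inj₂ refl = subst₂ (λ l b → Event l x is b) (ℕ.+-identityʳ r) (sym (at-r refl)) (is-resp (Event-σ^ r 0 x) (to (partition-is b (fold x g r)) p))

  join-measure : ∀ r q → out (iteratedJoin σ partition r q) ≡ ½ ^ r
  join-measure r q = trans (out-𝒜 (join-def r q)) (trans (m-cong μ₀-isCharge (join-cell r q)) (μ₀-cell r (decode r q)))

  module _ (log : ℝ → ℝ) (isLog : IsLogarithm log) where
    open Logarithm log isLog

    2^*½^ : ∀ r → fromℕ (2 ℕ.^ r) * ½ ^ r ≡ 1#
    2^*½^ zero    = trans (*-identityʳ _) (+-identityʳ 1#)
    2^*½^ (suc r) = trans (cong (_* (½ * ½ ^ r)) (fromℕ-* 2 (2 ℕ.^ r)))
      (trans (solve 4 (λ a b h p → a :* b :* (h :* p) := (a :* h) :* (b :* p)) refl (fromℕ 2) (fromℕ (2 ℕ.^ r)) ½ (½ ^ r))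
      (trans (cong₂ _*_ (trans (cong (_* ½) (cong (1# +_) (+-identityʳ 1#))) (*-inverse 0<2)) (2^*½^ r)) (*-identityʳ 1#)))

    join-entropy : ∀ r → H 𝓡 log measure (iteratedJoin σ partition r) ≡ fromℕ r * log 2#
    join-entropy r = trans (cong -_ (trans (∑Fin-cong λ q → cong (λ x → x * log x) (join-measure r q))
        (trans (∑Fin-const (2 ℕ.^ r) _) (trans (sym (*-assoc _ _ _)) (trans (cong (_* log (½ ^ r)) (2^*½^ r)) (*-identityˡ _))))))
      (trans (cong -_ (trans (log-^ 0<½ r) (cong (fromℕ r *_) (log-⁻¹ 0<2)))) (solve 2 (λ a b → :- (a :* (:- b)) := a :* b) refl (fromℕ r) (log 2#)))

    entropy-nonzero : ¬ IsEntropy 𝓡 log measure σ 0#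
    entropy-nonzero (hP , limits , ub , _) = <⇒≱ log2>0 (subst (_≤ 0#)
      (convergesTo-const 1 (limits P) value) (ub (hP P) (P , refl)))
      where
      P : FinitePartition M (suc k)
      P = 2 , partition , partition-measurable
      value : ∀ r → 1 ℕ.≤ r → fromℕ r ⁻¹ * H 𝓡 log measure (iteratedJoin σ partition r) ≡ log 2#
      value (suc r) _ = trans (cong (fromℕ (suc r) ⁻¹ *_) (join-entropy (suc r))) (trans (sym (*-assoc _ _ _))
        (trans (cong (_* log 2#) (trans (*-comm _ _) (*-inverse (fromℕ-pos r)))) (*-identityˡ _)))

-- The Sauer-Shelah lemma

module SauerShelah (em : ∀ {a} → ExcludedMiddle a) (ext : ∀ {a b} → Extensionality a b) where
  open Classical em

  Contains : ∀ {a} {A : Set a} → A → List A → Set a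
  Contains v = ListAny (v ≡_)

  ShattersAt : ∀ {a N} d → (Vec Bool N → Set a) → Set a
  ShattersAt {N = N} d F = Σ[ e ∈ (Fin d → Fin N) ] (∀ (S : Vec Bool d) → ∃[ v ] F v × (∀ i → lookup v (e i) ≡ lookup S i))

  -- A pattern v on the last N coordinates is listed once if it has one extension to all N + 1
  -- coordinates, and twice if it has two; the latter patterns shatter one set fewer.
  sauerShelah : ∀ {a} N d (F : Vec Bool N → Set a) → ¬ ShattersAt d F →
    Σ[ K ∈ List (Vec Bool N) ] List.length K ℕ.≤ suc N ℕ.^ d × (∀ v → F v → Contains v K)
  sauerShelah N zero F ¬sh = [] , z≤n , λ v f → ⊥-elim (¬sh ((λ ()) , λ S → v , f , λ ()))
  sauerShelah zero (suc d) F ¬sh = [] ∷ [] , ℕ.≤-reflexive (sym (ℕ.^-zeroˡ (suc d))) , λ { [] _ → here refl }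
  sauerShelah (suc N) (suc d) F ¬sh with
      sauerShelah N (suc d) (λ v → ∃[ b ] F (b ∷ v)) (λ (e , h) → ¬sh (suc ∘ e , λ S → let (v , (b , f) , k) = h S in b ∷ v , f , k))
    | sauerShelah N d (λ v → F (true ∷ v) × F (false ∷ v)) (λ (e , h) → ¬sh ((λ { zero → zero ; (suc i) → suc (e i) }) , λ
        { (true ∷ S)  → let (v , (f , _) , k) = h S in true ∷ v , f , λ { zero → refl ; (suc i) → k i }
        ; (false ∷ S) → let (v , (_ , f) , k) = h S in false ∷ v , f , λ { zero → refl ; (suc i) → k i } }))
  ... | K₁ , l₁ , c₁ | K₂ , l₂ , c₂ = List.map extend K₁ List.++ List.map (false ∷_) K₂ , bound , covers
    where
    extend : Vec Bool N → Vec Bool (suc N)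
    extend v = ⌊ F (true ∷ v) ⌋ ∷ v
    -- (N+1)^(d+1) + (N+1)^d = (N+2)·(N+1)^d, which is at most (N+2)^(d+1).
    bound : List.length (List.map extend K₁ List.++ List.map (false ∷_) K₂) ℕ.≤ suc (suc N) ℕ.^ suc d
    bound = subst (ℕ._≤ suc (suc N) ℕ.^ suc d) (sym (trans (List.length-++ (List.map extend K₁)) (cong₂ ℕ._+_ (List.length-map extend K₁) (List.length-map (false ∷_) K₂))))
      (ℕ.≤-trans (ℕ.+-mono-≤ l₁ l₂) (ℕ.≤-trans (ℕ.≤-reflexive (ℕ.+-comm (suc N ℕ.^ suc d) (suc N ℕ.^ d)))
        (ℕ.*-monoʳ-≤ (suc (suc N)) (ℕ.^-monoˡ-≤ d (ℕ.n≤1+n (suc N))))))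
    covers : ∀ v → F v → Contains v (List.map extend K₁ List.++ List.map (false ∷_) K₂)
    covers (true ∷ v) f = ListAny.++⁺ˡ (ListAny.map⁺ (ListAny.map (λ { refl → cong (_∷ v) (sym (holds f)) }) (c₁ v (true , f))))
    covers (false ∷ v) f with em {P = F (true ∷ v)}
    ... | yes t = ListAny.++⁺ʳ (List.map extend K₁) (ListAny.map⁺ (ListAny.map (cong (false ∷_)) (c₂ v (t , f))))
    ... | no ¬t = ListAny.++⁺ˡ (ListAny.map⁺ (ListAny.map (λ { refl → cong (_∷ v) (sym (fails ¬t)) }) (c₁ v (false , f))))

  length-cartesian : ∀ {a b c} {A : Set a} {B : Set b} {C : Set c} (f : A → B → C) xs ys →
    List.length (List.cartesianProductWith f xs ys) ≡ List.length xs ℕ.* List.length ys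
  length-cartesian f []       ys = refl
  length-cartesian f (x ∷ xs) ys = trans (List.length-++ (List.map (f x) ys)) (cong₂ ℕ._+_ (List.length-map (f x) ys) (length-cartesian f xs ys))

  total : ∀ m → (Fin m → ℕ) → ℕ
  total zero    d = 0
  total (suc m) d = d zero ℕ.+ total m (d ∘ suc)

  -- Combines the patterns of several sets. The lengths of the lists multiply, so the exponents over
  -- the common base `B` add up and the count stays polynomial in `B`.
  product : ∀ {a} {A : Set a} m (K : Fin m → List A) B (d : Fin m → ℕ) → (∀ c → List.length (K c) ℕ.≤ B ℕ.^ d c) →
    Σ[ Π ∈ List (Fin m → A) ] List.length Π ℕ.≤ B ℕ.^ total m d × (∀ f → (∀ c → Contains (f c) (K c)) → Contains f Π)
  product zero K B d l = (λ ()) ∷ [] , ℕ.≤-refl , λ f _ → here (ext λ ())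
  product {A = A} (suc m) K B d l with product m (K ∘ suc) B (d ∘ suc) (l ∘ suc)
  ... | Π , le , cov = List.cartesianProductWith cons (K zero) Π , bound , covers
    where
    cons : A → (Fin m → A) → Fin (suc m) → A
    cons x f zero    = x
    cons x f (suc c) = f c
    bound : List.length (List.cartesianProductWith cons (K zero) Π) ℕ.≤ B ℕ.^ total (suc m) d
    bound = subst₂ ℕ._≤_ (sym (length-cartesian cons (K zero) Π)) (sym (ℕ.^-distribˡ-+-* B (d zero) (total m (d ∘ suc)))) (ℕ.*-mono-≤ (l zero) le)
    covers : ∀ f → (∀ c → Contains (f c) (K c)) → Contains f (List.cartesianProductWith cons (K zero) Π)
    covers f h = ListAny.cartesianProductWith⁺ cons (λ p q → ext λ { zero → p ; (suc c) → cong (λ g → g c) q }) (h zero) (cov (f ∘ suc) (h ∘ suc))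

-- Invariant measures on the generated σ-algebra

module InvariantMeasure (em : ∀ {a} → ExcludedMiddle a) (𝓡 : RealNumbers) {ℓ} {L : Language ℓ} {M : Structure L} {k : ℕ}
  (σ : Automorphism M) (measure : Measure 𝓡 M k) (invariant : IsInvariant 𝓡 σ measure) where
  open Classical em
  open Logic em {L = L}
  open Parameters M
  open Action σ
  open Reals em 𝓡
  open Analysis em 𝓡
  open FiniteUnions em {X = Vec (Structure.Domain M) k}
  open Measure measure public using (μ)
  private
    module 𝓂 = Measure measure
    module 𝓀 = IsKeislerMeasure 𝓂.isKeisler
    X = Vec (Structure.Domain M) k

  g : X → X
  g = Vec.map (Automorphism.to σ)

  Measurable : Subset M k → Set (lsuc ℓ)
  Measurable D = D ∈ ⟨ Def M k ⟩

  meas-U : Measurable U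
  meas-U = generator Def-U

  ∅′ : Subset M k
  ∅′ = ∁ U

  meas-∅ : Measurable ∅′
  meas-∅ = complement meas-U

  pair : ∀ {a} {A : Set a} → A → A → A → ℕ → A
  pair x y z zero          = x
  pair x y z (suc zero)    = y
  pair x y z (suc (suc _)) = z

  pair-meas : ∀ {D E} → Measurable D → Measurable E → ∀ i → Measurable (pair D E ∅′ i)
  pair-meas d e zero          = d
  pair-meas d e (suc zero)    = e
  pair-meas d e (suc (suc _)) = meas-∅

  pair-⋃ : ∀ (D E : Subset M k) → ⋃ ℕ (pair D E ∅′) ≐ D ∪ E
  pair-⋃ D E = (λ { (zero , p) → inj₁ p ; (suc zero , p) → inj₂ p ; (suc (suc _) , p) → ⊥-elim (p _) }) ,
    [ (0 ,_) , (1 ,_) ]′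

  meas-∪ : ∀ {D E} → Measurable D → Measurable E → Measurable (D ∪ E)
  meas-∪ {D} {E} d e = resp-≐ (pair-⋃ D E) (union (pair-meas d e))

  meas-∩ : ∀ {D E} → Measurable D → Measurable E → Measurable (D ∩ E)
  meas-∩ d e = resp-≐ ((λ ¬p → dne (λ ¬a → ¬p (inj₁ λ a → ¬a a)) , dne (λ ¬b → ¬p (inj₂ λ b → ¬b b))) , λ (a , b) → [ (λ ¬a → ¬a a) , (λ ¬b → ¬b b) ]′)
    (complement (meas-∪ (complement d) (complement e)))

  meas-△ : ∀ {D E} → Measurable D → Measurable E → Measurable (D △ E)
  meas-△ d e = meas-∪ (meas-∩ d (complement e)) (meas-∩ e (complement d))

  meas-⋃< : ∀ n {F} → (∀ i → Measurable (F i)) → Measurable (⋃< n F)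
  meas-⋃< zero    f = resp-≐ ((λ p → ⊥-elim (p _)) , λ ()) meas-∅
  meas-⋃< (suc n) {F} f = resp-≐ (proj₂ (⋃<-suc n F) , proj₁ (⋃<-suc n F)) (meas-∪ (meas-⋃< n f) (f n))

  meas-∃Fin : ∀ {m} {F : Fin m → Subset M k} → (∀ c → Measurable (F c)) → Measurable (λ x → ∃[ c ] F c x)
  meas-∃Fin {zero}  f = resp-≐ ((λ p → ⊥-elim (p _)) , λ ()) meas-∅
  meas-∃Fin {suc m} f = resp-≐ ([ (zero ,_) , (λ (c , p) → suc c , p) ]′ , λ { (zero , p) → inj₁ p ; (suc c , p) → inj₂ (c , p) })
    (meas-∪ (f zero) (meas-∃Fin (f ∘ suc)))

  meas-g : ∀ {D} → Measurable D → Measurable (D ∘ g)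
  meas-g (generator d)        = generator (Def-pullback d)
  meas-g (complement d)       = complement (meas-g d)
  meas-g (union d)            = union (λ i → meas-g (d i))
  meas-g (resp-≐ (p , q) d)   = resp-≐ (p , q) (meas-g d)

  meas-σ^ : ∀ i {D} → Measurable D → Measurable (preimage^ σ i D)
  meas-σ^ zero    d = d
  meas-σ^ (suc i) d = meas-σ^ i (meas-g d)

  μ-cong : ∀ {D E} → Measurable D → D ≐ E → μ D ≡ μ E
  μ-cong d eq = 𝓂.cong d (resp-≐ eq d) eq

  μ-nonNeg : ∀ {D} → Measurable D → 0# ≤ μ D
  μ-nonNeg = 𝓂.nonNeg

  μ-∅ : μ ∅′ ≡ 0#
  μ-∅ = trans (solve 1 (λ x → x := (x :+ x) :- x) refl (μ ∅′)) (trans (cong (_- μ ∅′)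
    (trans (sym (𝓀.additive (Def-∁ Def-U) (Def-∁ Def-U) λ x (p , _) → p _)) (μ-cong (meas-∪ meas-∅ meas-∅) ([ id , id ]′ , inj₁)))) (-‿inverseʳ _))

  μ-empty : ∀ {D} → Measurable D → (∀ x → ¬ D x) → μ D ≡ 0#
  μ-empty d none = trans (μ-cong d ((λ {x} p → ⊥-elim (none x p)) , λ p → ⊥-elim (p _))) μ-∅

  -- Countable additivity for the sequence `D`, `E` followed by empty sets: its partial sums are
  -- constant from two terms on.
  μ-additive : ∀ {D E} → Measurable D → Measurable E → D ⊥′ E → μ (D ∪ E) ≡ μ D + μ E
  μ-additive {D} {E} d e dis = trans (sym (μ-cong (union (pair-meas d e)) (pair-⋃ D E)))
      (convergesTo-const 2 (𝓂.σ-additive (pair D E ∅′) (pair-meas d e) disjoint) λ { (suc (suc n)) _ → sums n ; (suc zero) (s≤s ()) })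
    where
    disjoint : ∀ i j → i ≢ j → pair D E ∅′ i ⊥′ pair D E ∅′ j
    disjoint zero          zero          ne = ⊥-elim (ne refl)
    disjoint zero          (suc zero)    _  = dis
    disjoint zero          (suc (suc _)) _  x (_ , p) = p _
    disjoint (suc zero)    zero          _  x (p , q) = dis x (q , p)
    disjoint (suc zero)    (suc zero)    ne = ⊥-elim (ne refl)
    disjoint (suc zero)    (suc (suc _)) _  x (_ , p) = p _
    disjoint (suc (suc _)) _             _  x (p , _) = p _
    sums : ∀ n → ∑< (suc (suc n)) (λ i → μ (pair D E ∅′ i)) ≡ μ D + μ E
    sums zero    = cong (_+ μ E) (+-identityˡ (μ D))
    sums (suc n) = trans (cong₂ _+_ (sums n) μ-∅) (+-identityʳ _)

  μ-split : ∀ {A B} → Measurable A → Measurable B → μ A ≡ μ (A ∩ B) + μ (A ∩ ∁ B)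
  μ-split {A} {B} a b = trans (μ-cong a ((λ {x} → split x) , [ proj₁ , proj₁ ]′)) (μ-additive (meas-∩ a b) (meas-∩ a (complement b)) λ x ((_ , p) , (_ , ¬p)) → ¬p p)
    where
    split : ∀ x → A x → ((A ∩ B) ∪ (A ∩ ∁ B)) x
    split x p with em {P = B x}
    ... | yes q = inj₁ (p , q)
    ... | no ¬q = inj₂ (p , ¬q)

  μ-mono : ∀ {D E} → Measurable D → Measurable E → D ⊑ E → μ D ≤ μ E
  μ-mono {D} {E} d e sub = ≤-trans (≤-+-nonNeg (μ-nonNeg (meas-∩ e (complement d)))) (≤-reflexive (sym (trans (μ-split e d)
    (cong (_+ μ (E ∩ ∁ D)) (μ-cong (meas-∩ e d) (proj₂ , λ {x} p → sub x p , p))))))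

  μ-≤1 : ∀ {D} → Measurable D → μ D ≤ 1#
  μ-≤1 d = subst (_ ≤_) 𝓀.total (μ-mono d meas-U λ _ _ → _)

  μ-∪ : ∀ {D E} → Measurable D → Measurable E → μ (D ∪ E) ≤ μ D + μ E
  μ-∪ {D} {E} d e = ≤-trans (≤-reflexive (trans (μ-split (meas-∪ d e) d) (cong (_+ μ ((D ∪ E) ∩ ∁ D)) (μ-cong (meas-∩ (meas-∪ d e) d) (proj₂ , λ p → inj₁ p , p)))))
    (+-monoʳ-≤ (μ D) (μ-mono (meas-∩ (meas-∪ d e) (complement d)) e λ { x (inj₁ p , ¬p) → ⊥-elim (¬p p) ; x (inj₂ q , _) → q }))

  μ-∃Fin-≤ : ∀ {m} {F : Fin m → Subset M k} → (∀ c → Measurable (F c)) → μ (λ x → ∃[ c ] F c x) ≤ ∑Fin (λ c → μ (F c))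
  μ-∃Fin-≤ {zero}  f = ≤-reflexive (μ-empty (meas-∃Fin f) λ { x (() , _) })
  μ-∃Fin-≤ {suc m} {F} f = ≤-trans (≤-reflexive (μ-cong (meas-∃Fin f) ((λ { (zero , p) → inj₁ p ; (suc c , p) → inj₂ (c , p) }) , [ (zero ,_) , (λ (c , p) → suc c , p) ]′)))
    (≤-trans (μ-∪ (f zero) (meas-∃Fin (f ∘ suc))) (+-monoʳ-≤ (μ (F zero)) (μ-∃Fin-≤ (f ∘ suc))))

  μ-∃Fin : ∀ {m} {F : Fin m → Subset M k} → (∀ c → Measurable (F c)) → (∀ c d → c ≢ d → F c ⊥′ F d) → μ (λ x → ∃[ c ] F c x) ≡ ∑Fin (λ c → μ (F c))
  μ-∃Fin {zero}  f dis = μ-empty (meas-∃Fin f) λ { x (() , _) }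
  μ-∃Fin {suc m} {F} f dis = trans (μ-cong (meas-∃Fin f) ((λ { (zero , p) → inj₁ p ; (suc c , p) → inj₂ (c , p) }) , [ (zero ,_) , (λ (c , p) → suc c , p) ]′))
    (trans (μ-additive (f zero) (meas-∃Fin (f ∘ suc)) λ x (p , c , q) → dis zero (suc c) (λ ()) x (p , q))
      (cong (μ (F zero) +_) (μ-∃Fin (f ∘ suc) λ c d ne → dis (suc c) (suc d) (ne ∘ Fin.suc-injective))))

  μ-partition : ∀ {m} {Q : Fin m → Subset M k} {B} → (∀ c → Measurable (Q c)) → (∀ c d → c ≢ d → Q c ⊥′ Q d) → (∀ x → ∃[ c ] Q c x) → Measurable B →
    ∑Fin (λ c → μ (Q c ∩ B)) ≡ μ B
  μ-partition q dis cov b = trans (sym (μ-∃Fin (λ c → meas-∩ (q c) b) λ c d ne x ((p , _) , (p′ , _)) → dis c d ne x (p , p′)))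
    (μ-cong (meas-∃Fin λ c → meas-∩ (q c) b) ((λ (_ , _ , p) → p) , λ {x} p → let (c , r) = cov x in c , r , p))

  -- Invariance is assumed for images; it is applied to the preimage of `D`, whose image is `D`.
  μ-g : ∀ {D} → Measurable D → μ (D ∘ g) ≡ μ D
  μ-g {D} d = trans (sym (invariant (D ∘ g) (meas-g d))) (𝓂.cong (resp-≐ (q , p) d) d (p , q))
    where
    p : ∀ {y} → image σ (D ∘ g) y → D y
    p (x , r , refl) = r
    q : ∀ {y} → D y → image σ (D ∘ g) y
    q {y} r = Vec.map (Automorphism.from σ) y , subst D (sym (map-gh y)) r , map-gh y

  μ-σ^ : ∀ i {D} → Measurable D → μ (preimage^ σ i D) ≡ μ D
  μ-σ^ zero    d = refl
  μ-σ^ (suc i) d = trans (μ-σ^ i (meas-g d)) (μ-g d)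

  Approximable : Subset M k → Set (lsuc ℓ)
  Approximable A = ∀ ε → 0# < ε → Σ[ D ∈ Subset M k ] Def M k D × μ (A △ D) ≤ ε

  approx-⋃< : ∀ n {F} → (∀ i → Measurable (F i)) → (∀ i → Approximable (F i)) → Approximable (⋃< n F)
  approx-⋃< zero {F} f a ε 0<ε = ∅′ , Def-∁ Def-U , ≤-trans (≤-reflexive (μ-empty (meas-△ (meas-⋃< 0 f) meas-∅) none)) (<⇒≤ 0<ε)
    where
    none : ∀ x → ¬ (⋃< 0 F △ ∅′) x
    none x (inj₁ ((_ , () , _) , _))
    none x (inj₂ (p , _)) = p _
  approx-⋃< (suc n) {F} f a ε 0<ε = let
      (D , d , p) = approx-⋃< n f a (½ * ε) (half-pos 0<ε)
      (E , e , q) = a n (½ * ε) (half-pos 0<ε)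
      mf = meas-⋃< n f
      md = generator d
      me = generator e
    in D ∪ E , Def-∪ d e , ≤-trans (μ-mono (meas-△ (meas-⋃< (suc n) f) (meas-∪ md me)) (meas-∪ (meas-△ mf md) (meas-△ (f n) me))
         (λ x r → △-∪ (⋃< n F) (F n) D E x (△-resp {⋃< n F ∪ F n} {⋃< (suc n) F} (D ∪ E) ((λ {y} → proj₂ (⋃<-suc n F) {y}) , λ {y} → proj₁ (⋃<-suc n F) {y}) x r)))
       (≤-trans (μ-∪ (meas-△ mf md) (meas-△ (f n) me)) (≤-trans (+-mono-≤ p q) (≤-reflexive (half ε))))

  μ-⋃<-sum : ∀ n {F} → (∀ i → Measurable (F i)) → (∀ i j → i ≢ j → F i ⊥′ F j) → ∑< n (λ i → μ (F i)) ≡ μ (⋃< n F)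
  μ-⋃<-sum zero    f dis = sym (μ-empty (meas-⋃< 0 f) λ { x (_ , () , _) })
  μ-⋃<-sum (suc n) {F} f dis = trans (cong (_+ μ (F n)) (μ-⋃<-sum n f dis)) (trans (sym (μ-additive (meas-⋃< n f) (f n)
    λ x ((j , j<n , p) , q) → dis j n (ℕ.<⇒≢ j<n) x (p , q))) (sym (μ-cong (meas-⋃< (suc n) f) (⋃<-suc n F))))

  abstract
    -- Induction on the generation of `A`. For a union, countable additivity over the disjoint parts
    -- leaves a remainder of at most half of `ε` outside a finite subunion, which is approximated
    -- within the other half.
    approximable : ∀ {A} → Measurable A → Approximable A
    approximable (generator {D} d) ε 0<ε = D , d , ≤-trans (≤-reflexive (μ-empty (meas-△ (generator d) (generator d)) none)) (<⇒≤ 0<ε)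
      where
      none : ∀ x → ¬ (D △ D) x
      none x (inj₁ (p , ¬p)) = ¬p p
      none x (inj₂ (p , ¬p)) = ¬p p
    approximable (complement {A} a) ε 0<ε = let (D , d , p) = approximable a ε 0<ε in
      ∁ D , Def-∁ d , ≤-trans (μ-mono (meas-△ (complement a) (complement (generator d))) (meas-△ a (generator d)) (△-∁ A D)) p
    approximable (resp-≐ {A} {B} eq a) ε 0<ε = let (D , d , p) = approximable a ε 0<ε in
      D , d , ≤-trans (μ-mono (meas-△ (resp-≐ eq a) (generator d)) (meas-△ a (generator d)) (△-resp D eq)) p
    approximable (union {F} f) ε 0<ε = let
        b : ∀ i → Measurable (fresh F i)
        b i = meas-∩ (f i) (complement (meas-⋃< i f))
        (N , close) = 𝓂.σ-additive (fresh F) b (fresh-disjoint F) (½ * ε) (half-pos 0<ε)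
        P = ⋃< N F
        mP = meas-⋃< N f
        (D , d , p) = approx-⋃< N f (λ i → approximable (f i)) (½ * ε) (half-pos 0<ε)
        md = generator d
        gap : μ (⋃ ℕ F) ≤ μ P + ½ * ε
        gap = ≤-trans (≤-reflexive (trans (sym (μ-cong (union b) (⋃-fresh F))) (solve 2 (λ x h → x := x :- h :+ h) refl (μ (⋃ ℕ (fresh F))) (½ * ε))))
          (+-monoˡ-≤ (½ * ε) (≤-trans (<⇒≤ (proj₁ (close N ℕ.≤-refl))) (≤-reflexive (trans (μ-⋃<-sum N b (fresh-disjoint F)) (μ-cong (meas-⋃< N b) (⋃<-fresh N F))))))
        small : μ (⋃ ℕ F △ P) ≤ ½ * ε
        small = +-cancelʳ-≤ (μ P) (≤-trans (≤-reflexive (trans (+-comm _ _) (sym (trans (μ-split (union f) mP) (cong₂ _+_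
            (μ-cong (meas-∩ (union f) mP) (proj₂ , λ {x} (j , j<N , q) → (j , q) , (j , j<N , q)))
            (μ-cong (meas-∩ (union f) (complement mP)) (inj₁ , [ id , (λ ((j , _ , q) , ¬q) → ⊥-elim (¬q (j , q))) ]′)))))))
          (≤-trans gap (≤-reflexive (+-comm _ _))))
      in D , d , ≤-trans (μ-mono (meas-△ (union f) md) (meas-∪ (meas-△ (union f) mP) (meas-△ mP md)) (△-trans (⋃ ℕ F) P D))
           (≤-trans (μ-∪ (meas-△ (union f) mP) (meas-△ mP md)) (≤-trans (+-mono-≤ small p) (≤-reflexive (half ε))))

  hits : (ℕ → Subset M k) → ℕ → X → ℕ
  hits B zero    x = 0
  hits B (suc n) x = if ⌊ B n x ⌋ then suc (hits B n x) else hits B n x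

  -- Markov's inequality, the integral over `A` of the number of visits being the sum on the right.
  -- In the induction `A` is split along `B n`; the required count drops by one on the part inside
  -- `B n`.
  markov : ∀ n d {B A} → (∀ i → Measurable (B i)) → Measurable A → (∀ x → A x → d ℕ.≤ hits B n x) →
    fromℕ d * μ A ≤ ∑< n (λ i → μ (A ∩ B i))
  markov zero    zero    b a h = ≤-reflexive (zeroˡ _)
  markov zero    (suc d) b a h = ≤-reflexive (trans (cong (fromℕ (suc d) *_) (μ-empty a λ x p → case h x p of λ ())) (zeroʳ _))
  markov (suc n) d {B} {A} b a h = ≤-trans (≤-reflexive (trans (cong (fromℕ d *_) (μ-split a (b n))) (distribˡ _ _ _)))
      (≤-trans (+-monoˡ-≤ _ (≤-trans (subst₂ _≤_ (*-comm _ _) (*-comm _ _) (*-monoˡ-≤ (μ-nonNeg a₁) (predecessor d))) (≤-reflexive (trans (distribʳ _ _ _) (cong (fromℕ (ℕ.pred d) * μ A₁ +_) (*-identityˡ _))))))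
      (≤-trans (+-mono-≤ (+-monoˡ-≤ (μ A₁) (markov n (ℕ.pred d) b a₁ λ x (p , q) → inside x q (h x p))) (markov n d b a₂ λ x (p , q) → outside x q (h x p)))
        (≤-reflexive (trans (solve 3 (λ s m t → s :+ m :+ t := s :+ t :+ m) refl (∑< n (λ i → μ (A₁ ∩ B i))) (μ A₁) (∑< n (λ i → μ (A₂ ∩ B i))))
          (cong (_+ μ A₁) (trans (sym (∑<-+ n (λ i → μ (A₁ ∩ B i)) (λ i → μ (A₂ ∩ B i)))) (∑<-cong n λ i _ → sym (pieces i))))))))
    where
    A₁ A₂ : Subset M k
    A₁ = A ∩ B n
    A₂ = A ∩ ∁ (B n)
    a₁ : Measurable A₁
    a₁ = meas-∩ a (b n)
    a₂ : Measurable A₂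
    a₂ = meas-∩ a (complement (b n))
    predecessor : ∀ d → fromℕ d ≤ fromℕ (ℕ.pred d) + 1#
    predecessor zero    = +-nonNeg ≤-refl 0≤1
    predecessor (suc d) = ≤-reflexive (+-comm _ _)
    inside : ∀ x → B n x → d ℕ.≤ hits B (suc n) x → ℕ.pred d ℕ.≤ hits B n x
    inside x q p rewrite holds q = ℕ.pred-mono-≤ p
    outside : ∀ x → ¬ B n x → d ℕ.≤ hits B (suc n) x → d ℕ.≤ hits B n x
    outside x ¬q p rewrite fails ¬q = p
    pieces : ∀ i → μ (A ∩ B i) ≡ μ (A₁ ∩ B i) + μ (A₂ ∩ B i)
    pieces i = trans (μ-split (meas-∩ a (b i)) (b n)) (cong₂ _+_
      (μ-cong (meas-∩ (meas-∩ a (b i)) (b n)) ((λ ((p , q) , r) → (p , r) , q) , λ ((p , r) , q) → (p , q) , r))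
      (μ-cong (meas-∩ (meas-∩ a (b i)) (complement (b n))) ((λ ((p , q) , r) → (p , r) , q) , λ ((p , r) , q) → (p , q) , r)))

-- Upper bound for the entropy of names

module EntropyBound (em : ∀ {a} → ExcludedMiddle a) (𝓡 : RealNumbers) {ℓ} {L : Language ℓ} {M : Structure L} {k : ℕ}
  (σ : Automorphism M) (measure : Measure 𝓡 M k) (invariant : IsInvariant 𝓡 σ measure)
  (log : RealNumbers.ℝ 𝓡 → RealNumbers.ℝ 𝓡) (isLog : RealNumbers.IsLogarithm 𝓡 log) where
  open Classical em
  open Reals em 𝓡
  open Analysis em 𝓡
  open Logarithm log isLog
  open IsLogarithm isLog
  open InvariantMeasure em 𝓡 σ measure invariant

  module _ {m} {P : Fin m → Subset M k} (isPartition : IsMeasurablePartition {M = M} P) where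
    open IsMeasurablePartition isPartition

    Join : ∀ n → Fin (m ℕ.^ n) → Subset M k
    Join = iteratedJoin σ P

    first : ∀ n → Fin (m ℕ.^ suc n) → Fin m
    first n w = proj₁ (remQuot {m} (m ℕ.^ n) w)

    rest : ∀ n → Fin (m ℕ.^ suc n) → Fin (m ℕ.^ n)
    rest n w = proj₂ (remQuot {m} (m ℕ.^ n) w)

    Join-measurable : ∀ n w → Measurable (Join n w)
    Join-measurable zero    w = meas-U
    Join-measurable (suc n) w = meas-∩ (meas-σ^ n (measurable (first n w))) (Join-measurable n (rest n w))

    -- `B` is arbitrary so that the induction can absorb the newest factor of the join into it.
    Join-sum : ∀ n {B} → Measurable B → ∑Fin (λ w → μ (Join n w ∩ B)) ≡ μ B
    Join-sum zero    {B} b = trans (+-identityʳ _) (μ-cong (meas-∩ meas-U b) (proj₂ , (_ ,_)))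
    Join-sum (suc n) {B} b = trans (∑Fin-remQuot m (m ℕ.^ n) (λ (c , w) → μ ((preimage^ σ n (P c) ∩ Join n w) ∩ B)))
      (trans (∑Fin-cong λ c → trans (∑Fin-cong λ w → μ-cong (meas-∩ (meas-∩ (meas-σ^ n (measurable c)) (Join-measurable n w)) b)
                ((λ ((p , q) , r) → q , p , r) , λ (q , p , r) → (p , q) , r))
              (Join-sum n (meas-∩ (meas-σ^ n (measurable c)) b)))
        (μ-partition (λ c → meas-σ^ n (measurable c)) (λ c d ne x → disjoint c d ne (fold x g n)) (λ x → covers (fold x g n)) b))

    abstract
      entropy-nonNeg : ∀ n → 0# ≤ H 𝓡 log measure (Join n)
      entropy-nonNeg n = subst (0# ≤_) (sym (∑Fin-neg (λ w → μ (Join n w) * log (μ (Join n w))))) (∑Fin-nonNeg {f = λ w → - (μ (Join n w) * log (μ (Join n w)))} term)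
        where
        term : ∀ w → 0# ≤ - (μ (Join n w) * log (μ (Join n w)))
        -- `log` is unspecified at 0, so null cells are treated apart.
        term w with em {P = μ (Join n w) ≡ 0#}
        ... | yes eq = ≤-reflexive (sym (trans (cong (λ z → - (z * log (μ (Join n w)))) eq) (solve 1 (λ l → :- (con (ℤ.+ 0) :* l) := con (ℤ.+ 0)) refl (log (μ (Join n w))))))
        ... | no ne  = subst₂ _≤_ (solve 1 (λ x → x :* con (ℤ.+ 0) := con (ℤ.+ 0)) refl (μ (Join n w))) (solve 2 (λ x l → x :* (:- l) := :- (x :* l)) refl (μ (Join n w)) (log (μ (Join n w))))
          (*-monoˡ-≤ (μ-nonNeg (Join-measurable n w)) (subst (_≤ - log (μ (Join n w))) (solve 0 (:- con (ℤ.+ 0) := con (ℤ.+ 0)) refl)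
            (neg-mono (log-nonPos (μ-nonNeg (Join-measurable n w) , λ e → ne (sym e)) (μ-≤1 (Join-measurable n w))))))

    -- The probability vector q on names of length n is the average, over the centres u ∈ K, of the
    -- product measures giving weight α to the entry of u and β to every other entry.
    module _ {α β : ℝ} (0<α : 0# < α) (α≤1 : α ≤ 1#) (0<β : 0# < β) (β≤1 : β ≤ 1#) (αβ : α + fromℕ m * β ≤ 1#) where

      kernel : Fin m → Fin m → ℝ
      kernel u c = if ⌊ u ≡ c ⌋ then α else β

      kernel-pos : ∀ u c → 0# < kernel u c
      kernel-pos u c with em {P = u ≡ c}
      ... | yes _ = 0<α
      ... | no _  = 0<β

      single : ∀ {r} (u : Fin r) → ∑Fin (λ c → if ⌊ u ≡ c ⌋ then α else 0#) ≤ α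
      single {suc r} zero = ≤-reflexive (trans (cong₂ _+_ (cong (λ b → if b then α else 0#) (holds {P = zero ≡ zero} refl))
        (trans (∑Fin-cong {r} λ c → cong (λ b → if b then α else 0#) (fails {P = zero ≡ suc c} λ ())) (∑Fin-0 r))) (+-identityʳ α))
      single {suc r} (suc u) = ≤-trans (≤-reflexive (trans (cong₂ _+_ (cong (λ b → if b then α else 0#) (fails {P = suc u ≡ zero} λ ()))
        (∑Fin-cong λ c → cong (λ b → if b then α else 0#) (⌊⌋-cong {P = suc u ≡ suc c} {Q = u ≡ c} Fin.suc-injective (cong suc)))) (+-identityˡ _))) (single u)

      -- Here β is counted for every entry, that of the centre included, which explains the form of
      -- the hypothesis on α and β.
      kernel-sum : ∀ u → ∑Fin (kernel u) ≤ 1#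
      kernel-sum u = ≤-trans (∑Fin-mono {f = kernel u} {g = λ c → (if ⌊ u ≡ c ⌋ then α else 0#) + β} bound) (≤-trans (≤-reflexive (trans (∑Fin-+ (λ c → if ⌊ u ≡ c ⌋ then α else 0#) (λ _ → β)) (cong (∑Fin (λ c → if ⌊ u ≡ c ⌋ then α else 0#) +_) (∑Fin-const m β))))
        (≤-trans (+-monoˡ-≤ _ (single u)) αβ))
        where
        bound : ∀ c → kernel u c ≤ (if ⌊ u ≡ c ⌋ then α else 0#) + β
        bound c with em {P = u ≡ c}
        ... | yes _ = ≤-+-nonNeg (<⇒≤ 0<β)
        ... | no _  = ≤-reflexive (sym (+-identityˡ β))

      weight : ∀ n → (ℕ → Fin m) → Fin (m ℕ.^ n) → ℝ
      weight zero    u w = 1#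
      weight (suc n) u w = kernel (u n) (first n w) * weight n u (rest n w)

      weight-pos : ∀ n u w → 0# < weight n u w
      weight-pos zero    u w = 0<1
      weight-pos (suc n) u w = *-pos (kernel-pos (u n) (first n w)) (weight-pos n u (rest n w))

      weight-sum : ∀ n u → ∑Fin (weight n u) ≤ 1#
      weight-sum zero    u = ≤-reflexive (+-identityʳ 1#)
      weight-sum (suc n) u = ≤-trans (≤-reflexive (trans (∑Fin-remQuot m (m ℕ.^ n) (λ (c , w) → kernel (u n) c * weight n u w))
          (trans (∑Fin-cong λ c → trans (∑Fin-* (kernel (u n) c) (weight n u)) (*-comm _ _)) (∑Fin-* (∑Fin (weight n u)) (kernel (u n))))))
        (≤-trans (*-mono-≤ (∑Fin-nonNeg {f = weight n u} λ w → <⇒≤ (weight-pos n u w)) 0≤1 (weight-sum n u) (kernel-sum (u n))) (≤-reflexive (*-identityʳ 1#)))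

      mismatches : ∀ n → (ℕ → Fin m) → Fin (m ℕ.^ n) → ℕ
      mismatches zero    u w = 0
      mismatches (suc n) u w = if ⌊ u n ≡ first n w ⌋ then mismatches n u (rest n w) else suc (mismatches n u (rest n w))

      -- At a mismatch a further factor α, at most 1, is given away, so that α occurs `n` times
      -- whatever the name.
      weight-≥ : ∀ n u w → α ^ n * β ^ mismatches n u w ≤ weight n u w
      weight-≥ zero    u w = ≤-reflexive (*-identityʳ 1#)
      weight-≥ (suc n) u w with em {P = u n ≡ first n w}
      ... | yes _ = ≤-trans (≤-reflexive (*-assoc _ _ _)) (*-monoˡ-≤ (<⇒≤ 0<α) (weight-≥ n u (rest n w)))
      ... | no _  = ≤-trans (≤-reflexive (solve 4 (λ a p b q → a :* p :* (b :* q) := a :* (b :* (p :* q))) refl α (α ^ n) β (β ^ mismatches n u (rest n w))))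
        (≤-trans (*-mono-≤ (<⇒≤ 0<α) (*-nonNeg (<⇒≤ 0<β) (<⇒≤ (weight-pos n u (rest n w)))) α≤1 (*-monoˡ-≤ (<⇒≤ 0<β) (weight-≥ n u (rest n w)))) (≤-reflexive (*-identityˡ _)))

      β^-antitone : ∀ {d e} → d ℕ.≤ e → β ^ e ≤ β ^ d
      β^-antitone {e = e} z≤n = le e
        where
        le : ∀ e → β ^ e ≤ 1#
        le zero    = ≤-refl
        le (suc e) = ≤-trans (*-mono-≤ (<⇒≤ 0<β) 0≤1 β≤1 (le e)) (≤-reflexive (*-identityʳ 1#))
      β^-antitone (s≤s p) = *-monoˡ-≤ (<⇒≤ 0<β) (β^-antitone p)

      module _ {E : Subset M k} (E-measurable : Measurable E) (n : ℕ) (K : List (ℕ → Fin m))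
        (centre : ∀ x → Σ[ j ∈ Fin (List.length K) ] (∀ i → i ℕ.< n → ¬ E (fold x g i) → P (List.lookup K j i) (fold x g i)))
        (κ₀ : ℕ) (κ≡ : List.length K ≡ suc κ₀) where
        private
          κ : ℝ
          κ = fromℕ (List.length K)
          0<κ : 0# < κ
          0<κ = subst (λ j → 0# < fromℕ j) (sym κ≡) (fromℕ-pos κ₀)
          Eᵢ : ℕ → Subset M k
          Eᵢ i = preimage^ σ i E

          mismatches-≤ : ∀ n u w x → Join n w x → (∀ i → i ℕ.< n → ¬ E (fold x g i) → P (u i) (fold x g i)) → mismatches n u w ℕ.≤ hits Eᵢ n x
          mismatches-≤ zero    u w x _       h = z≤n
          mismatches-≤ (suc n) u w x (p , q) h with em {P = u n ≡ first n w} | em {P = E (fold x g n)} | mismatches-≤ n u (rest n w) x q (λ i i<n → h i (ℕ.m<n⇒m<1+n i<n))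
          ... | yes _ | yes _ | le = ℕ.m≤n⇒m≤1+n le
          ... | yes _ | no _  | le = le
          ... | no _  | yes _ | le = s≤s le
          ... | no ne | no ¬e | le = ⊥-elim (disjoint (u n) (first n w) ne (fold x g n) (h n ℕ.≤-refl ¬e , p))

          q : Fin (m ℕ.^ n) → ℝ
          q w = κ ⁻¹ * ∑Fin (λ j → weight n (List.lookup K j) w)

          q-sum : ∑Fin q ≤ 1#
          q-sum = ≤-trans (≤-reflexive (trans (∑Fin-* (κ ⁻¹) (λ w → ∑Fin (λ j → weight n (List.lookup K j) w))) (cong (κ ⁻¹ *_) (∑Fin-swap (m ℕ.^ n) (List.length K) (λ w j → weight n (List.lookup K j) w)))))
            (≤-trans (*-monoˡ-≤ (<⇒≤ (⁻¹-pos 0<κ)) (∑Fin-mono {f = λ j → ∑Fin (weight n (List.lookup K j))} {g = λ _ → 1#} λ j → weight-sum n (List.lookup K j)))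
              (≤-reflexive (trans (cong (κ ⁻¹ *_) (trans (∑Fin-const (List.length K) 1#) (*-identityʳ κ))) (trans (*-comm _ _) (*-inverse 0<κ)))))

          q-nonNeg : ∀ w → 0# ≤ q w
          q-nonNeg w = *-nonNeg (<⇒≤ (⁻¹-pos 0<κ)) (∑Fin-nonNeg {f = λ j → weight n (List.lookup K j) w} λ j → <⇒≤ (weight-pos n (List.lookup K j) w))

          L₁ L₂ : ℝ
          L₁ = - log α
          L₂ = - log β

          L₂-nonNeg : 0# ≤ L₂
          L₂-nonNeg = subst (_≤ L₂) (solve 0 (:- con (ℤ.+ 0) := con (ℤ.+ 0)) refl) (neg-mono (log-nonPos 0<β β≤1))

          L₁-nonNeg : 0# ≤ L₁
          L₁-nonNeg = subst (_≤ L₁) (solve 0 (:- con (ℤ.+ 0) := con (ℤ.+ 0)) refl) (neg-mono (log-nonPos 0<α α≤1))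

          1≤κ : 1# ≤ κ
          1≤κ = subst (λ j → 1# ≤ fromℕ j) (sym κ≡) (≤-+-nonNeg (fromℕ-nonNeg κ₀))

          Base : ℝ
          Base = log κ + fromℕ n * L₁

          Base-nonNeg : 0# ≤ Base
          Base-nonNeg = +-nonNeg (log-nonNeg 1≤κ) (*-nonNeg (fromℕ-nonNeg n) L₁-nonNeg)

          -- The visit count varies within a cell. At a point with the fewest visits `q-log` is
          -- sharpest, and since the whole cell has at least that many, `markov` bounds this minimum
          -- times the measure of the cell.
          closest : ∀ w → ∃ (Join n w) → ∃[ d ] (∃[ x ] Join n w x × hits Eᵢ n x ≡ d) × (∀ x → Join n w x → d ℕ.≤ hits Eᵢ n x)
          closest w (x₀ , p₀) = let (d , (x , p , eq) , min) = WellOrder.least <-wellOrder (λ d → ∃[ x ] Join n w x × hits Eᵢ n x ≡ d) (_ , x₀ , p₀ , refl)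
            in d , (x , p , eq) , λ y py → ℕ.≮⇒≥ λ lt → min _ lt (y , py , refl)

          q-log : ∀ w x → Join n w x → - log (q w) ≤ Base + fromℕ (hits Eᵢ n x) * L₂
          q-log w x p = ≤-trans (neg-mono (log-≤ (*-pos (⁻¹-pos 0<κ) (*-pos (^-pos 0<α n) (^-pos 0<β (hits Eᵢ n x)))) lower-bound)) (≤-reflexive expand)
            where
            j : Fin (List.length K)
            j = proj₁ (centre x)
            lower-bound : κ ⁻¹ * (α ^ n * β ^ hits Eᵢ n x) ≤ q w
            lower-bound = *-monoˡ-≤ (<⇒≤ (⁻¹-pos 0<κ)) (≤-trans (*-monoˡ-≤ (<⇒≤ (^-pos 0<α n)) (β^-antitone (mismatches-≤ n (List.lookup K j) w x p (proj₂ (centre x)))))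
              (≤-trans (weight-≥ n (List.lookup K j) w) (∑Fin-term {f = λ j → weight n (List.lookup K j) w} (λ j → <⇒≤ (weight-pos n (List.lookup K j) w)) j)))
            expand : - log (κ ⁻¹ * (α ^ n * β ^ hits Eᵢ n x)) ≡ Base + fromℕ (hits Eᵢ n x) * L₂
            expand = trans (cong -_ (trans (log-* _ _ (⁻¹-pos 0<κ) (*-pos (^-pos 0<α n) (^-pos 0<β (hits Eᵢ n x)))) (cong₂ _+_ (log-⁻¹ 0<κ)
                (trans (log-* _ _ (^-pos 0<α n) (^-pos 0<β (hits Eᵢ n x))) (cong₂ _+_ (log-^ 0<α n) (log-^ 0<β (hits Eᵢ n x)))))))
              (solve 5 (λ k n a d b → :- ((:- k) :+ (n :* a :+ d :* b)) := k :+ n :* (:- a) :+ d :* (:- b)) refl (log κ) (fromℕ n) (log α) (fromℕ (hits Eᵢ n x)) (log β))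

          Hits : Fin (m ℕ.^ n) → ℝ
          Hits w = ∑< n (λ i → μ (Join n w ∩ Eᵢ i))

          Hits-nonNeg : ∀ w → 0# ≤ Hits w
          Hits-nonNeg w = ∑<-nonNeg n λ i → μ-nonNeg (meas-∩ (Join-measurable n w) (meas-σ^ i E-measurable))

          -- With y the measure of the cell, -y log y = y (log q - log y) + y (-log q). The first
          -- part is at most log 2 times q, by the linear bound on the logarithm of q/y; the second
          -- is estimated at the point given by `closest`.
          term : ∀ w → - (μ (Join n w) * log (μ (Join n w))) ≤ log 2# * q w + (Base * μ (Join n w) + L₂ * Hits w)
          term w with em {P = μ (Join n w) ≡ 0#}
          ... | yes eq = ≤-trans (≤-reflexive (trans (cong (λ z → - (z * log (μ (Join n w)))) eq) (solve 1 (λ l → :- (con (ℤ.+ 0) :* l) := con (ℤ.+ 0)) refl (log (μ (Join n w))))))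
            (+-nonNeg (*-nonNeg (<⇒≤ log2>0) (q-nonNeg w)) (+-nonNeg (*-nonNeg Base-nonNeg (μ-nonNeg (Join-measurable n w))) (*-nonNeg L₂-nonNeg (Hits-nonNeg w))))
          ... | no ne with dne {P = ∃ (Join n w)} (λ none → ne (μ-empty (Join-measurable n w) λ x p → none (x , p)))
          ...   | nonempty with closest w nonempty
          ...     | d , (x , p , refl) , min =
              ≤-trans (≤-reflexive (solve 3 (λ y l r → :- (y :* l) := y :* (r :- l) :+ y :* (:- r)) refl y (log y) (log (q w))))
                (+-mono-≤ gibbs (≤-trans (*-monoˡ-≤ (<⇒≤ 0<y) (q-log w x p)) (≤-trans (≤-reflexive
                  (solve 4 (λ y b d l → y :* (b :+ d :* l) := b :* y :+ l :* (d :* y)) refl y Base (fromℕ (hits Eᵢ n x)) L₂))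
                  (+-monoʳ-≤ (Base * y) (*-monoˡ-≤ L₂-nonNeg (markov n (hits Eᵢ n x) (λ i → meas-σ^ i E-measurable) (Join-measurable n w) min))))))
            where
            y : ℝ
            y = μ (Join n w)
            0<y : 0# < y
            0<y = μ-nonNeg (Join-measurable n w) , λ e → ne (sym e)
            0<q : 0# < q w
            0<q = *-pos (⁻¹-pos 0<κ) (<-≤-trans (weight-pos n (List.lookup K (proj₁ (centre x))) w) (∑Fin-term {f = λ j → weight n (List.lookup K j) w} (λ j → <⇒≤ (weight-pos n (List.lookup K j) w)) (proj₁ (centre x))))
            gibbs : y * (log (q w) - log y) ≤ log 2# * q w
            gibbs = ≤-trans (*-monoˡ-≤ (<⇒≤ 0<y) (≤-trans (≤-reflexive (sym (trans (log-* (q w) (y ⁻¹) 0<q (⁻¹-pos 0<y)) (cong (log (q w) +_) (log-⁻¹ 0<y)))))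
              (log-≤-linear (*-pos 0<q (⁻¹-pos 0<y)))))
              (≤-reflexive (trans (solve 4 (λ y l q i → y :* (l :* (q :* i)) := l :* q :* (y :* i)) refl y (log 2#) (q w) (y ⁻¹)) (trans (cong (log 2# * q w *_) (*-inverse 0<y)) (*-identityʳ _))))

          -- The mean number of visits in `n` steps: exchanging the sums leaves the measures of the
          -- iterated preimages of `E`, all equal by invariance.
          Hits-sum : ∑Fin Hits ≡ fromℕ n * μ E
          Hits-sum = trans (∑Fin-∑< (m ℕ.^ n) n (λ w i → μ (Join n w ∩ Eᵢ i))) (trans (∑<-cong n λ i _ → trans (Join-sum n (meas-σ^ i E-measurable)) (μ-σ^ i E-measurable)) (∑<-const n (μ E)))

          mass-sum : ∑Fin (λ w → μ (Join n w)) ≡ 1#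
          mass-sum = trans (∑Fin-cong λ w → μ-cong (Join-measurable n w) ((λ p → p , _) , proj₁)) (trans (Join-sum n meas-U) (IsKeislerMeasure.total (Measure.isKeisler measure)))

        abstract
          entropy-≤ : H 𝓡 log measure (Join n) ≤ log 2# + (log (fromℕ (List.length K)) + fromℕ n * - log α) + - log β * (fromℕ n * μ E)
          entropy-≤ = ≤-trans (≤-reflexive (∑Fin-neg (λ w → μ (Join n w) * log (μ (Join n w))))) (≤-trans (∑Fin-mono {f = λ w → - (μ (Join n w) * log (μ (Join n w)))} {g = λ w → log 2# * q w + (Base * μ (Join n w) + L₂ * Hits w)} term) (≤-trans (≤-reflexive
            (trans (∑Fin-+ (λ w → log 2# * q w) (λ w → Base * μ (Join n w) + L₂ * Hits w)) (cong₂ _+_ (∑Fin-* (log 2#) q)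
              (trans (∑Fin-+ (λ w → Base * μ (Join n w)) (λ w → L₂ * Hits w)) (cong₂ _+_ (trans (∑Fin-* Base (λ w → μ (Join n w))) (trans (cong (Base *_) mass-sum) (*-identityʳ Base)))
                (trans (∑Fin-* L₂ Hits) (cong (L₂ *_) Hits-sum)))))))
            (≤-trans (+-monoˡ-≤ _ (≤-trans (*-monoˡ-≤ (<⇒≤ log2>0) q-sum) (≤-reflexive (*-identityʳ _)))) (≤-reflexive (sym (+-assoc _ _ _))))))

-- Zero entropy from NIP

module ZeroEntropy (em : ∀ {a} → ExcludedMiddle a) (ext : ∀ {a b} → Extensionality a b) (𝓡 : RealNumbers)
  (log : RealNumbers.ℝ 𝓡 → RealNumbers.ℝ 𝓡) (isLog : RealNumbers.IsLogarithm 𝓡 log)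
  {ℓ} {L : Language ℓ} {M : Structure L} {k : ℕ}
  (noIP : ∀ {n} (φ : Formula L (k ℕ.+ n)) → ¬ Logic.IPIn em {L = L} {k} {n} φ M)
  (σ : Automorphism M) (measure : Measure 𝓡 M k) (invariant : IsInvariant 𝓡 σ measure) where
  open Classical em
  open Logic em {L = L}
  open Structure M using (Domain; nonempty)
  open Equivalence
  open Action σ
  open Parameters M
  open Reals em 𝓡
  open Analysis em 𝓡
  open Logarithm log isLog
  open SauerShelah em ext
  open FiniteUnions em {X = Vec Domain k}
  open InvariantMeasure em 𝓡 σ measure invariant
  open EntropyBound em 𝓡 σ measure invariant log isLog

  private
    -- Testing the `j`-th iterate of a point against `p` amounts to testing the point itself against
    -- `p` moved back `j` times.
    back : ∀ {a} → Vec Domain a → ℕ → Vec Domain a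
    back p zero    = p
    back p (suc j) = back (Vec.map (Automorphism.from σ) p) j

    sat-back : ∀ {a} (φ : Formula L (k ℕ.+ a)) p x j → Sat M φ (fold x g j ++ p) ⇔ Sat M φ (x ++ back p j)
    sat-back φ p x zero    = mk⇔ id id
    sat-back φ p x (suc j) = mk⇔ (to (sat-back φ _ x j) ∘ from step) (to step ∘ from (sat-back φ _ x j))
      where
      step : Sat M φ (fold x g j ++ Vec.map (Automorphism.from σ) p) ⇔ Sat M φ (g (fold x g j) ++ p)
      step = pullback-sat (record { formula = φ ; params = p }) (fold x g j)

    abstract
      -- Failure of IP gives a `d` such that no `d` parameter tuples are shattered. By `sat-back`, a
      -- shattered set of `d` times would yield `d` shattered translates of the parameters of `D`,
      -- whatever the length of the names.
      dimension : ∀ {D : Subset M k} → Def M k D → ∃[ d ] (∀ n → ¬ ShattersAt d (λ (v : Vec Bool n) → ∃[ x ] (∀ i → lookup v i ≡ ⌊ D (fold x g (toℕ i)) ⌋)))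
      dimension {D} (ψ , p , q) with ¬∀⇒∃¬ (noIP (FormulaWithParams.formula ψ))
      ... | d , none = d , λ n (e , h) → none ((λ i → back (FormulaWithParams.params ψ) (toℕ (e i))) , λ s →
        let (v , (x , eq) , at) = h s in x , λ i → mk⇔
          (λ t → trans (sym (at i)) (trans (eq (e i)) (holds (q (from (sat-back (FormulaWithParams.formula ψ) (FormulaWithParams.params ψ) x (toℕ (e i))) t)))))
          (λ t → to (sat-back (FormulaWithParams.formula ψ) (FormulaWithParams.params ψ) x (toℕ (e i))) (p (truth (trans (sym (eq (e i))) (trans (at i) t))))))

  module _ {m} {P : Fin m → Subset M k} (isPartition : IsMeasurablePartition {M = M} P) where
    open IsMeasurablePartition isPartition

    private
      c₀ : Fin m
      c₀ = proj₁ (covers (Vec.replicate k nonempty))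

    module _ (D : Fin m → Subset M k) (D-def : ∀ c → Def M k (D c)) where

      Bad : Subset M k
      Bad x = ∃[ c ] (P c △ D c) x

      exponent : ℕ
      exponent = total m (λ c → proj₁ (dimension (D-def c)))

      abstract
        -- The centres are read off from the joint patterns of visits to the `D c`: each single
        -- pattern is limited by Sauer-Shelah, the families of them by `product`.
        centres : ∀ n → Σ[ K ∈ List (ℕ → Fin m) ] List.length K ℕ.≤ suc n ℕ.^ exponent ×
          (∀ x → Σ[ j ∈ Fin (List.length K) ] (∀ i → i ℕ.< n → ¬ Bad (fold x g i) → P (List.lookup K j i) (fold x g i)))
        centres n = List.map centre Π , subst (ℕ._≤ suc n ℕ.^ exponent) (sym (List.length-map centre Π)) (proj₁ (proj₂ tuples)) , λ x →
            ListAny.index (found x) , λ i i<n good → subst (λ u → P (u i) (fold x g i)) (ListAny.lookup-index (found x)) (correct′ x i i<n good)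
          where
          patterns : ∀ c → Σ[ K ∈ List (Vec Bool n) ] List.length K ℕ.≤ suc n ℕ.^ proj₁ (dimension (D-def c)) ×
            (∀ v → ∃[ x ] (∀ i → lookup v i ≡ ⌊ D c (fold x g (toℕ i)) ⌋) → Contains v K)
          patterns c = sauerShelah n (proj₁ (dimension (D-def c))) (λ v → ∃[ x ] (∀ i → lookup v i ≡ ⌊ D c (fold x g (toℕ i)) ⌋)) (proj₂ (dimension (D-def c)) n)
          tuples : Σ[ Π ∈ List (Fin m → Vec Bool n) ] List.length Π ℕ.≤ suc n ℕ.^ exponent × (∀ f → (∀ c → Contains (f c) (proj₁ (patterns c))) → Contains f Π)
          tuples = product m (λ c → proj₁ (patterns c)) (suc n) (λ c → proj₁ (dimension (D-def c))) (λ c → proj₁ (proj₂ (patterns c)))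
          Π : List (Fin m → Vec Bool n)
          Π = proj₁ tuples
          -- At a good time `P c` and `D c` agree for every `c`, so any `c` with a true bit is the
          -- right cell and there is one. The default `c₀` can only occur at visits to `Bad`.
          centre : (Fin m → Vec Bool n) → ℕ → Fin m
          centre f i with em {P = ∃[ c ] Σ[ p ∈ i ℕ.< n ] lookup (f c) (fromℕ< p) ≡ true}
          ... | yes (c , _) = c
          ... | no _        = c₀
          name : Vec Domain k → Fin m → Vec Bool n
          name x c = Vec.tabulate λ i → ⌊ D c (fold x g (toℕ i)) ⌋
          name-at : ∀ x c i (p : i ℕ.< n) → lookup (name x c) (fromℕ< p) ≡ ⌊ D c (fold x g i) ⌋
          name-at x c i p = trans (Vec.lookup∘tabulate _ (fromℕ< p)) (cong (λ j → ⌊ D c (fold x g j) ⌋) (Fin.toℕ-fromℕ< p))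
          found : ∀ x → Contains (centre (name x)) (List.map centre Π)
          found x = ListAny.map⁺ (ListAny.map (cong centre) (proj₂ (proj₂ tuples) (name x) λ c → proj₂ (proj₂ (patterns c)) (name x c) (x , λ i → Vec.lookup∘tabulate _ i)))
          correct′ : ∀ x i → i ℕ.< n → ¬ Bad (fold x g i) → P (centre (name x) i) (fold x g i)
          correct′ x i i<n good with em {P = ∃[ c ] Σ[ p ∈ i ℕ.< n ] lookup (name x c) (fromℕ< p) ≡ true}
          ... | yes (c , p , t) = dne λ ¬P → good (c , inj₂ (truth (trans (sym (name-at x c i p)) t) , ¬P))
          ... | no none = let (c , r) = covers (fold x g i) in
            ⊥-elim (none (c , i<n , trans (name-at x c i i<n) (holds (dne λ ¬D → good (c , inj₁ (r , ¬D))))))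

    collect : ∀ {t k s n a b e η} → 0# ≤ n → k ≤ s → t + s ≤ η * n → a ≤ η → b * e ≤ η → t + (k + n * a) + b * (n * e) ≤ n * (η + η + η)
    collect {t} {k} {s} {n} {a} {b} {e} {η} 0≤n k≤s ts≤ a≤ be≤ = ≤-trans
      (≤-reflexive (trans (cong₂ _+_ (sym (+-assoc t k (n * a))) (solve 3 (λ b n e → b :* (n :* e) := n :* (b :* e)) refl b n e)) (+-assoc (t + k) (n * a) (n * (b * e)))))
      (≤-trans (+-mono-≤ (≤-trans (+-monoʳ-≤ t k≤s) ts≤) (+-mono-≤ (*-monoˡ-≤ 0≤n a≤) (*-monoˡ-≤ 0≤n be≤)))
        (≤-reflexive (solve 2 (λ n h → h :* n :+ (n :* h :+ n :* h) := n :* (h :+ h :+ h)) refl n η)))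

    -- One `η` pays for log 2 and the logarithm of the number of centres, one for the `n` factors α,
    -- and one for the expected visits to `E`.
    entropy-eventually : ∀ η → 0# < η → ∃[ N ] (∀ n → N ℕ.≤ n → H 𝓡 log measure (iteratedJoin σ P n) ≤ fromℕ n * (η + η + η))
    entropy-eventually η 0<η = N , bound
      where
      y₀ : ∃[ y ] 0# < y × y ≤ ½ × - log (1# - y) ≤ η
      y₀ = near-one η 0<η
      y α M# β : ℝ
      y  = proj₁ y₀
      α  = 1# - y
      M# = fromℕ m
      -- The mass `y` removed from 1 is shared equally by the `m` cells, so that α + mβ = 1.
      β  = y * M# ⁻¹
      1≤M# : 1# ≤ M#
      1≤M# = least-size c₀
        where
        least-size : ∀ {r} → Fin r → 1# ≤ fromℕ r
        least-size {suc r} _ = ≤-+-nonNeg (fromℕ-nonNeg r)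
      0<M# : 0# < M#
      0<M# = <-≤-trans 0<1 1≤M#
      0<y : 0# < y
      0<y = proj₁ (proj₂ y₀)
      y≤½ : y ≤ ½
      y≤½ = proj₁ (proj₂ (proj₂ y₀))
      ½≤1 : ½ ≤ 1#
      ½≤1 = subst (½ ≤_) ½+½ (≤-+-nonNeg (<⇒≤ 0<½))
      0<α : 0# < α
      0<α = <-≤-trans 0<½ (subst (_≤ 1# - y) (trans (cong (_- ½) (sym ½+½)) (solve 1 (λ h → h :+ h :- h := h) refl ½)) (+-monoʳ-≤ 1# (neg-mono y≤½)))
      α≤1 : α ≤ 1#
      α≤1 = ≤-by y (<⇒≤ 0<y) (solve 2 (λ o y → o :- y :+ y := o) refl 1# y)
      0<β : 0# < β
      0<β = *-pos 0<y (⁻¹-pos 0<M#)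
      M#β : M# * β ≡ y
      M#β = trans (solve 3 (λ m y i → m :* (y :* i) := y :* (m :* i)) refl M# y (M# ⁻¹)) (trans (cong (y *_) (*-inverse 0<M#)) (*-identityʳ y))
      β≤1 : β ≤ 1#
      β≤1 = ≤-trans (≤-trans (≤-reflexive (sym (*-identityˡ β))) (*-mono-≤ 0≤1 (<⇒≤ 0<β) 1≤M# ≤-refl)) (≤-trans (≤-reflexive M#β) (≤-trans y≤½ ½≤1))
      αβ : α + M# * β ≤ 1#
      αβ = ≤-reflexive (trans (cong (α +_) M#β) (solve 2 (λ o y → o :- y :+ y := o) refl 1# y))
      L₂ Λ : ℝ
      L₂ = - log β
      -- `L₂` is only known to be nonnegative; adding 1 makes the quantity invertible. With `δ` as
      -- below, the `m` errors together, multiplied by `Λ`, give exactly `η`.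
      Λ  = L₂ + 1#
      0≤L₂ : 0# ≤ L₂
      0≤L₂ = subst (_≤ L₂) (solve 0 (:- con (ℤ.+ 0) := con (ℤ.+ 0)) refl) (neg-mono (log-nonPos 0<β β≤1))
      0<Λ : 0# < Λ
      0<Λ = subst (0# <_) (+-comm 1# L₂) (+-pos-nonNeg 0<1 0≤L₂)
      δ : ℝ
      δ = η * (Λ * M#) ⁻¹
      0<ΛM : 0# < Λ * M#
      0<ΛM = *-pos 0<Λ 0<M#
      0<δ : 0# < δ
      0<δ = *-pos 0<η (⁻¹-pos 0<ΛM)
      D : Fin m → Subset M k
      D c = proj₁ (approximable (measurable c) δ 0<δ)
      D-def : ∀ c → Def M k (D c)
      D-def c = proj₁ (proj₂ (approximable (measurable c) δ 0<δ))
      E : Subset M k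
      E = Bad D D-def
      E-meas : Measurable E
      E-meas = meas-∃Fin λ c → meas-△ (measurable c) (generator (D-def c))
      L₂E : L₂ * μ E ≤ η
      L₂E = ≤-trans (*-mono-≤ 0≤L₂ (*-nonNeg (fromℕ-nonNeg m) (<⇒≤ 0<δ)) (≤-+-nonNeg 0≤1)
          (≤-trans (μ-∃Fin-≤ λ c → meas-△ (measurable c) (generator (D-def c))) (≤-trans (∑Fin-mono {f = λ c → μ (P c △ D c)} {g = λ _ → δ} λ c → proj₂ (proj₂ (approximable (measurable c) δ 0<δ))) (≤-reflexive (∑Fin-const m δ)))))
        (≤-reflexive (trans (solve 4 (λ l m h i → l :* (m :* (h :* i)) := h :* ((l :* m) :* i)) refl Λ M# η ((Λ * M#) ⁻¹)) (trans (cong (η *_) (*-inverse 0<ΛM)) (*-identityʳ η))))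
      sub : ∃[ N ] (∀ n → N ℕ.≤ n → log 2# + fromℕ (exponent D D-def) * log (fromℕ (suc n)) ≤ η * fromℕ n)
      sub = log-sublinear (log 2#) (fromℕ (exponent D D-def)) η (fromℕ-nonNeg (exponent D D-def)) 0<η
      N : ℕ
      N = proj₁ sub
      bound : ∀ n → N ℕ.≤ n → H 𝓡 log measure (iteratedJoin σ P n) ≤ fromℕ n * (η + η + η)
      bound n N≤n = go (centres D D-def n)
        where
        go : (Σ[ K ∈ List (ℕ → Fin m) ] List.length K ℕ.≤ suc n ℕ.^ exponent D D-def ×
          (∀ x → Σ[ j ∈ Fin (List.length K) ] (∀ i → i ℕ.< n → ¬ E (fold x g i) → P (List.lookup K j i) (fold x g i)))) →
          H 𝓡 log measure (iteratedJoin σ P n) ≤ fromℕ n * (η + η + η)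
        go ([] , _ , centre) = ⊥-elim (Fin.¬Fin0 (proj₁ (centre (Vec.replicate k nonempty))))
        go (u ∷ K , size , centre) = ≤-trans (entropy-≤ isPartition 0<α α≤1 0<β β≤1 αβ E-meas n (u ∷ K) centre (List.length K) refl)
          (collect {log 2#} {log (fromℕ (suc (List.length K)))} {fromℕ (exponent D D-def) * log (fromℕ (suc n))} {fromℕ n} {a = - log α} {L₂} {μ E} (fromℕ-nonNeg n) count (proj₂ sub n N≤n) (proj₂ (proj₂ (proj₂ y₀))) L₂E)
          where
          count : log (fromℕ (suc (List.length K))) ≤ fromℕ (exponent D D-def) * log (fromℕ (suc n))
          count = ≤-trans (log-≤ (fromℕ-pos (List.length K)) (≤-trans (fromℕ-mono size) (≤-reflexive (^-fromℕ (suc n) (exponent D D-def)))))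
            (≤-reflexive (log-^ (fromℕ-pos n) (exponent D D-def)))

    zeroEntropy : IsEntropyOfPartition 𝓡 log measure σ P 0#
    zeroEntropy ε 0<ε = finish (entropy-eventually η (half-pos (half-pos 0<ε)))
      where
      η : ℝ
      -- A quarter of `ε`, so that three of them remain strictly below `ε`.
      η = ½ * (½ * ε)
      three : η + η + η < ε
      three = subst (η + η + η <_) (trans (+-assoc (η + η) η η) (trans (cong (λ z → z + z) (half (½ * ε))) (half ε)))
        (subst₂ _<_ (+-identityˡ _) (+-comm η _) (+-monoˡ-< (η + η + η) (half-pos (half-pos 0<ε))))
      below : 0# - ε < 0#
      below = subst₂ _<_ (+-identityˡ _) (trans (cong (ε +_) (+-identityˡ (- ε))) (-‿inverseʳ ε)) (+-monoˡ-< (0# - ε) 0<ε)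
      scaled : ∀ n {h x} → h ≤ fromℕ (suc n) * x → fromℕ (suc n) ⁻¹ * h ≤ x
      scaled n {h} {x} le = ≤-trans (*-monoˡ-≤ (<⇒≤ (⁻¹-pos (fromℕ-pos n))) le)
        (≤-reflexive (trans (sym (*-assoc _ _ _)) (trans (cong (_* x) (trans (*-comm _ _) (*-inverse (fromℕ-pos n)))) (*-identityˡ x))))
      finish : (∃[ N ] (∀ n → N ℕ.≤ n → H 𝓡 log measure (iteratedJoin σ P n) ≤ fromℕ n * (η + η + η))) →
        ∃[ N ] (∀ n → N ℕ.≤ n → 0# - ε < fromℕ n ⁻¹ * H 𝓡 log measure (iteratedJoin σ P n) × fromℕ n ⁻¹ * H 𝓡 log measure (iteratedJoin σ P n) < 0# + ε)
      finish (N , bound) = suc N , λ { (suc n) (s≤s N≤n) →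
          <-≤-trans below (*-nonNeg (<⇒≤ (⁻¹-pos (fromℕ-pos n))) (entropy-nonNeg isPartition (suc n)))
        , ≤-<-trans (scaled n (bound (suc n) (ℕ.m≤n⇒m≤1+n N≤n))) (subst (η + η + η <_) (sym (+-identityˡ ε)) three) }

-- IP and the cardinality of the model

module Infinite (em : ∀ {a} → ExcludedMiddle a) (ext : ∀ {a b} → Extensionality a b) {ℓ} {L : Language ℓ} (M : Structure L) where
  open Classical em
  open Cardinal em ext
  open Logic em {L = L}
  open Structure M using (Domain)
  open Equivalence

  shattered-injective : ∀ {m n} (φ : Formula L (m ℕ.+ n)) {p} {b : Fin p → Vec Domain n} → Shatters {m} φ M b → ∀ {i j} → b i ≡ b j → i ≡ j
  shattered-injective φ {p} {b} sh {i} {j} eq with sh (Vec.tabulate λ t → ⌊ t ≡ i ⌋)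
  ... | a , f = sym (truth (trans (sym (Vec.lookup∘tabulate _ j)) (to (f j) (subst (λ u → Sat M φ (a ++ u)) eq (from (f i) (trans (Vec.lookup∘tabulate _ i) (holds refl)))))))

  -- Let the domain inject into ℕ. If the image is unbounded, the domain is countably infinite,
  -- which is excluded. If it is bounded by `B`, there are at most B^n tuples, while shattering
  -- makes the B^n + 1 tuples supplied by IP distinct.
  IP⇒uncountable : ∀ {m n} (φ : Formula L (m ℕ.+ n)) → IPIn {m} φ M → ¬ IsCountablyInfinite M → ¬ (Σ[ f ∈ (Domain → ℕ) ] Injective _≡_ _≡_ f)
  IP⇒uncountable {m} {n} φ ip ¬countable (f , f-inj) with em {P = ∀ B → ∃[ x ] B ℕ.≤ f x}
  ... | yes unbounded = ¬countable (unboundedCountable f f-inj unbounded)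
  ... | no bounded with ¬∀⇒∃¬ bounded
  ...   | B , none = ℕ.<-irrefl refl (Fin.injective⇒≤ {f = index} index-inj)
    where
    f< : ∀ x → f x ℕ.< B
    f< x = ℕ.≰⇒> λ le → none (x , le)
    b : Fin (suc (B ℕ.^ n)) → Vec Domain n
    b = proj₁ (ip (suc (B ℕ.^ n)))
    coordinates : Fin (suc (B ℕ.^ n)) → Fin n → Fin B
    coordinates i t = fromℕ< (f< (lookup (b i) t))
    index : Fin (suc (B ℕ.^ n)) → Fin (B ℕ.^ n)
    index i = Fin.funToFin (coordinates i)
    index-inj : ∀ {i j} → index i ≡ index j → i ≡ j
    index-inj {i} {j} eq = shattered-injective {m} φ (proj₂ (ip (suc (B ℕ.^ n)))) (trans (sym (Vec.tabulate∘lookup (b i))) (trans (Vec.tabulate-cong λ t →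
      f-inj (trans (sym (Fin.toℕ-fromℕ< (f< (lookup (b i) t)))) (trans (cong toℕ (trans (sym (Fin.finToFun-funToFin (coordinates i) t)) (trans (cong (λ c → Fin.finToFun c t) eq) (Fin.finToFun-funToFin (coordinates j) t))))
        (Fin.toℕ-fromℕ< (f< (lookup (b j) t)))))) (Vec.tabulate∘lookup (b j))))

theorem3p16 :
    (∀ {a} → ExcludedMiddle a) →
    (∀ {a b} → Extensionality a b) →
    (𝓡 : RealNumbers) → let open RealNumbers 𝓡 in
    (log : ℝ → ℝ) → IsLogarithm log →
    ∀ {ℓ} (L : Language ℓ) (T : Theory L) → IsComplete T →
    (M : Structure L) → IsModelOf M T → IsSaturated M →
    ¬ IsCountablyInfinite M →
    (k : ℕ) → NonZero k →
    NIP T ⇔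
      ((σ : Automorphism M) (μ : Measure 𝓡 M k) → IsInvariant 𝓡 σ μ →
        IsEntropy 𝓡 log μ σ 0#)
theorem3p16 em ext 𝓡 log isLog L T complete M M⊨T saturated ¬countable (suc k) _ = mk⇔ nip⇒zero zero⇒nip
  where
  open RealNumbers 𝓡 using (0#)
  open Logic em {L = L}
  open Reals em 𝓡 using (≤-reflexive)

  nip⇒zero : NIP T → (σ : Automorphism M) (μ : Measure 𝓡 M (suc k)) → IsInvariant 𝓡 σ μ → IsEntropy 𝓡 log μ σ 0#
  nip⇒zero nip σ μ invariant = (λ _ → 0#) , (λ (_ , _ , isPartition) → Zero.zeroEntropy isPartition) ,
      (λ { _ (_ , refl) → ≤-reflexive refl }) , λ b ub → ub 0# (trivial , refl)
    where
    noIP : ∀ {n} (φ : Formula L (suc k ℕ.+ n)) → ¬ IPIn {suc k} {n} φ M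
    -- `HasIP` speaks of every model of `T`; completeness carries the shattering from `M` to all of
    -- them.
    noIP φ ip = nip (suc k) _ φ (IPIn⇒HasIP {suc k} φ (IPIn-transfer {suc k} φ complete M⊨T ip))
    module Zero = ZeroEntropy em ext 𝓡 log isLog noIP σ μ invariant
    -- Some partition is needed for 0 to be attained, and hence to lie below every upper bound.
    trivial : FinitePartition M (suc k)
    trivial = 1 , (λ _ → U) , record
      { measurable = λ _ → generator (Parameters.Def-U M)
      ; disjoint   = λ { zero zero ne → ⊥-elim (ne refl) }
      ; covers     = λ _ → zero , _
      }

  zero⇒nip : ((σ : Automorphism M) (μ : Measure 𝓡 M (suc k)) → IsInvariant 𝓡 σ μ → IsEntropy 𝓡 log μ σ 0#) → NIP T
  zero⇒nip zero-entropy m n φ hasIP = entropy-nonzero log isLog (zero-entropy σ measure measure-invariant)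
    where
    ip : IPIn {m} {n} φ M
    ip = HasIP⇒IPIn {m} φ hasIP M⊨T
    uncountable : ¬ (Σ[ f ∈ (Structure.Domain M → ℕ) ] Injective _≡_ _≡_ f)
    uncountable = Infinite.IP⇒uncountable em ext M {m} φ ip ¬countable
    reduced : ∃[ n′ ] Σ[ ψ ∈ Formula L (1 ℕ.+ n′) ] IPIn {1} {n′} ψ M
    reduced = Reduction.reduce em ext M saturated uncountable m φ ip
    open PositiveEntropy em ext 𝓡 M saturated uncountable (proj₁ (proj₂ reduced)) (proj₂ (proj₂ reduced)) k
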